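{- Let $T$ be a tree on $n\ge 4$ vertices, let $v_1$ and $v_c$ be two non-adjacent vertices of $T$, let $v_1,v_2,\dots,v_c$ be the unique path in $T$ from $v_1$ to $v_c$ (so $c\ge3$), and let $G$ be the graph obtained from $T$ by adding the edge $v_1v_c$. Then $$\begin{aligned}\mathcal{K}(G)-\mathcal{K}(T)\le \frac{1}{4cn(n-1)}\Big\{&4c\cdot\tfrac{2}{3}(n-c+1)(n-c)(n-c-1)\\ &-8(n-c)\Big(-nc\left\lfloor\tfrac{c+1}{2}\right\rfloor\left\lceil\tfrac{c+1}{2}\right\rceil+\tfrac{c(c+1)}{6}\big((2n+1)c+n-1\big)\Big)\\ &-\tfrac{4(n+1)c^2(c^2-1)}{6}+4n(n-1)c(c-1)+2(n-1)c^2\Big\}.\end{aligned}$$ Moreover, equality holds if and only if $T$ is the tree obtained by identifying an end vertex of a path on $n-c+1$ vertices with the middle vertex (or one of the two middle vertices if $c$ is even) of the path $v_1,v_2,\dots,v_c$.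
   Context: Kemeny's constant: for a connected graph $H$ with adjacency matrix $A$ and diagonal degree matrix $\Delta$, consider the random walk with transition matrix $\Delta^{ -1}A$, its stationary distribution $w=(w_k)$ and mean first passage times $m_{j,k}$; then $\mathcal{K}(H)=\sum_{k\neq j} m_{j,k}w_k$, which is independent of $j$. -}

module Defs where

open import Data.Bool.Base using (if_then_else_)
open import Data.Fin.Base using (Fin; zero; suc; toℕ; fromℕ; inject₁)
open import Data.Fin.Properties using (_≟_)
open import Data.Integer.Base using (+_)
open import Data.Nat.Base as ℕ using (ℕ; zero; suc; _∸_; ⌊_/2⌋; ⌈_/2⌉)
import Data.Nat.Properties as ℕ
open import Data.Product.Base using (_×_; _,_; ∃-syntax)
open import Data.Rational.Base using (ℚ; 0ℚ; 1ℚ; _/_; _+_; _*_; _-_; -_; _≤_; _<_; ∣_∣)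
open import Data.Rational.Properties using (+-*-commutativeRing)
open import Data.Sum.Base using (_⊎_; inj₁; inj₂)
open import Algebra.Bundles using (CommutativeRing)
import Algebra.Properties.Semiring.Sum as SemiringSum
open import Function.Bundles using (_⇔_)
open import Function.Definitions using (Injective)
open import Level using (0ℓ)
open import Relation.Binary.Construct.Closure.ReflexiveTransitive using (Star)
open import Relation.Binary.Core using (Rel)
open import Relation.Binary.Definitions using (Decidable; Irreflexive; Symmetric)
open import Relation.Binary.PropositionalEquality using (_≡_; _≢_; refl; sym; trans)
open import Relation.Nullary using (¬_; does)
open import Relation.Nullary.Decidable using (_×-dec_; _⊎-dec_)

open SemiringSum (CommutativeRing.semiring +-*-commutativeRing) using (sum-syntax)
open SemiringSum ℕ.+-*-semiring using () renaming (sum to sumℕ)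

------------------------------------------------------------------------
-- Finite simple graphs

record Graph (n : ℕ) : Set₁ where
  field
    Adj        : Rel (Fin n) 0ℓ
    adj?       : Decidable Adj
    Adj-sym    : Symmetric Adj
    Adj-irrefl : Irreflexive _≡_ Adj

open Graph public using (Adj; adj?)

addEdge : ∀ {n} (G : Graph n) {u v : Fin n} → u ≢ v → Graph n
addEdge {n} G {u} {v} u≢v = record
  { Adj        = Adj⁺
  ; adj?       = λ i j → adj? G i j ⊎-dec ((i ≟ u ×-dec j ≟ v) ⊎-dec (i ≟ v ×-dec j ≟ u))
  ; Adj-sym    = sym⁺
  ; Adj-irrefl = irrefl⁺
  }
  where
  Adj⁺ : Rel (Fin n) 0ℓ
  Adj⁺ i j = Adj G i j ⊎ ((i ≡ u × j ≡ v) ⊎ (i ≡ v × j ≡ u))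

  sym⁺ : Symmetric Adj⁺
  sym⁺ (inj₁ a)              = inj₁ (Graph.Adj-sym G a)
  sym⁺ (inj₂ (inj₁ (p , q))) = inj₂ (inj₂ (q , p))
  sym⁺ (inj₂ (inj₂ (p , q))) = inj₂ (inj₁ (q , p))

  irrefl⁺ : Irreflexive _≡_ Adj⁺
  irrefl⁺ i≡j  (inj₁ a)              = Graph.Adj-irrefl G i≡j a
  irrefl⁺ refl (inj₂ (inj₁ (p , q))) = u≢v (trans (sym p) q)
  irrefl⁺ refl (inj₂ (inj₂ (p , q))) = u≢v (trans (sym q) p)

pathGraph : ∀ m → Graph m
pathGraph m = record
  { Adj        = λ i j → suc (toℕ i) ≡ toℕ j ⊎ suc (toℕ j) ≡ toℕ i
  ; adj?       = λ i j → (suc (toℕ i) ℕ.≟ toℕ j) ⊎-dec (suc (toℕ j) ℕ.≟ toℕ i)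
  ; Adj-sym    = λ { (inj₁ e) → inj₂ e ; (inj₂ e) → inj₁ e }
  ; Adj-irrefl = λ { refl (inj₁ e) → ℕ.1+n≢n e ; refl (inj₂ e) → ℕ.1+n≢n e }
  }

-- p lists the suc k distinct vertices of a path from u to v, so the
-- path has k edges.
record IsPath {n} (G : Graph n) (u v : Fin n) {k} (p : Fin (suc k) → Fin n) : Set where
  field
    injective : Injective _≡_ _≡_ p
    adjacent  : ∀ (i : Fin k) → Adj G (p (inject₁ i)) (p (suc i))
    start     : p zero ≡ u
    end       : p (fromℕ k) ≡ v

Connected : ∀ {n} → Graph n → Set
Connected G = ∀ u v → Star (Adj G) u v

-- A cycle is a path on at least three vertices whose ends are adjacent.
Acyclic : ∀ {n} → Graph n → Set
Acyclic {n} G = ∀ {u v : Fin n} {k} (p : Fin (3 ℕ.+ k) → Fin n) →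
                IsPath G u v p → ¬ Adj G v u

IsTree : ∀ {n} → Graph n → Set
IsTree G = Connected G × Acyclic G

-- G is obtained from disjoint copies of H and K by identifying the
-- vertex x of H with the vertex y of K; f and g are the resulting
-- inclusions of H and K into G.
record IsIdentification {a b n} (H : Graph a) (x : Fin a) (K : Graph b) (y : Fin b)
                        (G : Graph n) (f : Fin a → Fin n) (g : Fin b → Fin n) : Set where
  field
    f-injective : Injective _≡_ _≡_ f
    g-injective : Injective _≡_ _≡_ g
    glue        : f x ≡ g y
    glue-only   : ∀ {i j} → f i ≡ g j → i ≡ x × j ≡ y
    cover       : ∀ v → (∃[ i ] f i ≡ v) ⊎ (∃[ j ] g j ≡ v)
    edges       : ∀ u v → Adj G u v ⇔
                  ( (∃[ i ] ∃[ j ] Adj H i j × f i ≡ u × f j ≡ v)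
                  ⊎ (∃[ i ] ∃[ j ] Adj K i j × g i ≡ u × g j ≡ v))

-- Indices start at 0: the first disjunct is the middle of an odd path,
-- the other two are the two middles of an even path.
IsMiddle : ∀ {c} → Fin c → Set
IsMiddle {c} i = c ≡ 2 ℕ.* toℕ i ℕ.+ 1 ⊎ (c ≡ 2 ℕ.* toℕ i ⊎ c ≡ 2 ℕ.* toℕ i ℕ.+ 2)

IsEnd : ∀ {k} → Fin (suc k) → Set
IsEnd {k} y = y ≡ zero ⊎ y ≡ fromℕ k

-- For a path p on c vertices in T, the pendant path has n - c + 1
-- vertices; the truncated subtraction is exact since p is injective.
IsExtremal : ∀ {n} (T : Graph n) {c} (p : Fin c → Fin n) → Set
IsExtremal {n} T {c} p =
  ∃[ x ] IsMiddle x ×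
  (∃[ y ] IsEnd y ×
  (∃[ q ] IsIdentification (pathGraph c) x (pathGraph (suc (n ∸ c))) y T p q))

------------------------------------------------------------------------
-- Random walk and Kemeny's constant

ι : ℕ → ℚ
ι k = + k / 1

-- Reciprocal, with the convention 1/0 = 0.
recip : ℕ → ℚ
recip zero    = 0ℚ
recip (suc k) = + 1 / suc k

adjacency : ∀ {n} → Graph n → Fin n → Fin n → ℕ
adjacency G i j = if does (adj? G i j) then 1 else 0

degree : ∀ {n} → Graph n → Fin n → ℕ
degree G i = sumℕ (adjacency G i)

transition : ∀ {n} → Graph n → Fin n → Fin n → ℚ
transition G i j = recip (degree G i) * ι (adjacency G i j)

∑≢ : ∀ {n} → Fin n → (Fin n → ℚ) → ℚ
∑≢ {n} k f = ∑[ l < n ] (if does (l ≟ k) then 0ℚ else f l)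

record IsStationary {n} (G : Graph n) (w : Fin n → ℚ) : Set where
  field
    nonneg    : ∀ k → 0ℚ ≤ w k
    total     : ∑[ k < n ] w k ≡ 1ℚ
    invariant : ∀ k → ∑[ j < n ] (w j * transition G j k) ≡ w k

-- Probability that the walk started at j visits k for the first time
-- (after time 0) at step t.
firstPassage : ∀ {n} → Graph n → ℕ → Fin n → Fin n → ℚ
firstPassage G zero          j k = 0ℚ
firstPassage G (suc zero)    j k = transition G j k
firstPassage G (suc (suc t)) j k = ∑≢ k (λ l → transition G j l * firstPassage G (suc t) l k)

HasSum : (ℕ → ℚ) → ℚ → Set
HasSum a s = ∀ ε → 0ℚ < ε → ∃[ N ] ∀ M → N ℕ.≤ M → ∣ (∑[ t < M ] a (toℕ t)) - s ∣ < ε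

-- m j k is the expected time of the first passage from j to k.
IsMeanFirstPassage : ∀ {n} → Graph n → (Fin n → Fin n → ℚ) → Set
IsMeanFirstPassage G m = ∀ j k → HasSum (λ t → ι t * firstPassage G t j k) (m j k)

-- For connected G the value does not depend on the initial vertex, so
-- any one will do.  Stationary distribution and mean first passage times
-- solve rational linear systems, hence are rational.
record IsKemeny {n} (G : Graph n) (κ : ℚ) : Set where
  field
    w           : Fin n → ℚ
    m           : Fin n → Fin n → ℚ
    stationary  : IsStationary G w
    meanPassage : IsMeanFirstPassage G m
    initial     : Fin n
    value       : κ ≡ ∑≢ initial (λ k → m initial k * w k)

------------------------------------------------------------------------
-- The bound

-- Stated in ℚ, so the subtractions are genuine, except for n ∸ 1 in the
-- denominator, which is exact for n ≥ 1.
bound : ℕ → ℕ → ℚ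
bound n c = recip (4 ℕ.* c ℕ.* n ℕ.* (n ∸ 1)) *
  ( ι 4 * C * (+ 2 / 3) * (N - C + 1ℚ) * (N - C) * (N - C - 1ℚ)
  - ι 8 * (N - C) *
      ( - (N * C * ι ⌊ suc c /2⌋ * ι ⌈ suc c /2⌉)
      + C * (C + 1ℚ) * (+ 1 / 6) * ((ι 2 * N + 1ℚ) * C + N - 1ℚ))
  - ι 4 * (N + 1ℚ) * C * C * (C * C - 1ℚ) * (+ 1 / 6)
  + ι 4 * N * (N - 1ℚ) * C * (C - 1ℚ)
  + ι 2 * (N - 1ℚ) * C * C)
  where
  N = ι n
  C = ι c

{-# OPTIONS --safe #-}
-- Write L for the Laplacian and let R be s times the resistance metric, so that
-- L R(·, z) = c - 2 s δ_z for some function c.  Then hitting times are explicit in R, and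
-- Kemeny's constant is the degree-weighted sum of R over all pairs of vertices
-- divided by 2 s times the sum of the degrees.  For a tree R is the distance d;
-- adding the edge v₁v_c turns it into d - (a - a')²/c, where a is the index on
-- the path v₁ … v_c of the vertex closest to the given one (its foot).  Since the weights 2 - deg
-- integrate d, a and a² to explicit constants, K(G) - K(T) becomes a combination
-- of the sums of d, of (a - a')² and of the distances h to the path (heights).
--
-- The bound follows from three estimates: d ≥ |h - h'| + |a - a'|; at most
-- n - c - t vertices have height above t, because a tree has a vertex at every
-- height below the maximal one; and a vertex off the path contributes least when
-- its foot is a middle of the path.  The bound minus the value is a sum of
-- nonnegative terms, which all vanish iff d = |h - h'| + |a - a'| and all
-- vertices off the path have the same, middle, foot.  Heights are then distinct off the
-- path, so these vertices form a pendant path.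
module Submission where

open import Defs
open import Algebra.Bundles using (CommutativeRing)
import Algebra.Properties.Semiring.Sum as SemiringSum
open import Data.Bool.Base using (true; false; if_then_else_)
open import Data.Fin.Base as Fin using (Fin; zero; suc; toℕ; fromℕ; fromℕ<; inject₁; opposite)
import Data.Fin.Properties as Fin
open import Data.Fin.Induction using (<-weakInduction)
open import Data.Fin.Properties using (_≟_)
import Data.Integer.Base as ℤ
import Data.Integer.Properties as ℤ
open import Data.Nat.Base as ℕ using (ℕ; zero; suc; _∸_; z≤n; s≤s; ⌊_/2⌋; ⌈_/2⌉)
import Data.Nat.Properties as ℕ
open import Data.Product.Base using (_×_; _,_; ∃-syntax; Σ-syntax; proj₁; proj₂)
open import Data.Rational.Base using (ℚ; 0ℚ; 1ℚ; ½; _/_; _+_; _*_; _-_; -_; _≤_; _<_; ∣_∣; 1/_; nonNegative; ≢-nonZero; toℚᵘ)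
open import Data.Rational.Properties using (+-*-commutativeRing)
import Data.Rational.Properties as ℚ
import Data.Rational.Unnormalised.Base as ℚᵘ
import Data.Rational.Unnormalised.Properties as ℚᵘ
open import Data.Sum.Base using (_⊎_; inj₁; inj₂)
open import Function.Base using (_∘_; _$_)
open import Function.Bundles using (_⇔_; mk⇔; Equivalence)
import Relation.Binary.Construct.Closure.ReflexiveTransitive as Star
open import Relation.Binary.Construct.Closure.ReflexiveTransitive using (Star; _◅_; _◅◅_) renaming (ε to done)
open import Relation.Binary.Core using (Rel)
open import Relation.Binary.Definitions using (Decidable; tri<; tri≈; tri>)
open import Relation.Binary.PropositionalEquality using (_≡_; _≢_; refl; sym; trans; cong; cong₂; subst; subst₂; module ≡-Reasoning)
open import Relation.Nullary using (¬_; Dec; yes; no; does)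
open import Level using (0ℓ)
open import Relation.Nullary.Decidable using (dec⇒maybe; decidable-stable; _×-dec_; ¬?; dec-true; dec-false)
open import Relation.Nullary.Negation using (contradiction)
open import Tactic.RingSolver using (solve-∀)
open import Tactic.RingSolver.Core.AlmostCommutativeRing using (AlmostCommutativeRing; fromCommutativeRing)
open SemiringSum (CommutativeRing.semiring +-*-commutativeRing) using (sum; sum-syntax; sum-cong-≗; ∑-distrib-+; *-distribˡ-sum; ∑-comm)
open SemiringSum ℕ.+-*-semiring using () renaming (sum to sumℕ)

-- After clearing denominators the difference of the constants is `-4cW - 4(n-1)Q + 8c(n-1)H` plus a
-- constant, where `W`, `Q`, `H` are the sums of d, (a - a')² and h. Splitting d into |h - h'| + |a
-- - a'| and an excess decouples heights from feet. Heights: with M_t vertices of height above t,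
-- the sum of |h - h'| is `2nH` minus twice the sum of M_t², so the multiples of `nH` cancel and 8c
-- ∑ M_t (M_t - 1) remains, which is largest for M_t = n - c - t. Feet: |a - a'| and (a - a')²
-- combine into a `gap` whose sum over all positions a' on the path is a constant plus cn(2a - c +
-- 1)². The least value of this square is 0 or 1 by the parity of c - 1, which is what the floor and
-- the ceiling in the bound encode.
--
-- Mean first passage times are given as sums of series, so their linear equations have to be
-- derived. This includes almost sure arrival: the total first-passage probability is a limit
-- satisfying an equation whose only solution is the constant 1.

ℚ-ring : AlmostCommutativeRing _ _
ℚ-ring = fromCommutativeRing +-*-commutativeRing (λ x → dec⇒maybe (0ℚ ℚ.≟ x))

-- Naturals and decidable propositions as rationals

toℚᵘ-ι : ∀ k → toℚᵘ (ι k) ℚᵘ.≃ ℚᵘ.mkℚᵘ (ℤ.+ k) 0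
toℚᵘ-ι k = ℚ.toℚᵘ-fromℚᵘ (ℚᵘ.mkℚᵘ (ℤ.+ k) 0)

ι-+ : ∀ m n → ι (m ℕ.+ n) ≡ ι m + ι n
ι-+ m n = ℚ.toℚᵘ-injective (ℚᵘ.≃-trans (toℚᵘ-ι (m ℕ.+ n)) (ℚᵘ.≃-trans step
    (ℚᵘ.≃-sym (ℚᵘ.≃-trans (ℚ.toℚᵘ-homo-+ (ι m) (ι n)) (ℚᵘ.+-cong (toℚᵘ-ι m) (toℚᵘ-ι n))))))
  where
  step : ℚᵘ.mkℚᵘ (ℤ.+ (m ℕ.+ n)) 0 ℚᵘ.≃ ℚᵘ.mkℚᵘ (ℤ.+ m) 0 ℚᵘ.+ ℚᵘ.mkℚᵘ (ℤ.+ n) 0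
  step = ℚᵘ.*≡* (cong (ℤ._* (ℤ.+ 1)) (sym (cong₂ ℤ._+_ (ℤ.*-identityʳ (ℤ.+ m)) (ℤ.*-identityʳ (ℤ.+ n)))))

ι-* : ∀ m n → ι (m ℕ.* n) ≡ ι m * ι n
ι-* m n = ℚ.toℚᵘ-injective (ℚᵘ.≃-trans (toℚᵘ-ι (m ℕ.* n)) (ℚᵘ.≃-trans step
    (ℚᵘ.≃-sym (ℚᵘ.≃-trans (ℚ.toℚᵘ-homo-* (ι m) (ι n)) (ℚᵘ.*-cong (toℚᵘ-ι m) (toℚᵘ-ι n))))))
  where
  step : ℚᵘ.mkℚᵘ (ℤ.+ (m ℕ.* n)) 0 ℚᵘ.≃ ℚᵘ.mkℚᵘ (ℤ.+ m) 0 ℚᵘ.* ℚᵘ.mkℚᵘ (ℤ.+ n) 0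
  step = ℚᵘ.*≡* (cong (ℤ._* (ℤ.+ 1)) (ℤ.pos-* m n))

ι-suc : ∀ n → ι (suc n) ≡ 1ℚ + ι n
ι-suc = ι-+ 1

ι-mono : ∀ {m n} → m ℕ.≤ n → ι m ≤ ι n
ι-mono {m} {n} m≤n = ℚ.toℚᵘ-cancel-≤ (ℚᵘ.≤-respˡ-≃ (ℚᵘ.≃-sym (toℚᵘ-ι m)) (ℚᵘ.≤-respʳ-≃ (ℚᵘ.≃-sym (toℚᵘ-ι n))
  (ℚᵘ.*≤* (ℤ.*-monoʳ-≤-nonNeg (ℤ.+ 1) (ℤ.+≤+ m≤n)))))

ι-injective : ∀ {m n} → ι m ≡ ι n → m ≡ n
ι-injective {m} {n} e with ℚᵘ.≃-trans (ℚᵘ.≃-sym (toℚᵘ-ι m)) (ℚᵘ.≃-trans (ℚ.toℚᵘ-cong e) (toℚᵘ-ι n))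
... | ℚᵘ.*≡* p = ℤ.+-injective (trans (sym (ℤ.*-identityʳ (ℤ.+ m))) (trans p (ℤ.*-identityʳ (ℤ.+ n))))

0≤ι : ∀ n → 0ℚ ≤ ι n
0≤ι n = ι-mono {0} {n} z≤n

ι-sum : ∀ {n} (f : Fin n → ℕ) → ι (sumℕ f) ≡ sum (ι ∘ f)
ι-sum {zero}  f = refl
ι-sum {suc n} f = trans (ι-+ (f zero) (sumℕ (f ∘ suc))) (cong (ι (f zero) +_) (ι-sum (f ∘ suc)))

⟦_⟧ : ∀ {P : Set} → Dec P → ℚ
⟦ P? ⟧ = if does P? then 1ℚ else 0ℚ

⟦⟧-yes : ∀ {P : Set} (P? : Dec P) → P → ⟦ P? ⟧ ≡ 1ℚ
⟦⟧-yes P? p = cong (if_then 1ℚ else 0ℚ) (dec-true P? p)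

⟦⟧-no : ∀ {P : Set} (P? : Dec P) → ¬ P → ⟦ P? ⟧ ≡ 0ℚ
⟦⟧-no P? ¬p = cong (if_then 1ℚ else 0ℚ) (dec-false P? ¬p)

0≤⟦⟧ : ∀ {P : Set} (P? : Dec P) → 0ℚ ≤ ⟦ P? ⟧
0≤⟦⟧ (yes _) = 0≤ι 1
0≤⟦⟧ (no _)  = ℚ.≤-refl

-- Ordered field facts

0≤+ : ∀ {p q} → 0ℚ ≤ p → 0ℚ ≤ q → 0ℚ ≤ p + q
0≤+ = ℚ.+-mono-≤

0≤* : ∀ {p q} → 0ℚ ≤ p → 0ℚ ≤ q → 0ℚ ≤ p * q
0≤* {p} {q} 0≤p 0≤q = subst (_≤ p * q) (ℚ.*-zeroˡ q) (ℚ.*-monoʳ-≤-nonNeg q {{nonNegative 0≤q}} 0≤p)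

p≤q⇒0≤q-p : ∀ {p q} → p ≤ q → 0ℚ ≤ q - p
p≤q⇒0≤q-p {p} {q} p≤q = subst (_≤ q - p) (ℚ.+-inverseʳ p) (ℚ.+-monoˡ-≤ (- p) p≤q)

p-q≡0⇒p≡q : ∀ {p q} → p - q ≡ 0ℚ → p ≡ q
p-q≡0⇒p≡q {p} {q} e = trans (lemma p q) (trans (cong (_+ q) e) (ℚ.+-identityˡ q))
  where
  lemma : ∀ p q → p ≡ p - q + q
  lemma = solve-∀ ℚ-ring

0≤q-p⇒p≤q : ∀ {p q} → 0ℚ ≤ q - p → p ≤ q
0≤q-p⇒p≤q {p} {q} h = subst₂ _≤_ (ℚ.+-identityˡ p) (lemma q p) (ℚ.+-monoˡ-≤ p h)
  where
  lemma : ∀ q p → q - p + p ≡ q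
  lemma = solve-∀ ℚ-ring

*-cancelˡ : ∀ {r p q} → r ≢ 0ℚ → r * p ≡ r * q → p ≡ q
*-cancelˡ {r} {p} {q} r≢0 e = trans (undo p) (trans (cong (1/ r *_) e) (sym (undo q)))
  where
  instance _ = ≢-nonZero r≢0
  undo : ∀ p → p ≡ 1/ r * (r * p)
  undo p = sym (trans (sym (ℚ.*-assoc (1/ r) r p)) (trans (cong (_* p) (ℚ.*-inverseˡ r)) (ℚ.*-identityˡ p)))

p*p≡0⇒p≡0 : ∀ {p} → p * p ≡ 0ℚ → p ≡ 0ℚ
p*p≡0⇒p≡0 {p} e with p ℚ.≟ 0ℚ
... | yes p≡0 = p≡0
... | no p≢0  = *-cancelˡ p≢0 (trans e (sym (ℚ.*-zeroʳ p)))

0≤p*p : ∀ p → 0ℚ ≤ p * p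
0≤p*p p with ℚ.≤-total 0ℚ p
... | inj₁ 0≤p = 0≤* 0≤p 0≤p
... | inj₂ p≤0 = subst (0ℚ ≤_) (lemma p) (0≤* 0≤-p 0≤-p)
  where
  0≤-p = ℚ.neg-antimono-≤ p≤0
  lemma : ∀ p → - p * - p ≡ p * p
  lemma = solve-∀ ℚ-ring

0≤+≡0⇒≡0ˡ : ∀ {p q} → 0ℚ ≤ p → 0ℚ ≤ q → p + q ≡ 0ℚ → p ≡ 0ℚ
0≤+≡0⇒≡0ˡ {p} {q} 0≤p 0≤q e = ℚ.≤-antisym (subst₂ _≤_ (ℚ.+-identityʳ p) e (ℚ.+-monoʳ-≤ p 0≤q)) 0≤p

0≤+≡0⇒≡0ʳ : ∀ {p q} → 0ℚ ≤ p → 0ℚ ≤ q → p + q ≡ 0ℚ → q ≡ 0ℚ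
0≤+≡0⇒≡0ʳ {p} {q} 0≤p 0≤q e = 0≤+≡0⇒≡0ˡ 0≤q 0≤p (trans (ℚ.+-comm q p) e)

recip-* : ∀ {k} → k ≢ 0 → recip k * ι k ≡ 1ℚ
recip-* {zero} k≢0 = contradiction refl k≢0
recip-* {suc k} _ = ℚ.toℚᵘ-injective (ℚᵘ.≃-trans (ℚ.toℚᵘ-homo-* (recip (suc k)) (ι (suc k)))
  (ℚᵘ.≃-trans (ℚᵘ.*-cong (ℚ.toℚᵘ-fromℚᵘ (ℚᵘ.mkℚᵘ (ℤ.+ 1) k)) (toℚᵘ-ι (suc k)))
  (ℚᵘ.*≡* (trans (ℤ.*-identityʳ (ℤ.+ 1 ℤ.* ℤ.+ suc k)) (trans (ℤ.*-identityˡ (ℤ.+ suc k))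
    (sym (trans (ℤ.*-identityˡ (ℤ.+ (suc k ℕ.* 1))) (cong ℤ.+_ (ℕ.*-identityʳ (suc k))))))))))

0≤recip : ∀ k → 0ℚ ≤ recip k
0≤recip zero    = ℚ.≤-refl
0≤recip (suc k) = ℚ.nonNegative⁻¹ (recip (suc k)) {{ℚ.normalize-nonNeg 1 (suc k)}}

-- Finite sums

module _ {n : ℕ} where
  ∑-scale : ∀ α (f : Fin n → ℚ) → ∑[ i < n ] (α * f i) ≡ α * sum f
  ∑-scale α f = sym (*-distribˡ-sum α f)

  ∑-lin₂ : ∀ {h f g : Fin n → ℚ} α β → (∀ i → h i ≡ α * f i + β * g i) → sum h ≡ α * sum f + β * sum g
  ∑-lin₂ {h} {f} {g} α β e = trans (sum-cong-≗ e) (trans (∑-distrib-+ (λ i → α * f i) (λ i → β * g i)) (cong₂ _+_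
      (∑-scale α f) (∑-scale β g)))

  ∑-lin₁ : ∀ {h f : Fin n → ℚ} α → (∀ i → h i ≡ α * f i) → sum h ≡ α * sum f
  ∑-lin₁ {h} {f} α e = trans (sum-cong-≗ e) (∑-scale α f)

  ∑-lin₃ : ∀ {h f g u : Fin n → ℚ} α β γ → (∀ i → h i ≡ α * f i + β * g i + γ * u i) →
           sum h ≡ α * sum f + β * sum g + γ * sum u
  ∑-lin₃ {f = f} {g} {u} α β γ e = trans (sum-cong-≗ e) (trans (∑-distrib-+ (λ i → α * f i + β * g i) (λ i → γ * u i))
      (cong₂ _+_ (∑-lin₂ α β λ _ → refl) (∑-scale γ u)))

  ∑-lin₄ : ∀ {h f g u v : Fin n → ℚ} α β γ κ → (∀ i → h i ≡ α * f i + β * g i + γ * u i + κ * v i) →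
           sum h ≡ α * sum f + β * sum g + γ * sum u + κ * sum v
  ∑-lin₄ {f = f} {g} {u} {v} α β γ κ e = trans (sum-cong-≗ e) (trans (∑-distrib-+ (λ i → α * f i + β * g i + γ * u i)
      (λ i → κ * v i)) (cong₂ _+_ (∑-lin₃ α β γ λ _ → refl) (∑-scale κ v)))

  ∑-distrib-- : ∀ (f g : Fin n → ℚ) → ∑[ i < n ] (f i - g i) ≡ sum f - sum g
  ∑-distrib-- f g = trans (∑-lin₂ 1ℚ (- 1ℚ) (λ i → lemma (f i) (g i))) (sym (lemma (sum f) (sum g)))
    where
    lemma : ∀ p q → p - q ≡ 1ℚ * p + - 1ℚ * q
    lemma = solve-∀ ℚ-ring

∑-0 : ∀ {n} {f : Fin n → ℚ} → (∀ i → f i ≡ 0ℚ) → sum f ≡ 0ℚ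
∑-0 {zero}  e = refl
∑-0 {suc n} e = cong₂ _+_ (e zero) (∑-0 (e ∘ suc))

∑-const : ∀ n α → ∑[ i < n ] α ≡ ι n * α
∑-const zero    α = sym (ℚ.*-zeroˡ α)
∑-const (suc n) α = trans (cong (α +_) (∑-const n α)) (sym (trans (cong (_* α) (ι-suc n)) (lemma α (ι n))))
  where
  lemma : ∀ α n → (1ℚ + n) * α ≡ α + n * α
  lemma = solve-∀ ℚ-ring

∑-point : ∀ {n} {f : Fin n → ℚ} i → (∀ j → j ≢ i → f j ≡ 0ℚ) → sum f ≡ f i
∑-point {f = f} zero e = trans (cong (f zero +_) (∑-0 λ j → e (suc j) λ ())) (ℚ.+-identityʳ _)
∑-point (suc i) e = trans (cong₂ _+_ (e zero λ ()) (∑-point i λ j j≢i → e (suc j) (j≢i ∘ Fin.suc-injective)))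
    (ℚ.+-identityˡ _)

∑-δ : ∀ {n} i (f : Fin n → ℚ) → ∑[ j < n ] (⟦ j ≟ i ⟧ * f j) ≡ f i
∑-δ i f = trans (∑-point i λ j j≢i → trans (cong (_* f j) (⟦⟧-no (j ≟ i) j≢i)) (ℚ.*-zeroˡ (f j)))
                (trans (cong (_* f i) (⟦⟧-yes (i ≟ i) refl)) (ℚ.*-identityˡ _))

∑-δʳ : ∀ {n} i (f : Fin n → ℚ) → ∑[ j < n ] (⟦ i ≟ j ⟧ * f j) ≡ f i
∑-δʳ i f = trans (∑-point i λ j j≢i → trans (cong (_* f j) (⟦⟧-no (i ≟ j) (j≢i ∘ sym))) (ℚ.*-zeroˡ (f j)))
                 (trans (cong (_* f i) (⟦⟧-yes (i ≟ i) refl)) (ℚ.*-identityˡ (f i)))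

∑-≢ : ∀ {n} k (f : Fin n → ℚ) → sum f ≡ f k + ∑≢ k f
∑-≢ {n} k f = trans (sum-cong-≗ split) (trans (∑-distrib-+ (λ i → ⟦ i ≟ k ⟧ * f i)
    (λ i → if does (i ≟ k) then 0ℚ else f i)) (cong (_+ ∑≢ k f) (∑-δ k f)))
  where
  split : ∀ i → f i ≡ ⟦ i ≟ k ⟧ * f i + (if does (i ≟ k) then 0ℚ else f i)
  split i with does (i ≟ k)
  ... | true  = sym (trans (ℚ.+-identityʳ _) (ℚ.*-identityˡ _))
  ... | false = sym (trans (cong (_+ f i) (ℚ.*-zeroˡ (f i))) (ℚ.+-identityˡ _))

∑-nonNeg : ∀ {n} {f : Fin n → ℚ} → (∀ i → 0ℚ ≤ f i) → 0ℚ ≤ sum f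
∑-nonNeg {zero}  h = ℚ.≤-refl
∑-nonNeg {suc n} h = 0≤+ (h zero) (∑-nonNeg (h ∘ suc))

∑-nonNeg-≡0 : ∀ {n} {f : Fin n → ℚ} → (∀ i → 0ℚ ≤ f i) → sum f ≡ 0ℚ → ∀ i → f i ≡ 0ℚ
∑-nonNeg-≡0 h e zero    = 0≤+≡0⇒≡0ˡ (h zero) (∑-nonNeg (h ∘ suc)) e
∑-nonNeg-≡0 h e (suc i) = ∑-nonNeg-≡0 (h ∘ suc) (0≤+≡0⇒≡0ʳ (h zero) (∑-nonNeg (h ∘ suc)) e) i

module _ {n : ℕ} where
  ∑∑-0 : ∀ {f : Fin n → Fin n → ℚ} → (∀ i j → f i j ≡ 0ℚ) → ∑[ i < n ] ∑[ j < n ] f i j ≡ 0ℚ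
  ∑∑-0 e = ∑-0 λ i → ∑-0 (e i)

  ∑∑-antisym : ∀ (f : Fin n → Fin n → ℚ) → (∀ i j → f i j ≡ - f j i) → ∑[ i < n ] ∑[ j < n ] f i j ≡ 0ℚ
  ∑∑-antisym f e = x≡-x⇒x≡0 _ (trans (sum-cong-≗ λ i → trans (sum-cong-≗ (e i)) (∑-neg (λ j → f j i)))
                      (trans (∑-neg _) (cong -_ (sym (∑-comm f)))))
    where
    ∑-neg : ∀ (g : Fin n → ℚ) → ∑[ i < n ] (- g i) ≡ - sum g
    ∑-neg g = trans (∑-lin₁ (- 1ℚ) (λ i → lemma (g i))) (sym (lemma (sum g)))
      where
      lemma : ∀ p → - p ≡ - 1ℚ * p
      lemma = solve-∀ ℚ-ring
    x≡-x⇒x≡0 : ∀ x → x ≡ - x → x ≡ 0ℚ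
    x≡-x⇒x≡0 x e = *-cancelˡ {ι 2} (λ ()) (trans (lemma x) (trans (cong (x +_) e) (lemma₂ x)))
      where
      lemma : ∀ x → ι 2 * x ≡ x + x
      lemma = solve-∀ ℚ-ring
      lemma₂ : ∀ x → x + - x ≡ ι 2 * 0ℚ
      lemma₂ = solve-∀ ℚ-ring

-- Limits

-- `HasSum` with the partial sums abstracted; a record rather than a function type, so that
-- unification recovers `a` and `s` from a proof.
record Lim (a : ℕ → ℚ) (s : ℚ) : Set where
  constructor lim
  field
    close : ∀ ε → 0ℚ < ε → ∃[ N ] ∀ M → N ℕ.≤ M → ∣ a M - s ∣ < ε

0<½* : ∀ {ε} → 0ℚ < ε → 0ℚ < ½ * ε
0<½* {ε} 0<ε = subst (_< ½ * ε) (ℚ.*-zeroʳ ½) (ℚ.*-monoʳ-<-pos ½ 0<ε)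

½*+½* : ∀ ε → ½ * ε + ½ * ε ≡ ε
½*+½* = solve-∀ ℚ-ring

lim-cong : ∀ {a b s} → (∀ M → a M ≡ b M) → Lim a s → Lim b s
lim-cong {a} {b} {s} e (lim c) = lim λ ε 0<ε → let N , close = c ε 0<ε in
  N , λ M N≤M → subst (λ x → ∣ x - s ∣ < ε) (e M) (close M N≤M)

lim-tail : ∀ {a s} → Lim a s → Lim (a ∘ suc) s
lim-tail (lim c) = lim λ ε 0<ε → let N , close = c ε 0<ε in
  N , λ M N≤M → close (suc M) (ℕ.m≤n⇒m≤1+n N≤M)

lim-const : ∀ s → Lim (λ _ → s) s
lim-const s = lim λ ε 0<ε → 0 , λ _ _ → subst (_< ε) (sym (cong ∣_∣ (ℚ.+-inverseʳ s))) 0<ε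

lim-+ : ∀ {a b s t} → Lim a s → Lim b t → Lim (λ M → a M + b M) (s + t)
lim-+ {a} {b} {s} {t} (lim c₁) (lim c₂) = lim λ ε 0<ε →
  let N₁ , close₁ = c₁ (½ * ε) (0<½* 0<ε)
      N₂ , close₂ = c₂ (½ * ε) (0<½* 0<ε)
  in N₁ ℕ.⊔ N₂ , λ M N≤M → begin-strict
  ∣ a M + b M - (s + t) ∣        ≡⟨ cong ∣_∣ (regroup (a M) (b M) s t) ⟩
  ∣ (a M - s) + (b M - t) ∣      ≤⟨ ℚ.∣p+q∣≤∣p∣+∣q∣ (a M - s) (b M - t) ⟩
  ∣ a M - s ∣ + ∣ b M - t ∣      <⟨ ℚ.+-mono-< (close₁ M (ℕ.m⊔n≤o⇒m≤o N₁ N₂ N≤M)) (close₂ M (ℕ.m⊔n≤o⇒n≤o N₁ N₂ N≤M)) ⟩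
  ½ * ε + ½ * ε  ≡⟨ ½*+½* ε ⟩
  ε  ∎
  where
  open ℚ.≤-Reasoning
  regroup : ∀ a b s t → a + b - (s + t) ≡ (a - s) + (b - t)
  regroup = solve-∀ ℚ-ring

-- The only factors that occur are transition probabilities and -1, so the same `N` serves for the
-- same `ε`.
lim-* : ∀ {a s} c → ∣ c ∣ ≤ 1ℚ → Lim a s → Lim (λ M → c * a M) (c * s)
lim-* {a} {s} c ∣c∣≤1 (lim cl) = lim λ ε 0<ε → let N , close = cl ε 0<ε in N , λ M N≤M → begin-strict
  ∣ c * a M - c * s ∣   ≡⟨ cong ∣_∣ (factor c (a M) s) ⟩
  ∣ c * (a M - s) ∣     ≡⟨ ℚ.∣p*q∣≡∣p∣*∣q∣ c (a M - s) ⟩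
  ∣ c ∣ * ∣ a M - s ∣   ≤⟨ ℚ.*-monoʳ-≤-nonNeg ∣ a M - s ∣ {{ℚ.∣-∣-nonNeg (a M - s)}} ∣c∣≤1 ⟩
  1ℚ * ∣ a M - s ∣      ≡⟨ ℚ.*-identityˡ _ ⟩
  ∣ a M - s ∣  <⟨ close M N≤M ⟩
  ε  ∎
  where
  open ℚ.≤-Reasoning
  factor : ∀ c a s → c * a - c * s ≡ c * (a - s)
  factor = solve-∀ ℚ-ring

lim-- : ∀ {a b s t} → Lim a s → Lim b t → Lim (λ M → a M - b M) (s - t)
lim-- {a} {b} {s} {t} lima limb = subst (Lim (λ M → a M - b M)) (minus s t)
  (lim-cong (λ M → minus (a M) (b M)) (lim-+ lima (lim-* (- 1ℚ) ℚ.≤-refl limb)))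
  where
  minus : ∀ p q → p + - 1ℚ * q ≡ p - q
  minus = solve-∀ ℚ-ring

lim-∑ : ∀ {n} {a : Fin n → ℕ → ℚ} {s : Fin n → ℚ} → (∀ i → Lim (a i) (s i)) →
        Lim (λ M → ∑[ i < n ] a i M) (∑[ i < n ] s i)
lim-∑ {zero}  l = lim-const 0ℚ
lim-∑ {suc n} l = lim-+ (l zero) (lim-∑ (l ∘ suc))

lim-unique : ∀ {a s t} → Lim a s → Lim a t → s ≡ t
lim-unique {a} {s} {t} (lim c₁) (lim c₂) with s ℚ.≟ t
... | yes s≡t = s≡t
... | no s≢t with ℚ.<-cmp 0ℚ ∣ s - t ∣
...   | tri≈ _ 0≡d _ = contradiction (p-q≡0⇒p≡q (ℚ.∣p∣≡0⇒p≡0 (s - t) (sym 0≡d))) s≢t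
...   | tri> _ _ d<0 = contradiction (ℚ.<-≤-trans d<0 (ℚ.0≤∣p∣ (s - t))) (ℚ.<-irrefl refl)
...   | tri< 0<d _ _ with c₁ (½ * ∣ s - t ∣) (0<½* 0<d) | c₂ (½ * ∣ s - t ∣) (0<½* 0<d)
...     | N₁ , close₁ | N₂ , close₂ = contradiction d<d (ℚ.<-irrefl refl)
  where
  M = N₁ ℕ.⊔ N₂
  regroup : ∀ a s t → s - t ≡ (a - t) - (a - s)
  regroup = solve-∀ ℚ-ring
  open ℚ.≤-Reasoning
  d<d : ∣ s - t ∣ < ∣ s - t ∣
  d<d = begin-strict
    ∣ s - t ∣  ≡⟨ cong ∣_∣ (regroup (a M) s t) ⟩
    ∣ (a M - t) - (a M - s) ∣  ≤⟨ ℚ.∣p-q∣≤∣p∣+∣q∣ (a M - t) (a M - s) ⟩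
    ∣ a M - t ∣ + ∣ a M - s ∣  <⟨ ℚ.+-mono-< (close₂ M (ℕ.m≤n⊔m N₁ N₂)) (close₁ M (ℕ.m≤m⊔n N₁ N₂)) ⟩
    ½ * ∣ s - t ∣ + ½ * ∣ s - t ∣     ≡⟨ ½*+½* _ ⟩
    ∣ s - t ∣  ∎

-- Random walks on connected graphs

opaque
  -- Opaque, so that the ring solver and unification meet entries and degrees as atoms instead of
  -- unfolding them to decision procedures.
  adjℚ : ∀ {n} → Graph n → Fin n → Fin n → ℚ
  adjℚ G i j = ι (adjacency G i j)

  degℚ : ∀ {n} → Graph n → Fin n → ℚ
  degℚ G i = ι (degree G i)

  adjℚ-ι : ∀ {n} (G : Graph n) i j → adjℚ G i j ≡ ι (adjacency G i j)
  adjℚ-ι G i j = refl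

  degℚ-ι : ∀ {n} (G : Graph n) i → degℚ G i ≡ ι (degree G i)
  degℚ-ι G i = refl

  ∑-adj : ∀ {n} (G : Graph n) i → sum (adjℚ G i) ≡ degℚ G i
  ∑-adj G i = sym (ι-sum (adjacency G i))

  adj-yes : ∀ {n} (G : Graph n) {i j} → Adj G i j → adjℚ G i j ≡ 1ℚ
  adj-yes G {i} {j} a = cong (λ b → ι (if b then 1 else 0)) (dec-true (adj? G i j) a)

  adj-no : ∀ {n} (G : Graph n) {i j} → ¬ Adj G i j → adjℚ G i j ≡ 0ℚ
  adj-no G {i} {j} ¬a = cong (λ b → ι (if b then 1 else 0)) (dec-false (adj? G i j) ¬a)

  0≤adj : ∀ {n} (G : Graph n) i j → 0ℚ ≤ adjℚ G i j
  0≤adj G i j = 0≤ι (adjacency G i j)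

adj-sym : ∀ {n} (G : Graph n) i j → adjℚ G i j ≡ adjℚ G j i
adj-sym G i j with adj? G i j
... | yes a = trans (adj-yes G a) (sym (adj-yes G (Graph.Adj-sym G a)))
... | no ¬a = trans (adj-no G ¬a) (sym (adj-no G (¬a ∘ Graph.Adj-sym G)))

-- The graph Laplacian and harmonic functions

opaque
  laplacian : ∀ {n} → Graph n → (Fin n → ℚ) → Fin n → ℚ
  laplacian {n} G u i = ∑[ j < n ] (adjℚ G i j * (u i - u j))

  laplacian-∑ : ∀ {n} (G : Graph n) u i → laplacian G u i ≡ ∑[ j < n ] (adjℚ G i j * (u i - u j))
  laplacian-∑ G u i = refl

∑-laplacian : ∀ {n} (G : Graph n) u → sum (laplacian G u) ≡ 0ℚ
∑-laplacian G u = trans (sum-cong-≗ (laplacian-∑ G u)) $ ∑∑-antisym (λ i j → adjℚ G i j * (u i - u j)) λ i j → trans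
    (cong (_* (u i - u j)) (adj-sym G i j)) (flip (adjℚ G j i) (u i) (u j))
  where
  flip : ∀ a x y → a * (x - y) ≡ - (a * (y - x))
  flip = solve-∀ ℚ-ring

laplacian-degree : ∀ {n} (G : Graph n) u i → laplacian G u i ≡ degℚ G i * u i - ∑[ j < n ] (adjℚ G i j * u j)
laplacian-degree {n} G u i = begin
  laplacian G u i  ≡⟨ laplacian-∑ G u i ⟩
  ∑[ j < n ] (adjℚ G i j * (u i - u j))  ≡⟨ ∑-lin₂ (u i) (- 1ℚ)
      (λ j → expand (adjℚ G i j) (u i) (u j)) ⟩
  u i * sum (adjℚ G i) + - 1ℚ * ∑[ j < n ] (adjℚ G i j * u j) ≡⟨ collect (u i) (sum (adjℚ G i))
      (∑[ j < n ] (adjℚ G i j * u j)) ⟩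
  sum (adjℚ G i) * u i - ∑[ j < n ] (adjℚ G i j * u j)     ≡⟨ cong (λ x → x * u i - ∑[ j < n ] (adjℚ G i j * u j))
      (∑-adj G i) ⟩
  degℚ G i * u i - ∑[ j < n ] (adjℚ G i j * u j)  ∎
  where
  open ≡-Reasoning
  expand : ∀ a x y → a * (x - y) ≡ x * a + - 1ℚ * (a * y)
  expand = solve-∀ ℚ-ring
  collect : ∀ u d s → u * d + - 1ℚ * s ≡ d * u - s
  collect = solve-∀ ℚ-ring

-- The Dirichlet energy of u is the sum of (u i - u k) times the Laplacian of u at i.
harmonic⇒const : ∀ {n} (G : Graph n) → Connected G → ∀ u k → (∀ i → i ≢ k → laplacian G u i ≡ 0ℚ) →
                 ∀ i → u i ≡ u k
harmonic⇒const {n} G conn u k harm i = along (conn i k)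
  where
  open ≡-Reasoning
  A = adjℚ G
  -- Summed over `j` this is `u i - u k` times the Laplacian at `i`. The shift by `u k` makes it
  -- vanish at `i = k`, where nothing is known about the Laplacian.
  half : Fin n → Fin n → ℚ
  half i j = (u i - u k) * (A i j * (u i - u j))
  half≡0 : ∑[ i < n ] ∑[ j < n ] half i j ≡ 0ℚ
  half≡0 = ∑-0 λ i → trans (∑-scale (u i - u k) (λ j → A i j * (u i - u j)))
    (trans (cong ((u i - u k) *_) (sym (laplacian-∑ G u i))) (vanish i))
    where
    vanish : ∀ i → (u i - u k) * laplacian G u i ≡ 0ℚ
    vanish i with i ≟ k
    ... | yes refl = trans (cong (_* laplacian G u i) (ℚ.+-inverseʳ (u i))) (ℚ.*-zeroˡ (laplacian G u i))
    ... | no i≢k   = trans (cong ((u i - u k) *_) (harm i i≢k)) (ℚ.*-zeroʳ (u i - u k))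
  energy : Fin n → Fin n → ℚ
  energy i j = A i j * ((u i - u j) * (u i - u j))
  split : ∀ i j → energy i j ≡ half i j + half j i
  split i j = trans (lemma (A i j) (u i) (u j) (u k)) (cong (λ a → half i j + (u j - u k) * (a * (u j - u i)))
      (adj-sym G i j))
    where
    lemma : ∀ a x y z → a * ((x - y) * (x - y)) ≡ (x - z) * (a * (x - y)) + (y - z) * (a * (y - x))
    lemma = solve-∀ ℚ-ring
  energy≡0 : ∑[ i < n ] ∑[ j < n ] energy i j ≡ 0ℚ
  energy≡0 = begin
    ∑[ i < n ] ∑[ j < n ] energy i j  ≡⟨ sum-cong-≗ (λ i → trans
        (sum-cong-≗ (split i)) (∑-distrib-+ (half i) (λ j → half j i))) ⟩
    ∑[ i < n ] (∑[ j < n ] half i j + ∑[ j < n ] half j i)  ≡⟨ ∑-distrib-+ (λ i → ∑[ j < n ] half i j)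
        (λ i → ∑[ j < n ] half j i) ⟩
    ∑[ i < n ] ∑[ j < n ] half i j + ∑[ i < n ] ∑[ j < n ] half j i       ≡⟨ cong₂ _+_ half≡0 (trans (∑-comm
        (λ i j → half j i)) half≡0) ⟩
    0ℚ  ∎
  0≤energy : ∀ i j → 0ℚ ≤ energy i j
  0≤energy i j = 0≤* (0≤adj G i j) (0≤p*p (u i - u j))
  edge : ∀ {i j} → Adj G i j → u i ≡ u j
  edge {i} {j} a = p-q≡0⇒p≡q (p*p≡0⇒p≡0 (trans (sym (trans (cong (_* ((u i - u j) * (u i - u j))) (adj-yes G a))
      (ℚ.*-identityˡ ((u i - u j) * (u i - u j)))))
    (∑-nonNeg-≡0 (0≤energy i) (∑-nonNeg-≡0 (λ i → ∑-nonNeg (0≤energy i)) energy≡0 i) j)))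
  along : ∀ {i} → Star (Adj G) i k → u i ≡ u k
  along done    = refl
  along (a ◅ w) = trans (edge a) (along w)

module RandomWalk {n} (G : Graph n) (conn : Connected G) (deg≢0 : ∀ i → degree G i ≢ 0) where
  open ≡-Reasoning
  private
    A P : Fin n → Fin n → ℚ
    A = adjℚ G
    P = transition G
    D : Fin n → ℚ
    D = degℚ G

  degree*transition : ∀ i j → D i * P i j ≡ A i j
  degree*transition i j = trans (cong₂ (λ d a → d * (recip (degree G i) * a)) (degℚ-ι G i) (sym (adjℚ-ι G i j)))
    (trans (lemma (ι (degree G i)) (recip (degree G i)) (A i j)) (trans (cong (_* A i j) (recip-* (deg≢0 i)))
        (ℚ.*-identityˡ (A i j))))
    where
    lemma : ∀ d r a → d * (r * a) ≡ (r * d) * a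
    lemma = solve-∀ ℚ-ring

  D≢0 : ∀ i → D i ≢ 0ℚ
  D≢0 i e = deg≢0 i (ι-injective {degree G i} {0} (trans (sym (degℚ-ι G i)) e))

  module _ {w} (st : IsStationary G w) where
    open IsStationary st

    private
      S : ℚ
      S = sum D
      g : Fin n → ℚ
      g i = recip (degree G i) * w i

      D*g : ∀ i → D i * g i ≡ w i
      D*g i = trans (cong (_* g i) (degℚ-ι G i)) $ trans (lemma (ι (degree G i)) (recip (degree G i)) (w i)) (trans
          (cong (_* w i) (recip-* (deg≢0 i))) (ℚ.*-identityˡ (w i)))
        where
        lemma : ∀ d r a → d * (r * a) ≡ (r * d) * a
        lemma = solve-∀ ℚ-ring

      g-harmonic : ∀ i → laplacian G g i ≡ 0ℚ
      g-harmonic i = trans (laplacian-degree G g i) (trans (cong₂ _-_ (D*g i) inflow) (ℚ.+-inverseʳ (w i)))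
        where
        lemma : ∀ a r w → a * (r * w) ≡ w * (r * a)
        lemma = solve-∀ ℚ-ring
        inflow : ∑[ j < n ] (A i j * g j) ≡ w i
        inflow = trans (sum-cong-≗ λ j → trans (cong (_* g j)
            (trans (adj-sym G i j) (adjℚ-ι G j i))) (lemma (ι (adjacency G j i)) (recip (degree G j)) (w j)))
            (invariant i)

    -- Invariance of `w` says that `w` divided by the degree is harmonic at every vertex, hence
    -- constant; the total mass fixes the constant.
    stationary-degree : ∀ i → S * w i ≡ D i
    stationary-degree i = begin
      S * w i  ≡⟨ cong (S *_) (sym (D*g i)) ⟩
      S * (D i * g i)  ≡⟨ lemma S (D i) (g i) ⟩
      D i * (g i * S)  ≡⟨ cong (D i *_) (sym (∑-scale (g i) D)) ⟩
      D i * ∑[ j < n ] (g i * D j) ≡⟨ cong (D i *_) (trans (sum-cong-≗ λ j → trans (cong (_* D j) (const j)) (trans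
          (ℚ.*-comm (g j) (D j)) (D*g j))) total) ⟩
      D i * 1ℚ  ≡⟨ ℚ.*-identityʳ (D i) ⟩
      D i  ∎
      where
      const : ∀ j → g i ≡ g j
      const j = harmonic⇒const G conn g j (λ l _ → g-harmonic l) i
      lemma : ∀ s d g → s * (d * g) ≡ d * (g * s)
      lemma = solve-∀ ℚ-ring

  ∣transition∣≤1 : ∀ i j → ∣ P i j ∣ ≤ 1ℚ
  ∣transition∣≤1 i j = subst (_≤ 1ℚ) (sym (ℚ.0≤p⇒∣p∣≡p (0≤* (0≤recip (degree G i)) (0≤ι (adjacency G i j))))) P≤1
    where
    recip≤1 : ∀ k → recip k ≤ 1ℚ
    recip≤1 zero    = 0≤ι 1
    recip≤1 (suc k) = ℚ.≤-trans
      (subst₂ _≤_ (ℚ.*-identityʳ (recip (suc k))) refl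
        (ℚ.*-monoˡ-≤-nonNeg (recip (suc k)) {{ℚ.normalize-nonNeg 1 (suc k)}} (ι-mono {1} {suc k} (s≤s z≤n))))
      (ℚ.≤-reflexive (recip-* {suc k} λ ()))
    P≤1 : P i j ≤ 1ℚ
    P≤1 with does (adj? G i j)
    ... | true  = subst (_≤ 1ℚ) (sym (ℚ.*-identityʳ (recip (degree G i)))) (recip≤1 (degree G i))
    ... | false = subst (_≤ 1ℚ) (sym (ℚ.*-zeroʳ (recip (degree G i)))) (0≤ι 1)

  module _ {m} (mean : IsMeanFirstPassage G m) (k : Fin n) where
    private
      f : ℕ → Fin n → ℚ
      f t j = firstPassage G t j k

      F S : ℕ → Fin n → ℚ
      F M j = ∑[ t < M ] f (toℕ t) j
      S M j = ∑[ t < M ] (ι (toℕ t) * f (toℕ t) j)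

      -- One move of the walk that is killed on entering `k`.
      step : (Fin n → ℚ) → Fin n → ℚ
      step u j = ∑≢ k (λ l → P j l * u l)

      step-cong : ∀ {u v} → (∀ l → u l ≡ v l) → ∀ j → step u j ≡ step v j
      step-cong e j = sum-cong-≗ λ l → cong (λ x → if does (l ≟ k) then 0ℚ else P j l * x) (e l)

      step-∑ : ∀ M (u : Fin M → Fin n → ℚ) j → step (λ l → ∑[ t < M ] u t l) j ≡ ∑[ t < M ] step (u t) j
      step-∑ M u j = trans (sum-cong-≗ inner) (∑-comm (λ l t → if does (l ≟ k) then 0ℚ else P j l * u t l))
        where
        inner : ∀ l → (if does (l ≟ k) then 0ℚ else P j l * ∑[ t < M ] u t l) ≡ ∑[ t < M ] (if does
            (l ≟ k) then 0ℚ else P j l * u t l)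
        inner l with does (l ≟ k)
        ... | true  = sym (∑-0 {M} λ _ → refl)
        ... | false = *-distribˡ-sum (P j l) (λ t → u t l)

      step-scale : ∀ α u j → step (λ l → α * u l) j ≡ α * step u j
      step-scale α u j = ∑-lin₁ α inner
        where
        lemma : ∀ p α x → p * (α * x) ≡ α * (p * x)
        lemma = solve-∀ ℚ-ring
        inner : ∀ l → (if does (l ≟ k) then 0ℚ else P j l * (α * u l)) ≡ α * (if does (l ≟ k) then 0ℚ else P j l * u l)
        inner l with does (l ≟ k)
        ... | true  = sym (ℚ.*-zeroʳ α)
        ... | false = lemma (P j l) α (u l)

      lim-step : ∀ {a : ℕ → Fin n → ℚ} {s} → (∀ l → Lim (λ M → a M l) (s l)) → ∀ j → Lim (λ M → step (a M) j) (step s j)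
      lim-step {a} {s} l j = lim-∑ inner
        where
        inner : ∀ i → Lim (λ M → if does (i ≟ k) then 0ℚ else P j i * a M i) (if does (i ≟ k) then 0ℚ else P j i * s i)
        inner i with does (i ≟ k)
        ... | true  = lim-const 0ℚ
        ... | false = lim-* (P j i) (∣transition∣≤1 j i) (l i)

      F-suc : ∀ M j → F (2 ℕ.+ M) j ≡ P j k + step (F (suc M)) j
      F-suc M j = begin
        0ℚ + (P j k + ∑[ t < M ] step (f (suc (toℕ t))) j)  ≡⟨ ℚ.+-identityˡ (P j k + ∑[ t < M ] step (f (suc
            (toℕ t))) j) ⟩
        P j k + ∑[ t < M ] step (f (suc (toℕ t))) j  ≡⟨ cong (P j k +_) (sym (step-∑ M
            (λ t → f (suc (toℕ t))) j)) ⟩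
        P j k + step (λ l → ∑[ t < M ] f (suc (toℕ t)) l) j ≡⟨ cong (P j k +_) (step-cong (λ l → sym
            (ℚ.+-identityˡ _)) j) ⟩
        P j k + step (F (suc M)) j  ∎

      -- The weight of a passage time splits as `1 + t`: the 1 counts the first move and collects
      -- into `F`, the `t` counts the rest of the walk and collects into `step` of `S`.
      S-suc : ∀ M j → S (2 ℕ.+ M) j ≡ F (2 ℕ.+ M) j + step (S (suc M)) j
      S-suc M j = begin
        0ℚ * 0ℚ + (1ℚ * P j k + ∑[ t < M ] (ι (2 ℕ.+ toℕ t) * step (f (suc (toℕ t))) j))
          ≡⟨ cong (λ x → 0ℚ * 0ℚ + (1ℚ * P j k + x)) (trans (sum-cong-≗ weight) (trans (∑-distrib-+ {M} _ _)
              (cong (fs +_) inner))) ⟩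
        0ℚ * 0ℚ + (1ℚ * P j k + (fs + step (S (suc M)) j))
          ≡⟨ regroup (P j k) fs (step (S (suc M)) j) ⟩
        F (2 ℕ.+ M) j + step (S (suc M)) j ∎
        where
        fs = ∑[ t < M ] step (f (suc (toℕ t))) j
        regroup : ∀ p f s → 0ℚ * 0ℚ + (1ℚ * p + (f + s)) ≡ 0ℚ + (p + f) + s
        regroup = solve-∀ ℚ-ring
        distr : ∀ a b → (1ℚ + a) * b ≡ b + a * b
        distr = solve-∀ ℚ-ring
        weight : ∀ t → ι (2 ℕ.+ toℕ {M} t) * step (f (suc (toℕ t))) j ≡
                       step (f (suc (toℕ t))) j + step (λ l → ι (suc (toℕ t)) * f (suc (toℕ t)) l) j
        weight t = trans (cong (_* step (f (suc (toℕ t))) j) (ι-suc (suc (toℕ t))))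
          (trans (distr (ι (suc (toℕ t))) (step (f (suc (toℕ t))) j))
                 (cong (step (f (suc (toℕ t))) j +_) (sym (step-scale (ι (suc (toℕ t))) (f (suc (toℕ t))) j))))
        inner : ∑[ t < M ] step (λ l → ι (suc (toℕ t)) * f (suc (toℕ t)) l) j ≡ step (S (suc M)) j
        inner = trans (sym (step-∑ M (λ t l → ι (suc (toℕ t)) * f (suc (toℕ t)) l) j)) (step-cong (λ l → sym
            (ℚ.+-identityˡ _)) j)

      limS : ∀ j → Lim (λ M → S M j) (m j k)
      limS j = lim (mean j k)

      -- The total first-passage probability, as the limit of F.
      ρ : Fin n → ℚ
      ρ j = m j k - step (λ l → m l k) j

      -- Convergence of `F` is inherited from `S`: by `S-suc` it is a difference of two sequences
      -- that converge by assumption.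
      limF : ∀ j → Lim (λ M → F (2 ℕ.+ M) j) (ρ j)
      limF j = lim-cong (λ M → trans (cong (_- step (S (suc M)) j) (S-suc M j)) (cancel (F (2 ℕ.+ M) j) (step (S
          (suc M)) j)))
        (lim-- (lim-tail (lim-tail (limS j))) (lim-step (λ l → lim-tail (limS l)) j))
        where
        cancel : ∀ p q → p + q - q ≡ p
        cancel = solve-∀ ℚ-ring

      ρ-step : ∀ j → ρ j ≡ P j k + step ρ j
      ρ-step j = lim-unique (lim-tail (limF j))
        (lim-cong (λ M → sym (F-suc (suc M) j)) (lim-+ (lim-const (P j k)) (lim-step (λ l → limF l) j)))

      -- `step` leaves out the vertex `k`. Prescribing the value `x` there turns
      -- `P j k * x + step u j` into an average over all neighbours, to which the Laplacian applies.
      setAt : ℚ → (Fin n → ℚ) → Fin n → ℚ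
      setAt x u l = if does (l ≟ k) then x else u l

      setAt-k : ∀ x u → setAt x u k ≡ x
      setAt-k x u = cong (if_then x else u k) (dec-true (k ≟ k) refl)

      setAt-≢ : ∀ x u {l} → l ≢ k → setAt x u l ≡ u l
      setAt-≢ x u {l} l≢k = cong (if_then x else u l) (dec-false (l ≟ k) l≢k)

      ∑-setAt : ∀ x u j → ∑[ l < n ] (A j l * setAt x u l) ≡ D j * (P j k * x + step u j)
      ∑-setAt x u j = begin
        ∑[ l < n ] (A j l * setAt x u l)  ≡⟨ ∑-≢ k (λ l → A j l * setAt x u l) ⟩
        A j k * setAt x u k + ∑≢ k (λ l → A j l * setAt x u l) ≡⟨ cong₂ _+_ (cong (A j k *_) (setAt-k x u))
            (∑-lin₁ (D j) off) ⟩
        A j k * x + D j * step u j  ≡⟨ cong (λ a → a * x + D j * step u j)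
            (sym (degree*transition j k)) ⟩
        D j * P j k * x + D j * step u j  ≡⟨ collect (D j) (P j k) x (step u j) ⟩
        D j * (P j k * x + step u j)  ∎
        where
        collect : ∀ d p x s → d * p * x + d * s ≡ d * (p * x + s)
        collect = solve-∀ ℚ-ring
        off : ∀ l → (if does (l ≟ k) then 0ℚ else A j l * setAt x u l) ≡ D j * (if does
            (l ≟ k) then 0ℚ else P j l * u l)
        off l with does (l ≟ k)
        ... | true  = sym (ℚ.*-zeroʳ (D j))
        ... | false = trans (cong (_* u l) (sym (degree*transition j l))) (ℚ.*-assoc (D j) (P j l) (u l))

      laplacian-setAt : ∀ x u j → j ≢ k → laplacian G (setAt x u) j ≡ D j * (u j - (P j k * x + step u j))
      laplacian-setAt x u j j≢k = begin
        laplacian G (setAt x u) j  ≡⟨ laplacian-degree G (setAt x u) j ⟩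
        D j * setAt x u j - ∑[ l < n ] (A j l * setAt x u l)    ≡⟨ cong₂ (λ a b → D j * a - b) (setAt-≢ x u j≢k)
            (∑-setAt x u j) ⟩
        D j * u j - D j * (P j k * x + step u j)  ≡⟨ factor (D j) (u j) (P j k * x + step u j) ⟩
        D j * (u j - (P j k * x + step u j))  ∎
        where
        factor : ∀ d u s → d * u - d * s ≡ d * (u - s)
        factor = solve-∀ ℚ-ring

      -- By `ρ-step`, the extension of `ρ` by 1 at `k` is harmonic off `k`, hence constant: the walk
      -- reaches `k` almost surely.
      ρ≡1 : ∀ j → j ≢ k → ρ j ≡ 1ℚ
      ρ≡1 j j≢k = trans (sym (setAt-≢ 1ℚ ρ j≢k)) (trans (harmonic⇒const G conn (setAt 1ℚ ρ) k harm j) (setAt-k 1ℚ ρ))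
        where
        harm : ∀ i → i ≢ k → laplacian G (setAt 1ℚ ρ) i ≡ 0ℚ
        harm i i≢k = trans (laplacian-setAt 1ℚ ρ i i≢k) (trans (cong (D i *_)
          (trans (cong₂ _-_ (ρ-step i) (cong (_+ step ρ i) (ℚ.*-identityʳ (P i k))))
              (ℚ.+-inverseʳ (P i k + step ρ i)))) (ℚ.*-zeroʳ (D i)))

    -- Zero at `k`, in place of `m k k`, which is the mean return time.
    hitting : Fin n → ℚ
    hitting = setAt 0ℚ (λ l → m l k)

    hitting-k : hitting k ≡ 0ℚ
    hitting-k = setAt-k 0ℚ (λ l → m l k)

    hitting-≢ : ∀ {l} → l ≢ k → hitting l ≡ m l k
    hitting-≢ = setAt-≢ 0ℚ (λ l → m l k)

    -- The definition of `ρ` read backwards: `m` minus its own `step` is `ρ`, which is 1 off `k`.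
    laplacian-hitting : ∀ j → j ≢ k → laplacian G hitting j ≡ D j
    laplacian-hitting j j≢k = trans (laplacian-setAt 0ℚ (λ l → m l k) j j≢k) (trans (cong (D j *_)
      (trans (drop (m j k) (P j k) (step (λ l → m l k) j)) (ρ≡1 j j≢k))) (ℚ.*-identityʳ (D j)))
      where
      drop : ∀ m p s → m - (p * 0ℚ + s) ≡ m - s
      drop = solve-∀ ℚ-ring

-- Linearity of the Laplacian

module _ {n} (G : Graph n) where
  laplacian-lin₃ : ∀ {u f g h} α β γ κ → (∀ i → u i ≡ α * f i + β * g i + γ * h i + κ) →
                   ∀ i → laplacian G u i ≡ α * laplacian G f i + β * laplacian G g i + γ * laplacian G h i
  laplacian-lin₃ {u} {f} {g} {h} α β γ κ e i =
    trans (laplacian-∑ G u i) $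
    trans (∑-lin₃ α β γ λ j → trans (cong₂ (λ p q → adjℚ G i j * (p - q)) (e i) (e j))
                                   (lemma (adjℚ G i j) α β γ κ (f i) (f j) (g i) (g j) (h i) (h j))) $
    sym (cong₂ _+_ (cong₂ (λ p q → α * p + β * q) (laplacian-∑ G f i) (laplacian-∑ G g i))
        (cong (γ *_) (laplacian-∑ G h i)))
    where
    lemma : ∀ a α β γ κ f f′ g g′ h h′ → a * ((α * f + β * g + γ * h + κ) - (α * f′ + β * g′ + γ * h′ + κ)) ≡
            α * (a * (f - f′)) + β * (a * (g - g′)) + γ * (a * (h - h′))
    lemma = solve-∀ ℚ-ring

  laplacian-weighted : ∀ (w : Fin n → ℚ) (f : Fin n → Fin n → ℚ) i →
                       laplacian G (λ x → ∑[ z < n ] (w z * f x z)) i ≡ ∑[ z < n ] (w z * laplacian G (λ x → f x z) i)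
  laplacian-weighted w f i = begin
    laplacian G (λ x → ∑[ z < n ] (w z * f x z)) i
      ≡⟨ laplacian-∑ G _ i ⟩
    ∑[ j < n ] (adjℚ G i j * (∑[ z < n ] (w z * f i z) - ∑[ z < n ] (w z * f j z)))
      ≡⟨ sum-cong-≗ (λ j → trans (cong (adjℚ G i j *_) (sym (∑-distrib-- (λ z → w z * f i z) (λ z → w z * f j z))))
                                 (*-distribˡ-sum (adjℚ G i j) (λ z → w z * f i z - w z * f j z))) ⟩
    ∑[ j < n ] ∑[ z < n ] (adjℚ G i j * (w z * f i z - w z * f j z))
      ≡⟨ ∑-comm (λ j z → adjℚ G i j * (w z * f i z - w z * f j z)) ⟩
    ∑[ z < n ] ∑[ j < n ] (adjℚ G i j * (w z * f i z - w z * f j z))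
      ≡⟨ sum-cong-≗ (λ z → trans (∑-lin₁ (w z) (λ j → lemma (adjℚ G i j) (w z) (f i z) (f j z))) (cong (w z *_)
          (sym (laplacian-∑ G _ i)))) ⟩
    ∑[ z < n ] (w z * laplacian G (λ x → f x z) i) ∎
    where
    open ≡-Reasoning
    lemma : ∀ a w p q → a * (w * p - w * q) ≡ w * (a * (p - q))
    lemma = solve-∀ ℚ-ring

-- R is s times the resistance metric, for which the hitting time from j to k
-- is half the degree-weighted sum over z of R j k + R k z - R j z.
module _ {n} (G : Graph n) (conn : Connected G) (deg≢0 : ∀ i → degree G i ≢ 0)
         (R : Fin n → Fin n → ℚ) (c : Fin n → ℚ) (s : ℚ)
         (R-diag : ∀ i → R i i ≡ 0ℚ)
         (R-laplacian : ∀ z i → laplacian G (λ x → R x z) i ≡ c i - ι 2 * s * ⟦ i ≟ z ⟧) where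
  open RandomWalk G conn deg≢0
  open ≡-Reasoning
  private
    D : Fin n → ℚ
    D = degℚ G
    S : ℚ
    S = sum D
    E : Fin n → ℚ
    E x = ∑[ z < n ] (D z * R x z)

    laplacian-E : ∀ i → laplacian G E i ≡ S * c i - ι 2 * s * D i
    laplacian-E i = begin
      laplacian G E i  ≡⟨ laplacian-weighted G D R i ⟩
      ∑[ z < n ] (D z * laplacian G (λ x → R x z) i)  ≡⟨ ∑-lin₂ (c i) (- (ι 2 * s)) (λ z → trans
          (cong (D z *_) (R-laplacian z i)) (expand (D z) (c i) s ⟦ i ≟ z ⟧)) ⟩
      c i * S + - (ι 2 * s) * ∑[ z < n ] (⟦ i ≟ z ⟧ * D z)     ≡⟨ cong (λ x → c i * S + - (ι 2 * s) * x) (∑-δʳ i D) ⟩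
      c i * S + - (ι 2 * s) * D i  ≡⟨ collect (c i) S s (D i) ⟩
      S * c i - ι 2 * s * D i  ∎
      where
      expand : ∀ d c s b → d * (c - ι 2 * s * b) ≡ c * d + - (ι 2 * s) * (b * d)
      expand = solve-∀ ℚ-ring
      collect : ∀ c S s d → c * S + - (ι 2 * s) * d ≡ S * c - ι 2 * s * d
      collect = solve-∀ ℚ-ring

  hitting-formula : ∀ {m} (mean : IsMeanFirstPassage G m) k j → ι 2 * s * hitting mean k j ≡ S * R j k - E j + E k
  hitting-formula mean k j = p-q≡0⇒p≡q (trans (rearrange s (hitting mean k j) S (R j k) (E j) (E k)) (trans u≡uk uk≡0))
    where
    -- The combination in which both `c` and the degrees cancel from the Laplacian off `k`; the
    -- constant `- E k` makes it vanish at `k`.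
    u : Fin n → ℚ
    u i = ι 2 * s * hitting mean k i + - S * R i k + 1ℚ * E i + - E k
    rearrange : ∀ s h S r e f → ι 2 * s * h - (S * r - e + f) ≡ ι 2 * s * h + - S * r + 1ℚ * e + - f
    rearrange = solve-∀ ℚ-ring
    harm : ∀ i → i ≢ k → laplacian G u i ≡ 0ℚ
    harm i i≢k = begin
      laplacian G u i
        ≡⟨ laplacian-lin₃ G (ι 2 * s) (- S) 1ℚ (- E k) (λ _ → refl) i ⟩
      ι 2 * s * laplacian G (hitting mean k) i + - S * laplacian G (λ x → R x k) i + 1ℚ * laplacian G E i
        ≡⟨ cong₂ _+_ (cong₂ (λ p q → ι 2 * s * p + - S * q) (laplacian-hitting mean k i i≢k)
                        (trans (R-laplacian k i) (cong (λ b → c i - ι 2 * s * b) (⟦⟧-no (i ≟ k) i≢k))))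
                     (cong (1ℚ *_) (laplacian-E i)) ⟩
      ι 2 * s * D i + - S * (c i - ι 2 * s * 0ℚ) + 1ℚ * (S * c i - ι 2 * s * D i)
        ≡⟨ cancel s (D i) S (c i) ⟩
      0ℚ ∎
      where
      cancel : ∀ s d S c → ι 2 * s * d + - S * (c - ι 2 * s * 0ℚ) + 1ℚ * (S * c - ι 2 * s * d) ≡ 0ℚ
      cancel = solve-∀ ℚ-ring
    u≡uk : u j ≡ u k
    u≡uk = harmonic⇒const G conn u k harm j
    uk≡0 : u k ≡ 0ℚ
    uk≡0 = trans (cong₂ (λ p q → ι 2 * s * p + - S * q + 1ℚ * E k + - E k) (hitting-k mean k) (R-diag k)) (cancel s S
        (E k))
      where
      cancel : ∀ s S e → ι 2 * s * 0ℚ + - S * 0ℚ + 1ℚ * e + - e ≡ 0ℚ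
      cancel = solve-∀ ℚ-ring

  kemeny-formula : ∀ {κ} → IsKemeny G κ → κ * (ι 2 * s * S) ≡ ∑[ x < n ] (D x * ∑[ y < n ] (D y * R x y))
  kemeny-formula {κ} kem = begin
    κ * (ι 2 * s * S)  ≡⟨ cong (_* (ι 2 * s * S)) (trans value
        (sum-cong-≗ term)) ⟩
    ∑[ k < n ] (h k * w k) * (ι 2 * s * S)  ≡⟨ trans
        (ℚ.*-comm _ (ι 2 * s * S)) (*-distribˡ-sum (ι 2 * s * S) (λ k → h k * w k)) ⟩
    ∑[ k < n ] (ι 2 * s * S * (h k * w k))  ≡⟨ sum-cong-≗ (λ k → regroup s S (h k) (w k)) ⟩
    ∑[ k < n ] ((ι 2 * s * h k) * (S * w k))  ≡⟨ sum-cong-≗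
        (λ k → cong₂ _*_ (hitting-formula meanPassage k j) (stationary-degree stationary k)) ⟩
    ∑[ k < n ] ((S * R j k - E j + E k) * D k)  ≡⟨ ∑-lin₃ S (- E j) 1ℚ
        (λ k → expand S (R j k) (E j) (E k) (D k)) ⟩
    -- Here the initial vertex `j` drops out.
    S * E j + - E j * S + 1ℚ * ∑[ k < n ] (D k * E k)        ≡⟨ collect S (E j) _ ⟩
    ∑[ k < n ] (D k * E k)  ∎
    where
    open IsKemeny kem
    j : Fin n
    j = initial
    h : Fin n → ℚ
    h k = hitting meanPassage k j
    term : ∀ k → (if does (k ≟ j) then 0ℚ else m j k * w k) ≡ h k * w k
    term k with k ≟ j
    ... | yes refl = sym (trans (cong (_* w k) (hitting-k meanPassage k)) (ℚ.*-zeroˡ (w k)))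
    ... | no k≢j   = sym (cong (_* w k) (hitting-≢ meanPassage k (k≢j ∘ sym)))
    regroup : ∀ s S h w → ι 2 * s * S * (h * w) ≡ (ι 2 * s * h) * (S * w)
    regroup = solve-∀ ℚ-ring
    expand : ∀ S r e f d → (S * r - e + f) * d ≡ S * (d * r) + - e * d + 1ℚ * (d * f)
    expand = solve-∀ ℚ-ring
    collect : ∀ S e x → S * e + - e * S + 1ℚ * x ≡ x
    collect = solve-∀ ℚ-ring

-- Distances

least : ∀ {P : ℕ → Set} → (∀ t → Dec (P t)) → ∀ t → P t → ∃[ m ] P m × (∀ {s} → P s → m ℕ.≤ s)
least P? t pt with P? 0
... | yes p0 = 0 , p0 , λ _ → z≤n
least P? zero    pt | no ¬p0 = contradiction pt ¬p0
least {P} P? (suc t) pt | no ¬p0 with least (P? ∘ suc) t pt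
... | m , pm , min = suc m , pm , bound′
  where
  bound′ : ∀ {s} → P s → suc m ℕ.≤ s
  bound′ {zero}  p0 = contradiction p0 ¬p0
  bound′ {suc s} ps = s≤s (min ps)

-- Stated for an arbitrary relation because it is used both for adjacency and for adjacency away
-- from a fixed vertex.
module Walks {n} (E : Rel (Fin n) 0ℓ) where
  Walk : ℕ → Fin n → Fin n → Set
  Walk zero    x z = x ≡ z
  Walk (suc t) x z = ∃[ y ] E x y × Walk t y z

  walk? : Decidable E → ∀ t → Decidable (Walk t)
  walk? E? zero    x z = x ≟ z
  walk? E? (suc t) x z = Fin.any? λ y → E? x y ×-dec walk? E? t y z

  star⇒walk : ∀ {x z} → Star E x z → ∃[ t ] Walk t x z
  star⇒walk done    = 0 , refl
  star⇒walk (e ◅ w) with star⇒walk w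
  ... | t , w′ = suc t , _ , e , w′

  _++ʷ_ : ∀ {s t x y z} → Walk s x y → Walk t y z → Walk (s ℕ.+ t) x z
  _++ʷ_ {zero}  refl        w′ = w′
  _++ʷ_ {suc s} (y , e , w) w′ = y , e , w ++ʷ w′

  reverse : (∀ {x y} → E x y → E y x) → ∀ t {x z} → Walk t x z → Walk t z x
  reverse E-sym zero    w           = sym w
  reverse E-sym (suc t) {x} {z} (y , e , w) =
    subst (λ s → Walk s z x) (ℕ.+-comm t 1) (reverse E-sym t w ++ʷ (x , E-sym e , refl))

  -- The last component carries the induction: if the new first vertex `x` occurred again, the walk
  -- to `z` from its later occurrence would be shorter than the minimum.
  shortest⇒injective-path : ∀ t {x z} → Walk t x z → (∀ {s} → Walk s x z → t ℕ.≤ s) →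
    Σ[ p ∈ (Fin (suc t) → Fin n) ] ((∀ {i j} → p i ≡ p j → i ≡ j)
         × (∀ (i : Fin t) → E (p (inject₁ i)) (p (suc i)))
         × p zero ≡ x × p (fromℕ t) ≡ z
         × (∀ i → ∃[ s ] s ℕ.≤ t × Walk s (p i) z))
  shortest⇒injective-path zero {x} w min = (λ _ → x) , (λ { {zero} {zero} _ → refl }) ,
      (λ ()) , refl , w , λ _ → 0 , z≤n , w
  shortest⇒injective-path (suc t) {x} {z} (y , e , w) min
    with shortest⇒injective-path t w (λ w′ → ℕ.s≤s⁻¹ (min (y , e , w′)))
  ... | p , inj , edges , p0≡y , pt≡z , near = q , q-inj , q-edges , refl , pt≡z , q-near
    where
    q : Fin (2 ℕ.+ t) → Fin n
    q zero    = x
    q (suc i) = p i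
    x∉p : ∀ i → x ≢ p i
    x∉p i refl with near i
    ... | s , s≤t , w′ = ℕ.<⇒≱ (s≤s s≤t) (min w′)
    q-inj : ∀ {i j} → q i ≡ q j → i ≡ j
    q-inj {zero}  {zero}  _  = refl
    q-inj {zero}  {suc j} eq = contradiction eq (x∉p j)
    q-inj {suc i} {zero}  eq = contradiction (sym eq) (x∉p i)
    q-inj {suc i} {suc j} eq = cong suc (inj eq)
    q-edges : ∀ i → E (q (inject₁ i)) (q (suc i))
    q-edges zero    = subst (E x) (sym p0≡y) e
    q-edges (suc i) = edges i
    q-near : ∀ i → ∃[ s ] s ℕ.≤ suc t × Walk s (q i) z
    q-near zero    = suc t , ℕ.≤-refl , y , e , w
    q-near (suc i) with near i
    ... | s , s≤t , w′ = s , ℕ.m≤n⇒m≤1+n s≤t , w′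

module Distance {n} (G : Graph n) (conn : Connected G) where
  open Walks (Adj G)

  private
    shortest : ∀ x z → ∃[ t ] Walk t x z × (∀ {s} → Walk s x z → t ℕ.≤ s)
    shortest x z with star⇒walk (conn x z)
    ... | t , w = least (λ s → walk? (adj? G) s x z) t w

  opaque
    d : Fin n → Fin n → ℕ
    d x z = proj₁ (shortest x z)

    d-walk : ∀ x z → Walk (d x z) x z
    d-walk x z = proj₁ (proj₂ (shortest x z))

    d-min : ∀ {x z s} → Walk s x z → d x z ℕ.≤ s
    d-min {x} {z} = proj₂ (proj₂ (shortest x z))

  d-refl : ∀ x → d x x ≡ 0
  d-refl x = ℕ.n≤0⇒n≡0 (d-min refl)

  d≡0⇒≡ : ∀ {x z} → d x z ≡ 0 → x ≡ z
  d≡0⇒≡ {x} {z} e = subst (λ t → Walk t x z) e (d-walk x z)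

  triangle : ∀ x y z → d x z ℕ.≤ d x y ℕ.+ d y z
  triangle x y z = d-min (d-walk x y ++ʷ d-walk y z)

  d-sym : ∀ x z → d x z ≡ d z x
  d-sym x z = ℕ.≤-antisym (half x z) (half z x)
    where
    half : ∀ x z → d x z ℕ.≤ d z x
    half x z = d-min (reverse (Graph.Adj-sym G) _ (d-walk z x))

  adj⇒≢ : ∀ {x y} → Adj G x y → x ≢ y
  adj⇒≢ a x≡y = Graph.Adj-irrefl G x≡y a

  adj⇒d≡1 : ∀ {x y} → Adj G x y → d x y ≡ 1
  adj⇒d≡1 {x} {y} a with d x y in eq | d-min {x} {y} {1} (y , a , refl)
  ... | zero        | _         = contradiction (d≡0⇒≡ eq) (adj⇒≢ a)
  ... | suc zero    | _         = refl
  ... | suc (suc _) | s≤s ()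

  d≡1⇒adj : ∀ {x y} → d x y ≡ 1 → Adj G x y
  d≡1⇒adj {x} {y} e with subst (λ t → Walk t x y) e (d-walk x y)
  ... | _ , a , refl = a

  d-step : ∀ {x y} z → Adj G x y → d x z ℕ.≤ suc (d y z)
  d-step {x} {y} z a = d-min (y , a , d-walk y z)

  descend : ∀ {x z} → x ≢ z → ∃[ y ] Adj G x y × d x z ≡ suc (d y z)
  descend {x} {z} x≢z with d x z in eq | subst (λ t → Walk t x z) refl (d-walk x z)
  ... | zero  | _ = contradiction (d≡0⇒≡ eq) x≢z
  ... | suc t | y , a , w = y , a , ℕ.≤-antisym (subst (ℕ._≤ suc (d y z)) eq (d-step z a)) (s≤s (d-min w))

-- Distances in trees

module TreeDistance {n} (T : Graph n) (tree : IsTree T) where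
  open Distance T (proj₁ tree) public

  private
    Avoiding : Fin n → Rel (Fin n) 0ℓ
    Avoiding x s t = Adj T s t × s ≢ x × t ≢ x

    ≢-dec : ∀ (s x : Fin n) → Dec (s ≢ x)
    ≢-dec s x = ¬? (s ≟ x)

    -- A shortest walk from `y` to `y′` among those avoiding `x` is a path; putting `x` in front of
    -- it and returning along the edge from `y′` closes a cycle.
    no-bypass : ∀ {x y y′} → Adj T x y → Adj T x y′ → y ≢ y′ → ¬ Star (Avoiding x) y y′
    no-bypass {x} {y} {y′} a a′ y≢y′ bypass with Walks.star⇒walk (Avoiding x) bypass
    ... | t , w with least (λ s → Walks.walk? (Avoiding x) (λ s t → adj? T s t ×-dec
        (≢-dec s x ×-dec ≢-dec t x)) s y y′) t w
    ... | zero  , w′ , _   = y≢y′ w′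
    ... | suc k , w′ , min with Walks.shortest⇒injective-path (Avoiding x) (suc k) w′ min
    ... | p , inj , edges , p0≡y , pt≡y′ , _ = proj₂ tree q q-path (Graph.Adj-sym T a′)
      where
      q : Fin (3 ℕ.+ k) → Fin n
      q zero    = x
      q (suc i) = p i
      x∉p : ∀ i → x ≢ p i
      x∉p zero    x≡p0 = adj⇒≢ a (trans x≡p0 p0≡y)
      x∉p (suc i) x≡pi = proj₂ (proj₂ (edges i)) (sym x≡pi)
      q-inj : ∀ {i j} → q i ≡ q j → i ≡ j
      q-inj {zero}  {zero}  _  = refl
      q-inj {zero}  {suc j} eq = contradiction eq (x∉p j)
      q-inj {suc i} {zero}  eq = contradiction (sym eq) (x∉p i)
      q-inj {suc i} {suc j} eq = cong suc (inj eq)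
      q-edges : ∀ i → Adj T (q (inject₁ i)) (q (suc i))
      q-edges zero    = subst (Adj T x) (sym p0≡y) a
      q-edges (suc i) = proj₁ (edges i)
      q-path : IsPath T x y′ q
      q-path = record { injective = q-inj ; adjacent = q-edges ; start = refl ; end = pt≡y′ }

  -- Two such neighbours would be joined, through z, by a walk along which the
  -- distance to z stays below that of x.
  closer-unique : ∀ {x y y′} z → Adj T x y → Adj T x y′ → d y z ℕ.≤ d x z → d y′ z ℕ.≤ d x z → y ≡ y′
  closer-unique {x} {y} {y′} z a a′ y≤x y′≤x with y ≟ y′
  ... | yes y≡y′ = y≡y′
  ... | no y≢y′  = contradiction (descent _ refl (adj⇒≢ a ∘ sym) y≤x ◅◅ reverse-star (descent _ refl
      (adj⇒≢ a′ ∘ sym) y′≤x)) (no-bypass a a′ y≢y′)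
    where
    reverse-star : ∀ {s t} → Star (Avoiding x) s t → Star (Avoiding x) t s
    reverse-star done                = done
    reverse-star ((e , s≢x , t≢x) ◅ w) = reverse-star w ◅◅ ((Graph.Adj-sym T e , t≢x , s≢x) ◅ done)
    descent : ∀ t {s} → d s z ≡ t → s ≢ x → t ℕ.≤ d x z → Star (Avoiding x) s z
    descent zero    {s} e s≢x _   = subst (λ r → Star (Avoiding x) s r) (d≡0⇒≡ e) done
    descent (suc t) {s} e s≢x t<x with descend {s} {z} (λ { refl → contradiction (trans (sym e) (d-refl s)) λ () })
    ... | r , b , e′ = (b , s≢x , r≢x) ◅ descent t dr≡t r≢x (ℕ.<⇒≤ t<x)
      where
      dr≡t : d r z ≡ t
      dr≡t = ℕ.suc-injective (trans (sym e′) e)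
      r≢x : r ≢ x
      r≢x refl = ℕ.<-irrefl (sym dr≡t) t<x

  -- Equal distances are excluded because `closer-unique` allows equality: a neighbour of `x` that
  -- is not farther from `z` must be the one found by `descend`, which is strictly nearer.
  adj-dist : ∀ {x y} z → Adj T x y → d x z ≡ suc (d y z) ⊎ d y z ≡ suc (d x z)
  adj-dist {x} {y} z a with ℕ.≤-<-connex (d y z) (d x z)
  ... | inj₂ x<y = inj₂ (ℕ.≤-antisym (d-step z (Graph.Adj-sym T a)) x<y)
  ... | inj₁ y≤x with descend {x} {z} (λ { refl → adj⇒≢ a (sym (d≡0⇒≡ (ℕ.n≤0⇒n≡0
      (subst (d y x ℕ.≤_) (d-refl x) y≤x)))) })
  ... | y₀ , a₀ , e₀ = inj₁ (trans e₀ (cong (λ v → suc (d v z)) (closer-unique z a₀ a y₀≤x y≤x)))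
    where
    y₀≤x : d y₀ z ℕ.≤ d x z
    y₀≤x = subst (d y₀ z ℕ.≤_) (sym e₀) (ℕ.n≤1+n _)

  -- `x` is already the one neighbour of `y` nearer to `z`, so `w` cannot be another.
  keeps-receding : ∀ {x y w} z → Adj T x y → Adj T y w → x ≢ w → d y z ≡ suc (d x z) → d w z ≡ suc (d y z)
  keeps-receding {x} {y} {w} z a b x≢w e with adj-dist z b
  ... | inj₂ e′ = e′
  ... | inj₁ e′ = contradiction (closer-unique z (Graph.Adj-sym T a) b (below e) (below e′)) x≢w
    where
    below : ∀ {s t} → t ≡ suc s → s ℕ.≤ t
    below {s} e = subst (s ℕ.≤_) (sym e) (ℕ.n≤1+n s)

-- Projection onto a path of a tree

module _ where
  private
    -- `Keeps` compares consecutive indices through `toℕ`, since within `Fin k` they are of the form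
    -- `inject₁` and `suc` only once `k` is known to be a successor.
    Steps Keeps : ∀ k → (Fin (suc k) → ℕ) → Set
    Steps k δ = ∀ (i : Fin k) → δ (inject₁ i) ≡ suc (δ (suc i)) ⊎ δ (suc i) ≡ suc (δ (inject₁ i))
    Keeps k δ = ∀ (i j : Fin k) → toℕ j ≡ suc (toℕ i) → δ (suc i) ≡ suc (δ (inject₁ i)) → δ (suc j) ≡ suc (δ
        (inject₁ j))

    keeps-tail : ∀ {k} δ → Keeps (suc k) δ → Keeps k (δ ∘ suc)
    keeps-tail δ keeps i j e = keeps (suc i) (suc j) (cong suc e)

    rising : ∀ k δ → Keeps (suc k) δ → δ (suc zero) ≡ suc (δ zero) → ∀ b → δ b ≡ δ zero ℕ.+ toℕ b
    rising k       δ keeps up zero          = sym (ℕ.+-identityʳ _)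
    rising zero    δ keeps up (suc zero)    = trans up (ℕ.+-comm 1 (δ zero))
    rising (suc k) δ keeps up (suc b)       = trans
      (rising k (δ ∘ suc) (keeps-tail δ keeps) (keeps zero (suc zero) refl up) b)
      (trans (cong (ℕ._+ toℕ b) up) (sym (ℕ.+-suc (δ zero) (toℕ b))))

  -- Such a sequence descends by ones to its minimum `h`, reached at `a`, and then ascends by ones.
  -- For distances to the vertices of a path, `a` and `h` become foot and height.
  vee-shaped : ∀ k δ → Steps k δ → Keeps k δ → ∃[ a ] ∃[ h ] ∀ b → δ b ≡ h ℕ.+ ℕ.∣ toℕ {suc k} a - toℕ b ∣
  vee-shaped zero δ steps keeps = zero , δ zero , λ { zero → sym (ℕ.+-identityʳ _) }
  vee-shaped (suc k) δ steps keeps with steps zero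
  ... | inj₂ up   = zero , δ zero , rising k δ keeps up
  ... | inj₁ down with vee-shaped k (δ ∘ suc) (steps ∘ suc) (keeps-tail δ keeps)
  ...   | a , h , e = suc a , h , λ where
    zero    → trans down (trans (cong suc (trans (e zero) (cong (h ℕ.+_) (ℕ.∣-∣-identityʳ (toℕ a))))) (sym
        (ℕ.+-suc h (toℕ a))))
    (suc b) → e b

module PathProjection {n} (T : Graph n) (tree : IsTree T) {u v k} (p : Fin (suc k) → Fin n)
    (path : IsPath T u v p) where
  open TreeDistance T tree
  open IsPath path

  private
    vee : ∀ x → ∃[ a ] ∃[ h ] ∀ b → d (p b) x ≡ h ℕ.+ ℕ.∣ toℕ {suc k} a - toℕ b ∣
    vee x = vee-shaped k (λ b → d (p b) x) (λ i → adj-dist x (adjacent i)) keeps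
      where
      keeps : ∀ (i j : Fin k) → toℕ j ≡ suc (toℕ i) → d (p (suc i)) x ≡ suc (d (p (inject₁ i)) x) →
              d (p (suc j)) x ≡ suc (d (p (inject₁ j)) x)
      keeps i j j≡1+i up = subst (λ c → d (p (suc j)) x ≡ suc (d (p c) x)) 1+i≡j
        (keeps-receding x (adjacent i) (subst (λ c → Adj T (p c) (p (suc j))) (sym 1+i≡j) (adjacent j)) apart up)
        where
        1+i≡j : suc i ≡ inject₁ j
        1+i≡j = Fin.toℕ-injective (trans (sym j≡1+i) (sym (Fin.toℕ-inject₁ j)))
        apart : p (inject₁ i) ≢ p (suc j)
        apart e = ℕ.<-irrefl (trans (sym (Fin.toℕ-inject₁ i)) (cong toℕ (injective e)))
                             (s≤s (ℕ.≤-trans (ℕ.n≤1+n _) (ℕ.≤-reflexive (sym j≡1+i))))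

  opaque
    foot : Fin n → Fin (suc k)
    foot x = proj₁ (vee x)

    height : Fin n → ℕ
    height x = proj₁ (proj₂ (vee x))

    d-path : ∀ x b → d x (p b) ≡ height x ℕ.+ ℕ.∣ toℕ (foot x) - toℕ b ∣
    d-path x b = trans (d-sym x (p b)) (proj₂ (proj₂ (vee x)) b)

  height≡0⇒ : ∀ {x} → height x ≡ 0 → p (foot x) ≡ x
  height≡0⇒ {x} e = sym (d≡0⇒≡ (trans (d-path x (foot x)) (cong₂ ℕ._+_ e (ℕ.∣n-n∣≡0 (toℕ (foot x))))))

  private
    on-path : ∀ b → height (p b) ℕ.+ ℕ.∣ toℕ (foot (p b)) - toℕ b ∣ ≡ 0
    on-path b = trans (sym (d-path (p b) b)) (d-refl (p b))

  height-path : ∀ b → height (p b) ≡ 0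
  height-path b = ℕ.m+n≡0⇒m≡0 _ (on-path b)

  foot-path : ∀ b → foot (p b) ≡ b
  foot-path b = Fin.toℕ-injective (ℕ.∣m-n∣≡0⇒m≡n (ℕ.m+n≡0⇒n≡0 (height (p b)) (on-path b)))

  d-path-path : ∀ a b → d (p a) (p b) ≡ ℕ.∣ toℕ a - toℕ b ∣
  d-path-path a b = trans (d-path (p a) b) (cong₂ (λ h c → h ℕ.+ ℕ.∣ toℕ c - toℕ b ∣) (height-path a) (foot-path a))

  private
    -- The triangle inequality through the foot of `y`, the lower of the two vertices: `height x`
    -- plus the distance of the feet is at most `d x y` plus `height y`.
    d-lower-≤ : ∀ x y → height y ℕ.≤ height x → ℕ.∣ height x - height y ∣ ℕ.+ ℕ.∣ toℕ (foot x) - toℕ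
        (foot y) ∣ ℕ.≤ d x y
    d-lower-≤ x y hy≤hx = ℕ.+-cancelʳ-≤ (height y) _ _ (begin
      ℕ.∣ height x - height y ∣ ℕ.+ Δ ℕ.+ height y      ≡⟨ cong (λ r → r ℕ.+ Δ ℕ.+ height y) (ℕ.m≤n⇒∣n-m∣≡n∸m hy≤hx) ⟩
      (height x ∸ height y) ℕ.+ Δ ℕ.+ height y  ≡⟨ swap (height x ∸ height y) Δ (height y) ⟩
      (height x ∸ height y) ℕ.+ height y ℕ.+ Δ  ≡⟨ cong (ℕ._+ Δ) (ℕ.m∸n+n≡m hy≤hx) ⟩
      height x ℕ.+ Δ  ≡⟨ sym (d-path x (foot y)) ⟩
      d x (p (foot y))  ≤⟨ triangle x y (p (foot y)) ⟩
      d x y ℕ.+ d y (p (foot y))  ≡⟨ cong (d x y ℕ.+_) (trans (d-path y (foot y)) (trans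
          (cong (height y ℕ.+_) (ℕ.∣n-n∣≡0 (toℕ (foot y)))) (ℕ.+-identityʳ _))) ⟩
      d x y ℕ.+ height y                                ∎)
      where
      open ℕ.≤-Reasoning
      Δ = ℕ.∣ toℕ (foot x) - toℕ (foot y) ∣
      swap : ∀ r s t → r ℕ.+ s ℕ.+ t ≡ r ℕ.+ t ℕ.+ s
      swap r s t = trans (ℕ.+-assoc r s t) (trans (cong (r ℕ.+_) (ℕ.+-comm s t)) (sym (ℕ.+-assoc r t s)))

  d-lower : ∀ x y → ℕ.∣ height x - height y ∣ ℕ.+ ℕ.∣ toℕ (foot x) - toℕ (foot y) ∣ ℕ.≤ d x y
  d-lower x y with ℕ.≤-total (height y) (height x)
  ... | inj₁ hy≤hx = d-lower-≤ x y hy≤hx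
  ... | inj₂ hx≤hy = subst₂ ℕ._≤_
      (cong₂ ℕ._+_ (ℕ.∣-∣-comm (height y) (height x)) (ℕ.∣-∣-comm (toℕ (foot y)) (toℕ (foot x)))) (d-sym y x)
          (d-lower-≤ y x hx≤hy)

  -- A neighbour one step nearer to the foot of `x` has height exactly one less: not more, because
  -- its height is at most its distance to that foot, and not less, because by `d-lower` heights
  -- differ by at most one along an edge.
  height-below : ∀ h x t → height x ≡ h → t ℕ.≤ h → ∃[ y ] height y ≡ t
  height-below h x t e t≤h with ℕ.m≤n⇒m<n∨m≡n t≤h
  ... | inj₂ refl = x , e
  height-below (suc h) x t e t≤h | inj₁ (s≤s t≤h′) with descend {x} {p (foot x)} (λ x≡p → contradiction (trans (sym e)
      (trans (cong height x≡p) (height-path (foot x)))) λ ())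
  ... | y , a , e′ = height-below h y t (ℕ.≤-antisym hy≤h h≤hy) t≤h′
    where
    open ℕ.≤-Reasoning
    dy≡h : d y (p (foot x)) ≡ h
    dy≡h = ℕ.suc-injective (trans (sym e′) (trans (d-path x (foot x)) (trans (cong₂ ℕ._+_ e (ℕ.∣n-n∣≡0 (toℕ (foot x))))
        (ℕ.+-identityʳ _))))
    hy≤h : height y ℕ.≤ h
    hy≤h = ℕ.≤-trans (ℕ.m≤m+n (height y) _) (ℕ.≤-reflexive (trans (sym (d-path y (foot x))) dy≡h))
    h≤hy : h ℕ.≤ height y
    h≤hy = ℕ.s≤s⁻¹ (begin
      suc h  ≡⟨ sym e ⟩
      height x  ≤⟨ ℕ.m≤∣m-n∣+n (height x) (height y) ⟩
      ℕ.∣ height x - height y ∣ ℕ.+ height y      ≤⟨ ℕ.+-monoˡ-≤ (height y) (ℕ.≤-trans (ℕ.m≤m+n _ _) (d-lower x y)) ⟩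
      d x y ℕ.+ height y  ≡⟨ cong (ℕ._+ height y) (adj⇒d≡1 a) ⟩
      suc (height y)                              ∎)

-- The Laplacian of a tree

connected⇒degree≢0 : ∀ {n} (G : Graph n) → Connected G → ∀ {i j} → i ≢ j → degree G i ≢ 0
connected⇒degree≢0 G conn {i} {j} i≢j deg≡0 with conn i j
... | done = i≢j refl
... | _◅_ {j = y} a _ = ℚ.1≢0 (trans (sym (adj-yes G a)) (∑-nonNeg-≡0 (0≤adj G i) row≡0 y))
  where
  row≡0 : sum (adjℚ G i) ≡ 0ℚ
  row≡0 = trans (∑-adj G i) (trans (degℚ-ι G i) (cong ι deg≡0))

∑-⟦⟧ : ∀ {n} (i : Fin n) → ∑[ j < n ] ⟦ j ≟ i ⟧ ≡ 1ℚ
∑-⟦⟧ i = trans (sum-cong-≗ λ j → sym (ℚ.*-identityʳ ⟦ j ≟ i ⟧)) (∑-δ i (λ _ → 1ℚ))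

module TreeLaplacian {n} (T : Graph n) (tree : IsTree T) where
  open TreeDistance T tree
  open ≡-Reasoning

  opaque
    dist : Fin n → Fin n → ℚ
    dist x y = ι (d x y)

    dist-ι : ∀ x y → dist x y ≡ ι (d x y)
    dist-ι x y = refl

    τ : Fin n → ℚ
    τ i = ι 2 - degℚ T i

    τ-def : ∀ i → τ i ≡ ι 2 - degℚ T i
    τ-def i = refl

  dist-refl : ∀ x → dist x x ≡ 0ℚ
  dist-refl x = trans (dist-ι x x) (cong ι (d-refl x))

  dist-sym : ∀ x y → dist x y ≡ dist y x
  dist-sym x y = trans (dist-ι x y) (trans (cong ι (d-sym x y)) (sym (dist-ι y x)))

  dist-suc : ∀ {x y z w} → d x y ≡ suc (d z w) → dist x y ≡ 1ℚ + dist z w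
  dist-suc {x} {y} {z} {w} e = trans (dist-ι x y) (trans (cong ι e) (trans (ι-suc (d z w)) (cong (1ℚ +_)
      (sym (dist-ι z w)))))

  private
    N-1 : ℚ
    N-1 = ι n - 1ℚ

  -- Away from `z` exactly one neighbour is nearer and contributes 1, and every other one
  -- contributes -1, which gives 2 minus the degree; at `z` all contribute -1, which is 2 less. The
  -- factor `1ℚ` is the scale `s` of the resistance metric.
  laplacian-dist : ∀ z i → laplacian T (λ x → dist x z) i ≡ τ i - ι 2 * 1ℚ * ⟦ i ≟ z ⟧
  laplacian-dist z i with i ≟ z
  ... | yes refl = begin
    laplacian T (λ x → dist x i) i     ≡⟨ laplacian-∑ T _ i ⟩
    ∑[ j < n ] (adjℚ T i j * (dist i i - dist j i)) ≡⟨ ∑-lin₁ (- 1ℚ) term ⟩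
    - 1ℚ * sum (adjℚ T i)  ≡⟨ cong (- 1ℚ *_) (∑-adj T i) ⟩
    - 1ℚ * degℚ T i  ≡⟨ collect (degℚ T i) ⟩
    ι 2 - degℚ T i - ι 2 * 1ℚ * 1ℚ     ≡⟨ cong (_- ι 2 * 1ℚ * 1ℚ) (sym (τ-def i)) ⟩
    τ i - ι 2 * 1ℚ * 1ℚ  ∎
    where
    collect : ∀ D → - 1ℚ * D ≡ ι 2 - D - ι 2 * 1ℚ * 1ℚ
    collect = solve-∀ ℚ-ring
    zeros : ∀ x → 0ℚ * x ≡ - 1ℚ * 0ℚ
    zeros = solve-∀ ℚ-ring
    term : ∀ j → adjℚ T i j * (dist i i - dist j i) ≡ - 1ℚ * adjℚ T i j
    term j with adj? T i j
    ... | no ¬a = trans (cong (_* (dist i i - dist j i)) (adj-no T ¬a)) (trans (zeros (dist i i - dist j i))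
        (cong (- 1ℚ *_) (sym (adj-no T ¬a))))
    ... | yes a = trans (cong₂ (λ p q → adjℚ T i j * (p - q)) (dist-refl i) (trans (dist-ι j i)
        (cong ι (adj⇒d≡1 (Graph.Adj-sym T a))))) (ℚ.*-comm (adjℚ T i j) (- 1ℚ))
  ... | no i≢z with descend i≢z
  ... | y₀ , a₀ , e₀ = begin
    laplacian T (λ x → dist x z) i  ≡⟨ laplacian-∑ T _ i ⟩
    ∑[ j < n ] (adjℚ T i j * (dist i z - dist j z))     ≡⟨ ∑-lin₂ (- 1ℚ) (ι 2) term ⟩
    - 1ℚ * sum (adjℚ T i) + ι 2 * ∑[ j < n ] ⟦ j ≟ y₀ ⟧ ≡⟨ cong₂ (λ p q → - 1ℚ * p + ι 2 * q) (∑-adj T i) (∑-⟦⟧ y₀) ⟩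
    - 1ℚ * degℚ T i + ι 2 * 1ℚ  ≡⟨ collect (degℚ T i) ⟩
    ι 2 - degℚ T i - ι 2 * 1ℚ * 0ℚ  ≡⟨ cong (_- ι 2 * 1ℚ * 0ℚ) (sym (τ-def i)) ⟩
    τ i - ι 2 * 1ℚ * 0ℚ  ∎
    where
    collect : ∀ D → - 1ℚ * D + ι 2 * 1ℚ ≡ ι 2 - D - ι 2 * 1ℚ * 0ℚ
    collect = solve-∀ ℚ-ring
    zeros : ∀ x → 0ℚ * x ≡ - 1ℚ * 0ℚ + ι 2 * 0ℚ
    zeros = solve-∀ ℚ-ring
    farther : ∀ x → 1ℚ * (x - (1ℚ + x)) ≡ - 1ℚ * 1ℚ + ι 2 * 0ℚ
    farther = solve-∀ ℚ-ring
    nearer : ∀ x → 1ℚ * (1ℚ + x - x) ≡ - 1ℚ * 1ℚ + ι 2 * 1ℚ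
    nearer = solve-∀ ℚ-ring
    below : ∀ {s t} → t ≡ suc s → s ℕ.≤ t
    below {s} e = subst (s ℕ.≤_) (sym e) (ℕ.n≤1+n s)
    term : ∀ j → adjℚ T i j * (dist i z - dist j z) ≡ - 1ℚ * adjℚ T i j + ι 2 * ⟦ j ≟ y₀ ⟧
    term j with j ≟ y₀
    ... | yes refl = trans (cong₂ (λ p q → p * (q - dist j z)) (adj-yes T a₀) (dist-suc e₀))
                           (trans (nearer (dist j z)) (cong (λ p → - 1ℚ * p + ι 2 * 1ℚ) (sym (adj-yes T a₀))))
    ... | no j≢y₀ with adj? T i j
    ...   | no ¬a = trans (cong (_* (dist i z - dist j z)) (adj-no T ¬a)) (trans (zeros (dist i z - dist j z)) (cong
        (λ p → - 1ℚ * p + ι 2 * 0ℚ) (sym (adj-no T ¬a))))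
    ...   | yes a with adj-dist z a
    ...     | inj₁ e = contradiction (closer-unique z a a₀ (below e) (below e₀)) j≢y₀
    ...     | inj₂ e = trans (cong₂ (λ p q → p * (dist i z - q)) (adj-yes T a) (dist-suc e))
                             (trans (farther (dist i z)) (cong (λ p → - 1ℚ * p + ι 2 * 0ℚ) (sym (adj-yes T a))))

  -- A Laplacian sums to zero. This is the edge count `n - 1` of a tree in disguise; the argument
  -- supplies a vertex.
  ∑-τ : Fin n → sum τ ≡ ι 2
  ∑-τ z = p-q≡0⇒p≡q (begin
    sum τ - ι 2  ≡⟨ collect (sum τ) ⟩
    1ℚ * sum τ + - ι 2 * 1ℚ  ≡⟨ cong (λ x → 1ℚ * sum τ + - ι 2 * x) (sym (∑-⟦⟧ z)) ⟩
    1ℚ * sum τ + - ι 2 * ∑[ i < n ] ⟦ i ≟ z ⟧  ≡⟨ sym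
        (∑-lin₂ 1ℚ (- ι 2) λ i → trans (laplacian-dist z i) (expand (τ i) ⟦ i ≟ z ⟧)) ⟩
    sum (laplacian T (λ x → dist x z))  ≡⟨ ∑-laplacian T _ ⟩
    0ℚ                                                   ∎)
    where
    collect : ∀ s → s - ι 2 ≡ 1ℚ * s + - ι 2 * 1ℚ
    collect = solve-∀ ℚ-ring
    expand : ∀ t b → t - ι 2 * 1ℚ * b ≡ 1ℚ * t + - ι 2 * b
    expand = solve-∀ ℚ-ring

  -- Obtained by summing the Laplacian of the squared distance.
  ∑-τ-dist : ∀ z → ∑[ x < n ] (τ x * dist x z) ≡ N-1
  ∑-τ-dist z = *-cancelˡ {ι 2} (λ ()) (p-q≡0⇒p≡q (begin
    ι 2 * X - ι 2 * N-1  ≡⟨ collect X (ι n) ⟩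
    ι 2 * X + 1ℚ * ι 2 + - ι 2 * (ι n * 1ℚ)  ≡⟨ cong₂ (λ p q → ι 2 * X + 1ℚ * p + - ι 2 * q)
        (sym (∑-τ z)) (sym (∑-const n 1ℚ)) ⟩
    ι 2 * X + 1ℚ * sum τ + - ι 2 * ∑[ x < n ] 1ℚ  ≡⟨ sym (∑-lin₃ (ι 2) 1ℚ (- ι 2) laplacian-sq) ⟩
    sum (laplacian T (λ x → dist x z * dist x z))  ≡⟨ ∑-laplacian T _ ⟩
    0ℚ                                                              ∎))
    where
    X = ∑[ x < n ] (τ x * dist x z)
    collect : ∀ X N → ι 2 * X - ι 2 * (N - 1ℚ) ≡ ι 2 * X + 1ℚ * ι 2 + - ι 2 * (N * 1ℚ)
    collect = solve-∀ ℚ-ring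
    -- On an edge, x² - y² = 2x(x - y) - (x - y)², where the last square is 1.
    difference : ∀ i j → adjℚ T i j * (dist i z * dist i z - dist j z * dist j z) ≡
                 ι 2 * dist i z * (adjℚ T i j * (dist i z - dist j z)) + - 1ℚ * adjℚ T i j
    difference i j with adj? T i j
    ... | no ¬a rewrite adj-no T ¬a = zeros (dist i z * dist i z - dist j z * dist j z) (dist i z) (dist i z - dist j z)
      where
      zeros : ∀ x y w → 0ℚ * x ≡ ι 2 * y * (0ℚ * w) + - 1ℚ * 0ℚ
      zeros = solve-∀ ℚ-ring
    ... | yes a with adj-dist z a
    ...   | inj₁ e rewrite adj-yes T a | dist-suc e = nearer (dist j z)
      where
      nearer : ∀ y → 1ℚ * ((1ℚ + y) * (1ℚ + y) - y * y) ≡ ι 2 * (1ℚ + y) * (1ℚ * (1ℚ + y - y)) + - 1ℚ * 1ℚ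
      nearer = solve-∀ ℚ-ring
    ...   | inj₂ e rewrite adj-yes T a | dist-suc e = farther (dist i z)
      where
      farther : ∀ x → 1ℚ * (x * x - (1ℚ + x) * (1ℚ + x)) ≡ ι 2 * x * (1ℚ * (x - (1ℚ + x))) + - 1ℚ * 1ℚ
      farther = solve-∀ ℚ-ring
    dist*⟦⟧ : ∀ i → dist i z * ⟦ i ≟ z ⟧ ≡ 0ℚ
    dist*⟦⟧ i with i ≟ z
    ... | yes refl = trans (cong (_* 1ℚ) (dist-refl i)) refl
    ... | no _     = ℚ.*-zeroʳ (dist i z)
    laplacian-sq : ∀ i → laplacian T (λ x → dist x z * dist x z) i ≡ ι 2 * (τ i * dist i z) + 1ℚ * τ i + - ι 2 * 1ℚ
    laplacian-sq i = begin
      laplacian T (λ x → dist x z * dist x z) i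
        ≡⟨ trans (laplacian-∑ T _ i) (∑-lin₂ (ι 2 * dist i z) (- 1ℚ) (difference i)) ⟩
      ι 2 * dist i z * ∑[ j < n ] (adjℚ T i j * (dist i z - dist j z)) + - 1ℚ * sum (adjℚ T i)
        ≡⟨ cong₂ (λ p q → ι 2 * dist i z * p + - 1ℚ * q) (trans (sym (laplacian-∑ T _ i)) (laplacian-dist z i))
            (∑-adj T i) ⟩
      ι 2 * dist i z * (τ i - ι 2 * 1ℚ * ⟦ i ≟ z ⟧) + - 1ℚ * degℚ T i
        ≡⟨ regroup (dist i z) (τ i) ⟦ i ≟ z ⟧ (degℚ T i) ⟩
      ι 2 * (τ i * dist i z) + 1ℚ * (ι 2 - degℚ T i) + - ι 2 * 1ℚ - ι 4 * (dist i z * ⟦ i ≟ z ⟧)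
        ≡⟨ cong₂ (λ p q → ι 2 * (τ i * dist i z) + 1ℚ * p + - ι 2 * 1ℚ - ι 4 * q) (sym (τ-def i)) (dist*⟦⟧ i) ⟩
      ι 2 * (τ i * dist i z) + 1ℚ * τ i + - ι 2 * 1ℚ - ι 4 * 0ℚ
        ≡⟨ drop (ι 2 * (τ i * dist i z) + 1ℚ * τ i + - ι 2 * 1ℚ) ⟩
      ι 2 * (τ i * dist i z) + 1ℚ * τ i + - ι 2 * 1ℚ ∎
      where
      regroup : ∀ d t b D → ι 2 * d * (t - ι 2 * 1ℚ * b) + - 1ℚ * D ≡ ι 2 * (t * d) + 1ℚ *
          (ι 2 - D) + - ι 2 * 1ℚ - ι 4 * (d * b)
      regroup = solve-∀ ℚ-ring
      drop : ∀ x → x - ι 4 * 0ℚ ≡ x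
      drop = solve-∀ ℚ-ring

-- Power sums

∑-toℕ : ∀ k → ι 2 * ∑[ b < suc k ] ι (toℕ b) ≡ ι k * (ι k + 1ℚ)
∑-toℕ zero    = refl
∑-toℕ (suc k) = begin
  ι 2 * (0ℚ + ∑[ b < suc k ] ι (suc (toℕ b)))       ≡⟨ cong (λ x → ι 2 * (0ℚ + x))
      (∑-lin₂ {n = suc k} {f = λ b → ι (toℕ b)} {λ _ → 1ℚ} 1ℚ 1ℚ (λ b → trans (ι-suc (toℕ b)) (expand (ι (toℕ b))))) ⟩
  ι 2 * (0ℚ + (1ℚ * S + 1ℚ * ∑[ b < suc k ] 1ℚ))    ≡⟨ cong (λ x → ι 2 * (0ℚ + (1ℚ * S + 1ℚ * x))) (trans
      (∑-const (suc k) 1ℚ) (cong (_* 1ℚ) (ι-suc k))) ⟩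
  ι 2 * (0ℚ + (1ℚ * S + 1ℚ * ((1ℚ + ι k) * 1ℚ)))    ≡⟨ regroup S (ι k) ⟩
  ι 2 * S + ι 2 * (1ℚ + ι k)  ≡⟨ cong (_+ ι 2 * (1ℚ + ι k)) (∑-toℕ k) ⟩
  ι k * (ι k + 1ℚ) + ι 2 * (1ℚ + ι k)  ≡⟨ close (ι k) ⟩
  (1ℚ + ι k) * (1ℚ + ι k + 1ℚ)  ≡⟨ cong (λ x → x * (x + 1ℚ)) (sym (ι-suc k)) ⟩
  ι (suc k) * (ι (suc k) + 1ℚ)  ∎
  where
  open ≡-Reasoning
  S = ∑[ b < suc k ] ι (toℕ b)
  expand : ∀ b → 1ℚ + b ≡ 1ℚ * b + 1ℚ * 1ℚ
  expand = solve-∀ ℚ-ring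
  regroup : ∀ S k → ι 2 * (0ℚ + (1ℚ * S + 1ℚ * ((1ℚ + k) * 1ℚ))) ≡ ι 2 * S + ι 2 * (1ℚ + k)
  regroup = solve-∀ ℚ-ring
  close : ∀ k → k * (k + 1ℚ) + ι 2 * (1ℚ + k) ≡ (1ℚ + k) * (1ℚ + k + 1ℚ)
  close = solve-∀ ℚ-ring

∑-toℕ² : ∀ k → ι 6 * ∑[ b < suc k ] (ι (toℕ b) * ι (toℕ b)) ≡ ι k * (ι k + 1ℚ) * (ι 2 * ι k + 1ℚ)
∑-toℕ² zero    = refl
∑-toℕ² (suc k) = begin
  ι 6 * (0ℚ * 0ℚ + ∑[ b < suc k ] (ι (suc (toℕ b)) * ι (suc (toℕ b))))
    ≡⟨ cong (λ x → ι 6 * (0ℚ * 0ℚ + x)) (∑-lin₃ {n = suc k} {f = λ b → ι (toℕ b) * ι (toℕ b)} {λ b → ι (toℕ b)} {λ _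
        → 1ℚ} 1ℚ (ι 2) 1ℚ (λ b → trans (cong (λ x → x * x) (ι-suc (toℕ b))) (expand (ι (toℕ b))))) ⟩
  ι 6 * (0ℚ * 0ℚ + (1ℚ * S₂ + ι 2 * S₁ + 1ℚ * ∑[ b < suc k ] 1ℚ))
    ≡⟨ cong (λ x → ι 6 * (0ℚ * 0ℚ + (1ℚ * S₂ + ι 2 * S₁ + 1ℚ * x))) (trans (∑-const (suc k) 1ℚ)
        (cong (_* 1ℚ) (ι-suc k))) ⟩
  ι 6 * (0ℚ * 0ℚ + (1ℚ * S₂ + ι 2 * S₁ + 1ℚ * ((1ℚ + ι k) * 1ℚ)))
    ≡⟨ regroup S₁ S₂ (ι k) ⟩
  ι 6 * S₂ + ι 6 * (ι 2 * S₁) + ι 6 * (1ℚ + ι k)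
    ≡⟨ cong₂ (λ p q → p + ι 6 * q + ι 6 * (1ℚ + ι k)) (∑-toℕ² k) (∑-toℕ k) ⟩
  ι k * (ι k + 1ℚ) * (ι 2 * ι k + 1ℚ) + ι 6 * (ι k * (ι k + 1ℚ)) + ι 6 * (1ℚ + ι k)
    ≡⟨ close (ι k) ⟩
  (1ℚ + ι k) * (1ℚ + ι k + 1ℚ) * (ι 2 * (1ℚ + ι k) + 1ℚ)
    ≡⟨ cong (λ x → x * (x + 1ℚ) * (ι 2 * x + 1ℚ)) (sym (ι-suc k)) ⟩
  ι (suc k) * (ι (suc k) + 1ℚ) * (ι 2 * ι (suc k) + 1ℚ) ∎
  where
  open ≡-Reasoning
  S₁ = ∑[ b < suc k ] ι (toℕ b)
  S₂ = ∑[ b < suc k ] (ι (toℕ b) * ι (toℕ b))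
  expand : ∀ b → (1ℚ + b) * (1ℚ + b) ≡ 1ℚ * (b * b) + ι 2 * b + 1ℚ * 1ℚ
  expand = solve-∀ ℚ-ring
  regroup : ∀ s₁ s₂ k → ι 6 * (0ℚ * 0ℚ + (1ℚ * s₂ + ι 2 * s₁ + 1ℚ * ((1ℚ + k) * 1ℚ))) ≡ ι 6 * s₂ + ι 6 *
      (ι 2 * s₁) + ι 6 * (1ℚ + k)
  regroup = solve-∀ ℚ-ring
  close : ∀ k → k * (k + 1ℚ) * (ι 2 * k + 1ℚ) + ι 6 * (k * (k + 1ℚ)) + ι 6 * (1ℚ + k) ≡ (1ℚ + k) * (1ℚ + k + 1ℚ) *
      (ι 2 * (1ℚ + k) + 1ℚ)
  close = solve-∀ ℚ-ring

-- The square is completed around the midpoint: `2a - k` is also what later measures how far a foot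
-- is from the middle. The induction peels off the vertex 0.
∑-gap : ∀ {k} (a : Fin (suc k)) → ι 4 * ∑[ b < suc k ] ι ℕ.∣ toℕ a - toℕ b ∣ ≡
        (ι 2 * ι (toℕ a) - ι k) * (ι 2 * ι (toℕ a) - ι k) + ι k * ι k + ι 2 * ι k
∑-gap {k} zero = begin
  ι 4 * S  ≡⟨ double S ⟩
  ι 2 * (ι 2 * S)        ≡⟨ cong (ι 2 *_) (∑-toℕ k) ⟩
  ι 2 * (ι k * (ι k + 1ℚ)) ≡⟨ close (ι k) ⟩
  (ι 2 * 0ℚ - ι k) * (ι 2 * 0ℚ - ι k) + ι k * ι k + ι 2 * ι k ∎
  where
  open ≡-Reasoning
  S = ∑[ b < suc k ] ι (toℕ b)
  double : ∀ S → ι 4 * S ≡ ι 2 * (ι 2 * S)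
  double = solve-∀ ℚ-ring
  close : ∀ k → ι 2 * (k * (k + 1ℚ)) ≡ (ι 2 * 0ℚ - k) * (ι 2 * 0ℚ - k) + k * k + ι 2 * k
  close = solve-∀ ℚ-ring
∑-gap {suc k} (suc a) = begin
  ι 4 * (ι (suc (toℕ a)) + S)
    ≡⟨ regroup (ι (suc (toℕ a))) S ⟩
  ι 4 * ι (suc (toℕ a)) + ι 4 * S
    ≡⟨ cong₂ (λ p q → ι 4 * p + q) (ι-suc (toℕ a)) (∑-gap a) ⟩
  ι 4 * (1ℚ + ι (toℕ a)) + ((ι 2 * ι (toℕ a) - ι k) * (ι 2 * ι (toℕ a) - ι k) + ι k * ι k + ι 2 * ι k)
    ≡⟨ close (ι (toℕ a)) (ι k) ⟩
  (ι 2 * (1ℚ + ι (toℕ a)) - (1ℚ + ι k)) * (ι 2 * (1ℚ + ι (toℕ a)) - (1ℚ + ι k)) + (1ℚ + ι k) * (1ℚ + ι k) + ι 2 *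
      (1ℚ + ι k)
    ≡⟨ cong₂ (λ a k → (ι 2 * a - k) * (ι 2 * a - k) + k * k + ι 2 * k) (sym (ι-suc (toℕ a))) (sym (ι-suc k)) ⟩
  (ι 2 * ι (suc (toℕ a)) - ι (suc k)) * (ι 2 * ι (suc (toℕ a)) - ι (suc k)) + ι (suc k) * ι (suc k) + ι 2 * ι (suc k) ∎
  where
  open ≡-Reasoning
  S = ∑[ b < suc k ] ι ℕ.∣ toℕ a - toℕ b ∣
  regroup : ∀ a S → ι 4 * (a + S) ≡ ι 4 * a + ι 4 * S
  regroup = solve-∀ ℚ-ring
  close : ∀ a k → ι 4 * (1ℚ + a) + ((ι 2 * a - k) * (ι 2 * a - k) + k * k + ι 2 * k) ≡
          (ι 2 * (1ℚ + a) - (1ℚ + k)) * (ι 2 * (1ℚ + a) - (1ℚ + k)) + (1ℚ + k) * (1ℚ + k) + ι 2 * (1ℚ + k)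
  close = solve-∀ ℚ-ring

ι-∸ : ∀ {m n} → m ℕ.≤ n → ι (n ∸ m) ≡ ι n - ι m
ι-∸ {m} {n} m≤n = sym (trans (cong (λ x → ι x - ι m) (sym (ℕ.m∸n+n≡m m≤n))) (trans
    (cong (_- ι m) (ι-+ (n ∸ m) m)) (cancel (ι (n ∸ m)) (ι m))))
  where
  cancel : ∀ x y → x + y - y ≡ x
  cancel = solve-∀ ℚ-ring

-- Applied with `2 - σ` the degree in the tree and then in the unicyclic graph. Each of the two
-- mixed terms contributes `sum r`, one of them after exchanging the sums by the symmetry of `K`.
∑-quadratic : ∀ {n} (σ : Fin n → ℚ) (K : Fin n → Fin n → ℚ) (r : Fin n → ℚ) → (∀ x y → K x y ≡ K y x) →
  (∀ x → ∑[ y < n ] (σ y * K x y) ≡ r x) →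
  ∑[ x < n ] ((ι 2 - σ x) * ∑[ y < n ] ((ι 2 - σ y) * K x y)) ≡
  ι 4 * ∑[ x < n ] ∑[ y < n ] K x y - ι 4 * sum r + ∑[ x < n ] (σ x * r x)
∑-quadratic {n} σ K r K-sym σK = begin
  ∑[ x < n ] ((ι 2 - σ x) * ∑[ y < n ] ((ι 2 - σ y) * K x y))
    ≡⟨ ∑-lin₄ (ι 4) (- ι 2) (- ι 2) 1ℚ (λ x → trans (cong ((ι 2 - σ x) *_) (inner x)) (expand (σ x) (sum (K x))
        (r x))) ⟩
  ι 4 * ∑[ x < n ] sum (K x) + - ι 2 * sum r + - ι 2 * ∑[ x < n ] (σ x * sum (K x)) + 1ℚ * ∑[ x < n ] (σ x * r x)
    ≡⟨ cong (λ s → ι 4 * ∑[ x < n ] sum (K x) + - ι 2 * sum r + - ι 2 * s + 1ℚ * ∑[ x < n ] (σ x * r x)) swap ⟩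
  ι 4 * ∑[ x < n ] sum (K x) + - ι 2 * sum r + - ι 2 * sum r + 1ℚ * ∑[ x < n ] (σ x * r x)
    ≡⟨ collect (∑[ x < n ] sum (K x)) (sum r) (∑[ x < n ] (σ x * r x)) ⟩
  ι 4 * ∑[ x < n ] ∑[ y < n ] K x y - ι 4 * sum r + ∑[ x < n ] (σ x * r x) ∎
  where
  open ≡-Reasoning
  distr : ∀ s k → (ι 2 - s) * k ≡ ι 2 * k + - 1ℚ * (s * k)
  distr = solve-∀ ℚ-ring
  inner : ∀ x → ∑[ y < n ] ((ι 2 - σ y) * K x y) ≡ ι 2 * sum (K x) + - 1ℚ * r x
  inner x = trans (∑-lin₂ (ι 2) (- 1ℚ) (λ y → distr (σ y) (K x y))) (cong (λ s → ι 2 * sum (K x) + - 1ℚ * s) (σK x))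
  expand : ∀ s k r → (ι 2 - s) * (ι 2 * k + - 1ℚ * r) ≡ ι 4 * k + - ι 2 * r + - ι 2 * (s * k) + 1ℚ * (s * r)
  expand = solve-∀ ℚ-ring
  swap : ∑[ x < n ] (σ x * sum (K x)) ≡ sum r
  swap = begin
    ∑[ x < n ] (σ x * sum (K x))  ≡⟨ sum-cong-≗ (λ x → *-distribˡ-sum (σ x) (K x)) ⟩
    ∑[ x < n ] ∑[ y < n ] (σ x * K x y)       ≡⟨ ∑-comm (λ x y → σ x * K x y) ⟩
    ∑[ y < n ] ∑[ x < n ] (σ x * K x y)       ≡⟨ sum-cong-≗ (λ y → trans
        (sum-cong-≗ λ x → cong (σ x *_) (K-sym x y)) (σK y)) ⟩
    sum r  ∎
  collect : ∀ k r s → ι 4 * k + - ι 2 * r + - ι 2 * r + 1ℚ * s ≡ ι 4 * k - ι 4 * r + s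
  collect = solve-∀ ℚ-ring

⟦⟧*⟦⟧-no : ∀ {P Q : Set} (P? : Dec P) (Q? : Dec Q) → (P → ¬ Q) → ⟦ P? ⟧ * ⟦ Q? ⟧ ≡ 0ℚ
⟦⟧*⟦⟧-no (yes p) Q? excl = trans (cong (1ℚ *_) (⟦⟧-no Q? (excl p))) refl
⟦⟧*⟦⟧-no (no _)  Q? excl = ℚ.*-zeroˡ ⟦ Q? ⟧

-- Degrees and Laplacian after adding an edge

module _ {n} (T : Graph n) {u v : Fin n} (u≢v : u ≢ v) (¬uv : ¬ Adj T u v) where
  private
    G : Graph n
    G = addEdge T u≢v

  -- Non-adjacency of `u` and `v` makes the entries add; an existing edge would be counted twice on
  -- the right but once on the left.
  adj-addEdge : ∀ i j → adjℚ G i j ≡ 1ℚ * adjℚ T i j + ⟦ i ≟ u ⟧ * ⟦ j ≟ v ⟧ + ⟦ i ≟ v ⟧ * ⟦ j ≟ u ⟧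
  adj-addEdge i j with adj? T i j
  ... | yes a = trans (adj-yes G (inj₁ a)) (sym (cong₂ _+_ (cong₂ _+_ (cong (1ℚ *_) (adj-yes T a))
      (⟦⟧*⟦⟧-no (i ≟ u) (j ≟ v) λ { refl refl → ¬uv a })) (⟦⟧*⟦⟧-no (i ≟ v) (j ≟ u) λ { refl refl → ¬uv
          (Graph.Adj-sym T a) })))
  ... | no ¬a with (i ≟ u) ×-dec (j ≟ v) | (i ≟ v) ×-dec (j ≟ u)
  ...   | yes (refl , refl) | _ = trans (adj-yes G (inj₂ (inj₁ (refl , refl)))) (sym (cong₂ _+_ (cong₂ _+_
      (cong (1ℚ *_) (adj-no T ¬a))
      (cong₂ _*_ (⟦⟧-yes (i ≟ i) refl) (⟦⟧-yes (j ≟ j) refl))) (⟦⟧*⟦⟧-no (i ≟ j) (j ≟ i) λ i≡j _ → u≢v i≡j)))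
  ...   | no _ | yes (refl , refl) = trans (adj-yes G (inj₂ (inj₂ (refl , refl)))) (sym (cong₂ _+_ (cong₂ _+_
      (cong (1ℚ *_) (adj-no T ¬a))
      (⟦⟧*⟦⟧-no (i ≟ j) (j ≟ i) λ i≡j _ → u≢v (sym i≡j))) (cong₂ _*_ (⟦⟧-yes (i ≟ i) refl) (⟦⟧-yes (j ≟ j) refl))))
  ...   | no ¬uv′ | no ¬vu = trans (adj-no G λ { (inj₁ a) → ¬a a ; (inj₂ (inj₁ e)) → ¬uv′ e ; (inj₂ (inj₂ e)) → ¬vu e })
      (sym (cong₂ _+_ (cong₂ _+_ (cong (1ℚ *_) (adj-no T ¬a))
        (⟦⟧*⟦⟧-no (i ≟ u) (j ≟ v) λ p q → ¬uv′ (p , q))) (⟦⟧*⟦⟧-no (i ≟ v) (j ≟ u) λ p q → ¬vu (p , q))))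

  degree-addEdge : ∀ i → degℚ G i ≡ degℚ T i + ⟦ i ≟ u ⟧ + ⟦ i ≟ v ⟧
  degree-addEdge i = begin
    degℚ G i  ≡⟨ sym (∑-adj G i) ⟩
    sum (adjℚ G i)  ≡⟨ ∑-lin₃ 1ℚ ⟦ i ≟ u ⟧ ⟦ i ≟ v ⟧ (adj-addEdge i) ⟩
    1ℚ * sum (adjℚ T i) + ⟦ i ≟ u ⟧ * ∑[ j < n ] ⟦ j ≟ v ⟧ + ⟦ i ≟ v ⟧ * ∑[ j < n ] ⟦ j ≟ u ⟧
      ≡⟨ cong₂ _+_ (cong₂ (λ p q → 1ℚ * p + ⟦ i ≟ u ⟧ * q) (∑-adj T i) (∑-⟦⟧ v)) (cong (⟦ i ≟ v ⟧ *_) (∑-⟦⟧ u)) ⟩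
    1ℚ * degℚ T i + ⟦ i ≟ u ⟧ * 1ℚ + ⟦ i ≟ v ⟧ * 1ℚ ≡⟨ units (degℚ T i) ⟦ i ≟ u ⟧ ⟦ i ≟ v ⟧ ⟩
    degℚ T i + ⟦ i ≟ u ⟧ + ⟦ i ≟ v ⟧  ∎
    where
    open ≡-Reasoning
    units : ∀ d p q → 1ℚ * d + p * 1ℚ + q * 1ℚ ≡ d + p + q
    units = solve-∀ ℚ-ring

  laplacian-addEdge : ∀ f i → laplacian G f i ≡ laplacian T f i + ⟦ i ≟ u ⟧ * (f u - f v) + ⟦ i ≟ v ⟧ * (f v - f u)
  laplacian-addEdge f i = begin
    laplacian G f i
      ≡⟨ trans (laplacian-∑ G f i) (∑-lin₃ 1ℚ ⟦ i ≟ u ⟧ ⟦ i ≟ v ⟧ (λ j → trans (cong (_* (f i - f j)) (adj-addEdge i j))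
           (expand (adjℚ T i j) ⟦ i ≟ u ⟧ ⟦ j ≟ v ⟧ ⟦ i ≟ v ⟧ ⟦ j ≟ u ⟧ (f i - f j)))) ⟩
    1ℚ * ∑[ j < n ] (adjℚ T i j * (f i - f j)) + ⟦ i ≟ u ⟧ * ∑[ j < n ] (⟦ j ≟ v ⟧ *
        (f i - f j)) + ⟦ i ≟ v ⟧ * ∑[ j < n ] (⟦ j ≟ u ⟧ * (f i - f j))
      ≡⟨ cong₂ _+_ (cong₂ (λ p q → 1ℚ * p + ⟦ i ≟ u ⟧ * q) (sym (laplacian-∑ T f i)) (∑-δ v (λ j → f i - f j)))
          (cong (⟦ i ≟ v ⟧ *_) (∑-δ u (λ j → f i - f j))) ⟩
    1ℚ * laplacian T f i + ⟦ i ≟ u ⟧ * (f i - f v) + ⟦ i ≟ v ⟧ * (f i - f u)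
      ≡⟨ cong₂ _+_ (cong₂ _+_ (ℚ.*-identityˡ (laplacian T f i)) (at u (λ w → w - f v))) (at v (λ w → w - f u)) ⟩
    laplacian T f i + ⟦ i ≟ u ⟧ * (f u - f v) + ⟦ i ≟ v ⟧ * (f v - f u) ∎
    where
    open ≡-Reasoning
    expand : ∀ a p q r s x → (1ℚ * a + p * q + r * s) * x ≡ 1ℚ * (a * x) + p * (q * x) + r * (s * x)
    expand = solve-∀ ℚ-ring
    at : ∀ w (g : ℚ → ℚ) → ⟦ i ≟ w ⟧ * g (f i) ≡ ⟦ i ≟ w ⟧ * g (f w)
    at w g with i ≟ w
    ... | yes refl = refl
    ... | no _     = trans (ℚ.*-zeroˡ (g (f i))) (sym (ℚ.*-zeroˡ (g (f w))))

-- Foot and height as functions on the vertices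

module PathLaplacian {n} (T : Graph n) (tree : IsTree T) {k} (p : Fin (suc k) → Fin n)
                     (path : IsPath T (p zero) (p (fromℕ k)) p) where
  open TreeLaplacian T tree
  open PathProjection T tree p path
  open ≡-Reasoning

  private
    u v : Fin n
    u = p zero
    v = p (fromℕ k)
    N K : ℚ
    N = ι n
    K = ι k

  opaque
    a : Fin n → ℚ
    a x = ι (toℕ (foot x))

    a-ι : ∀ x → a x ≡ ι (toℕ (foot x))
    a-ι x = refl

    h : Fin n → ℚ
    h x = ι (height x)

    h-ι : ∀ x → h x ≡ ι (height x)
    h-ι x = refl

  dist-path : ∀ x b → dist x (p b) ≡ h x + ι ℕ.∣ toℕ (foot x) - toℕ b ∣
  dist-path x b = trans (dist-ι x (p b)) (trans (cong ι (d-path x b))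
    (trans (ι-+ (height x) _) (cong (_+ ι ℕ.∣ toℕ (foot x) - toℕ b ∣) (sym (h-ι x)))))

  dist-start : ∀ x → dist x u ≡ h x + a x
  dist-start x = trans (dist-path x zero) (cong (h x +_) (trans (cong ι (ℕ.∣-∣-identityʳ (toℕ (foot x))))
      (sym (a-ι x))))

  dist-end : ∀ x → dist x v ≡ h x + (K - a x)
  dist-end x = trans (dist-path x (fromℕ k)) (cong (h x +_) (begin
    ι ℕ.∣ toℕ (foot x) - toℕ (fromℕ k) ∣   ≡⟨ cong (λ b → ι ℕ.∣ toℕ (foot x) - b ∣) (Fin.toℕ-fromℕ k) ⟩
    ι ℕ.∣ toℕ (foot x) - k ∣  ≡⟨ cong ι (ℕ.m≤n⇒∣m-n∣≡n∸m foot≤k) ⟩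
    ι (k ∸ toℕ (foot x))  ≡⟨ ι-∸ foot≤k ⟩
    K - ι (toℕ (foot x))  ≡⟨ cong (λ y → K - y) (sym (a-ι x)) ⟩
    K - a x                                ∎))
    where
    foot≤k : toℕ (foot x) ℕ.≤ k
    foot≤k = ℕ.s≤s⁻¹ (Fin.toℕ<n (foot x))

  -- The zero term only brings the combination into the three-term shape of `laplacian-lin₃`.
  a-dist : ∀ x → a x ≡ ½ * dist x u + - ½ * dist x v + 0ℚ * dist x u + ½ * K
  a-dist x = trans (lemma (h x) (a x) K) (cong₂ (λ s e → ½ * s + - ½ * e + 0ℚ * s + ½ * K) (sym (dist-start x))
      (sym (dist-end x)))
    where
    lemma : ∀ h a K → a ≡ ½ * (h + a) + - ½ * (h + (K - a)) + 0ℚ * (h + a) + ½ * K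
    lemma = solve-∀ ℚ-ring

  -- The two copies of `τ` cancel in the difference of distances: `a` is the potential of a unit
  -- current between the ends of the path.
  laplacian-a : ∀ i → laplacian T a i ≡ ⟦ i ≟ v ⟧ - ⟦ i ≟ u ⟧
  laplacian-a i = begin
    laplacian T a i
      ≡⟨ laplacian-lin₃ T ½ (- ½) 0ℚ (½ * K) a-dist i ⟩
    ½ * laplacian T (λ x → dist x u) i + - ½ * laplacian T (λ x → dist x v) i + 0ℚ * laplacian T (λ x → dist x u) i
      ≡⟨ cong₂ (λ s e → ½ * s + - ½ * e + 0ℚ * s) (laplacian-dist u i) (laplacian-dist v i) ⟩
    ½ * (τ i - ι 2 * 1ℚ * ⟦ i ≟ u ⟧) + - ½ * (τ i - ι 2 * 1ℚ * ⟦ i ≟ v ⟧) + 0ℚ * (τ i - ι 2 * 1ℚ * ⟦ i ≟ u ⟧)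
      ≡⟨ lemma (τ i) ⟦ i ≟ u ⟧ ⟦ i ≟ v ⟧ ⟩
    ⟦ i ≟ v ⟧ - ⟦ i ≟ u ⟧ ∎
    where
    lemma : ∀ t p q → ½ * (t - ι 2 * 1ℚ * p) + - ½ * (t - ι 2 * 1ℚ * q) + 0ℚ * (t - ι 2 * 1ℚ * p) ≡ q - p
    lemma = solve-∀ ℚ-ring

  ∑-τ-a : ∑[ x < n ] (τ x * a x) ≡ K
  ∑-τ-a = begin
    ∑[ x < n ] (τ x * a x)
      ≡⟨ ∑-lin₃ ½ (- ½) (½ * K) (λ x → trans (cong (τ x *_) (a-dist x)) (expand (τ x) (dist x u) (dist x v) K)) ⟩
    ½ * ∑[ x < n ] (τ x * dist x u) + - ½ * ∑[ x < n ] (τ x * dist x v) + ½ * K * sum τ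
      ≡⟨ cong₂ _+_ (cong₂ (λ s e → ½ * s + - ½ * e) (∑-τ-dist u) (∑-τ-dist v)) (cong (½ * K *_) (∑-τ u)) ⟩
    ½ * (N - 1ℚ) + - ½ * (N - 1ℚ) + ½ * K * ι 2
      ≡⟨ close N K ⟩
    K ∎
    where
    expand : ∀ t s e K → t * (½ * s + - ½ * e + 0ℚ * s + ½ * K) ≡ ½ * (t * s) + - ½ * (t * e) + ½ * K * t
    expand = solve-∀ ℚ-ring
    close : ∀ N K → ½ * (N - 1ℚ) + - ½ * (N - 1ℚ) + ½ * K * ι 2 ≡ K
    close = solve-∀ ℚ-ring

  -- The square of a is a combination of distances to the vertices of the path,
  -- because the sum of |a - b| over b is a quadratic polynomial in a.
  private
    B : Fin n → ℚ
    B x = ∑[ b < suc k ] dist x (p b)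

  a²-dist : ∀ x → ι 4 * (a x * a x) ≡ ι 4 * B x + - (ι 2 * (K + 1ℚ)) * (dist x u + dist x v) + ι 4 * K * a x
  a²-dist x = trans (lemma (h x) (a x) K) (cong₂ (λ s e → s + - (ι 2 * (K + 1ℚ)) * e + ι 4 * K * a x) (sym 4B) (sym
      (cong₂ _+_ (dist-start x) (dist-end x))))
    where
    lemma : ∀ h a K → ι 4 * (a * a) ≡ (ι 4 * ((1ℚ + K) * h) + ((ι 2 * a - K) * (ι 2 * a - K) + K * K + ι 2 * K)) + -
        (ι 2 * (K + 1ℚ)) * (h + a + (h + (K - a))) + ι 4 * K * a
    lemma = solve-∀ ℚ-ring
    gaps : ℚ
    gaps = ∑[ b < suc k ] ι ℕ.∣ toℕ (foot x) - toℕ b ∣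
    4B : ι 4 * B x ≡ ι 4 * ((1ℚ + K) * h x) + ((ι 2 * a x - K) * (ι 2 * a x - K) + K * K + ι 2 * K)
    4B = begin
      ι 4 * B x
        ≡⟨ cong (ι 4 *_) (trans (sum-cong-≗ (dist-path x)) (∑-distrib-+ {suc k} (λ _ → h x)
            (λ b → ι ℕ.∣ toℕ (foot x) - toℕ b ∣))) ⟩
      ι 4 * (∑[ b < suc k ] h x + gaps)
        ≡⟨ cong (λ s → ι 4 * (s + gaps)) (trans (∑-const (suc k) (h x)) (cong (_* h x) (ι-suc k))) ⟩
      ι 4 * ((1ℚ + K) * h x + gaps)
        ≡⟨ ℚ.*-distribˡ-+ (ι 4) ((1ℚ + K) * h x) gaps ⟩
      ι 4 * ((1ℚ + K) * h x) + ι 4 * gaps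
        ≡⟨ cong (ι 4 * ((1ℚ + K) * h x) +_) (trans (∑-gap (foot x)) (cong
            (λ y → (ι 2 * y - K) * (ι 2 * y - K) + K * K + ι 2 * K) (sym (a-ι x)))) ⟩
      ι 4 * ((1ℚ + K) * h x) + ((ι 2 * a x - K) * (ι 2 * a x - K) + K * K + ι 2 * K) ∎

  ∑-τ-a² : ∑[ x < n ] (τ x * (a x * a x)) ≡ K * K
  ∑-τ-a² = *-cancelˡ {ι 4} (λ ()) (begin
    ι 4 * ∑[ x < n ] (τ x * (a x * a x))
      ≡⟨ *-distribˡ-sum (ι 4) (λ x → τ x * (a x * a x)) ⟩
    ∑[ x < n ] (ι 4 * (τ x * (a x * a x)))
      ≡⟨ ∑-lin₄ (ι 4) (- (ι 2 * (K + 1ℚ))) (- (ι 2 * (K + 1ℚ))) (ι 4 * K) (λ x → trans (swap (τ x) (a x * a x))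
           (trans (cong (τ x *_) (a²-dist x)) (expand (τ x) (B x) (dist x u) (dist x v) K (a x)))) ⟩
    ι 4 * ∑[ x < n ] (τ x * B x) + - (ι 2 * (K + 1ℚ)) * ∑[ x < n ] (τ x * dist x u) + - (ι 2 * (K + 1ℚ)) * ∑[ x < n ]
        (τ x * dist x v) + ι 4 * K * ∑[ x < n ] (τ x * a x)
      ≡⟨ cong₂ _+_ (cong₂ _+_ (cong₂ (λ s t → ι 4 * s + - (ι 2 * (K + 1ℚ)) * t) ∑τB (∑-τ-dist u))
          (cong (- (ι 2 * (K + 1ℚ)) *_) (∑-τ-dist v))) (cong (ι 4 * K *_) ∑-τ-a) ⟩
    ι 4 * ((1ℚ + K) * (N - 1ℚ)) + - (ι 2 * (K + 1ℚ)) * (N - 1ℚ) + - (ι 2 * (K + 1ℚ)) * (N - 1ℚ) + ι 4 * K * K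
      ≡⟨ close N K ⟩
    ι 4 * (K * K) ∎)
    where
    swap : ∀ t x → ι 4 * (t * x) ≡ t * (ι 4 * x)
    swap = solve-∀ ℚ-ring
    expand : ∀ t b s e K a → t * (ι 4 * b + - (ι 2 * (K + 1ℚ)) * (s + e) + ι 4 * K * a) ≡
             ι 4 * (t * b) + - (ι 2 * (K + 1ℚ)) * (t * s) + - (ι 2 * (K + 1ℚ)) * (t * e) + ι 4 * K * (t * a)
    expand = solve-∀ ℚ-ring
    close : ∀ N K → ι 4 * ((1ℚ + K) * (N - 1ℚ)) + - (ι 2 * (K + 1ℚ)) * (N - 1ℚ) + - (ι 2 * (K + 1ℚ)) *
        (N - 1ℚ) + ι 4 * K * K ≡ ι 4 * (K * K)
    close = solve-∀ ℚ-ring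
    ∑τB : ∑[ x < n ] (τ x * B x) ≡ (1ℚ + K) * (N - 1ℚ)
    ∑τB = begin
      ∑[ x < n ] (τ x * B x)  ≡⟨ sum-cong-≗ (λ x → *-distribˡ-sum (τ x)
          (λ b → dist x (p b))) ⟩
      ∑[ x < n ] ∑[ b < suc k ] (τ x * dist x (p b))  ≡⟨ ∑-comm (λ x b → τ x * dist x (p b)) ⟩
      ∑[ b < suc k ] ∑[ x < n ] (τ x * dist x (p b))  ≡⟨ sum-cong-≗ (λ b → ∑-τ-dist (p b)) ⟩
      ∑[ b < suc k ] (N - 1ℚ)  ≡⟨ trans (∑-const (suc k) (N - 1ℚ))
          (cong (_* (N - 1ℚ)) (ι-suc k)) ⟩
      (1ℚ + K) * (N - 1ℚ)  ∎

  -- The pairs are ordered, so `W` is twice the Wiener index.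
  W Q H : ℚ
  W = ∑[ x < n ] ∑[ y < n ] dist x y
  Q = ∑[ x < n ] ∑[ y < n ] ((a x - a y) * (a x - a y))
  H = ∑[ x < n ] h x

-- Kemeny's constants of the tree and of the unicyclic graph

module KemenyConstants {n} (T : Graph n) (tree : IsTree T) {k} (p : Fin (suc k) → Fin n)
                       (path : IsPath T (p zero) (p (fromℕ k)) p)
                       (u≢v : p zero ≢ p (fromℕ k)) (¬uv : ¬ Adj T (p zero) (p (fromℕ k))) where
  open TreeLaplacian T tree
  open PathLaplacian T tree p path
  open ≡-Reasoning

  private
    u v : Fin n
    u = p zero
    v = p (fromℕ k)
    N K C : ℚ
    N = ι n
    K = ι k
    C = ι (suc k)
    G : Graph n
    G = addEdge T u≢v

    C≡1+K : C ≡ 1ℚ + K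
    C≡1+K = ι-suc k

    connG : Connected G
    connG x y = Star.map inj₁ (proj₁ tree x y)

    degree≢0 : ∀ (H : Graph n) → Connected H → ∀ i → degree H i ≢ 0
    degree≢0 H conn i with i ≟ u
    ... | yes refl = connected⇒degree≢0 H conn u≢v
    ... | no i≢u   = connected⇒degree≢0 H conn i≢u

    [u] [v] : Fin n → ℚ
    [u] i = ⟦ i ≟ u ⟧
    [v] i = ⟦ i ≟ v ⟧

    a-u : a u ≡ 0ℚ
    a-u = trans (a-ι u) (cong (ι ∘ toℕ) (PathProjection.foot-path T tree p path zero))

    a-v : a v ≡ K
    a-v = trans (a-ι v) (trans (cong (ι ∘ toℕ) (PathProjection.foot-path T tree p path (fromℕ k)))
        (cong ι (Fin.toℕ-fromℕ k)))

    dist-uv : dist u v ≡ K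
    dist-uv = trans (dist-end u) (trans (cong₂ (λ x y → x + (K - y)) h-u a-u) (lemma K))
      where
      h-u : h u ≡ 0ℚ
      h-u = trans (h-ι u) (cong ι (PathProjection.height-path T tree p path zero))
      lemma : ∀ K → 0ℚ + (K - 0ℚ) ≡ K
      lemma = solve-∀ ℚ-ring

  private
    degree-τ : ∀ i → degℚ T i ≡ ι 2 - τ i
    degree-τ i = sym (trans (cong (λ t → ι 2 - t) (τ-def i)) (lemma (degℚ T i)))
      where
      lemma : ∀ d → ι 2 - (ι 2 - d) ≡ d
      lemma = solve-∀ ℚ-ring

    ∑-2- : ∀ σ → ∑[ i < n ] (ι 2 - σ i) ≡ ι 2 * N - sum σ
    ∑-2- σ = trans (∑-distrib-- (λ _ → ι 2) σ) (cong (_- sum σ) (trans (∑-const n (ι 2)) (ℚ.*-comm N (ι 2))))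

    flip-∑ : ∀ (σ : Fin n → ℚ) x → ∑[ y < n ] (σ y * dist x y) ≡ ∑[ y < n ] (σ y * dist y x)
    flip-∑ σ x = sum-cong-≗ λ y → cong (σ y *_) (dist-sym x y)

  kemeny-tree : ∀ {κ} → IsKemeny T κ → κ * (ι 4 * (N - 1ℚ)) ≡ ι 4 * W - ι 4 * (N * (N - 1ℚ)) + ι 2 * (N - 1ℚ)
  kemeny-tree {κ} kem = begin
    κ * (ι 4 * (N - 1ℚ))
      ≡⟨ cong (κ *_) (trans (scale N) (cong (ι 2 * 1ℚ *_) (sym ∑D))) ⟩
    κ * (ι 2 * 1ℚ * sum (degℚ T))
      ≡⟨ kemeny-formula T (proj₁ tree) (degree≢0 T (proj₁ tree)) dist τ 1ℚ dist-refl laplacian-dist kem ⟩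
    ∑[ x < n ] (degℚ T x * ∑[ y < n ] (degℚ T y * dist x y))
      ≡⟨ sum-cong-≗ (λ x → cong₂ _*_ (degree-τ x) (sum-cong-≗ λ y → cong (_* dist x y) (degree-τ y))) ⟩
    ∑[ x < n ] ((ι 2 - τ x) * ∑[ y < n ] ((ι 2 - τ y) * dist x y))
      ≡⟨ ∑-quadratic τ dist (λ _ → N - 1ℚ) dist-sym (λ x → trans (flip-∑ τ x) (∑-τ-dist x)) ⟩
    ι 4 * W - ι 4 * ∑[ x < n ] (N - 1ℚ) + ∑[ x < n ] (τ x * (N - 1ℚ))
      ≡⟨ cong₂ (λ s t → ι 4 * W - ι 4 * s + t) (∑-const n (N - 1ℚ)) (trans (∑-lin₁ (N - 1ℚ)
          (λ x → ℚ.*-comm (τ x) (N - 1ℚ))) (trans (cong ((N - 1ℚ) *_) (∑-τ u)) (ℚ.*-comm (N - 1ℚ) (ι 2)))) ⟩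
    ι 4 * W - ι 4 * (N * (N - 1ℚ)) + ι 2 * (N - 1ℚ) ∎
    where
    scale : ∀ N → ι 4 * (N - 1ℚ) ≡ ι 2 * 1ℚ * (ι 2 * N - ι 2)
    scale = solve-∀ ℚ-ring
    ∑D : sum (degℚ T) ≡ ι 2 * N - ι 2
    ∑D = trans (sum-cong-≗ degree-τ) (trans (∑-2- τ) (cong (λ s → ι 2 * N - s) (∑-τ u)))

  private
    -- `C` times the effective resistance in `G`: two vertices at index distance t on the cycle are
    -- joined by arcs of lengths t and C - t, whose resistance is t - t²/C, and the branches hanging
    -- off the cycle add their lengths.
    R : Fin n → Fin n → ℚ
    R x y = C * dist x y - (a x - a y) * (a x - a y)

    R-diag : ∀ i → R i i ≡ 0ℚ
    R-diag i = trans (cong (λ d → C * d - (a i - a i) * (a i - a i)) (dist-refl i)) (lemma C (a i))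
      where
      lemma : ∀ C x → C * 0ℚ - (x - x) * (x - x) ≡ 0ℚ
      lemma = solve-∀ ℚ-ring

    R-sym : ∀ x y → R x y ≡ R y x
    R-sym x y = trans (cong (λ d → C * d - (a x - a y) * (a x - a y)) (dist-sym x y)) (lemma C (dist y x) (a x) (a y))
      where
      lemma : ∀ C d x y → C * d - (x - y) * (x - y) ≡ C * d - (y - x) * (y - x)
      lemma = solve-∀ ℚ-ring

    curvature : Fin n → ℚ
    curvature i = C * τ i - laplacian T (λ x → a x * a x) i - K * ([u] i - [v] i)

    R-u-v : ∀ z → R u z - R v z ≡ ι 2 * a z - K
    R-u-v z = begin
      R u z - R v z
        ≡⟨ cong₂ (λ r s → r - s)
             (cong₂ (λ c r → c * proj₁ r - (proj₂ r - a z) * (proj₂ r - a z)) C≡1+K (cong₂ _,_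
                 (trans (dist-sym u z) (dist-start z)) a-u))
             (cong₂ (λ c r → c * proj₁ r - (proj₂ r - a z) * (proj₂ r - a z)) C≡1+K (cong₂ _,_
                 (trans (dist-sym v z) (dist-end z)) a-v)) ⟩
      ((1ℚ + K) * (h z + a z) - (0ℚ - a z) * (0ℚ - a z)) - ((1ℚ + K) * (h z + (K - a z)) - (K - a z) * (K - a z))
        ≡⟨ lemma K (h z) (a z) ⟩
      ι 2 * a z - K ∎
      where
      lemma : ∀ K h a → ((1ℚ + K) * (h + a) - (0ℚ - a) * (0ℚ - a)) - ((1ℚ + K) * (h + (K - a)) - (K - a) * (K - a))
          ≡ ι 2 * a - K
      lemma = solve-∀ ℚ-ring

    -- Apart from the point mass, the Laplacian in `T` depends on `z` only through the cross term
    -- `2 a z` times `[v] i - [u] i`. The new edge carries `R u z - R v z = 2 a z - K`, which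
    -- cancels this and leaves only `K`.
    R-laplacian : ∀ z i → laplacian G (λ x → R x z) i ≡ curvature i - ι 2 * C * ⟦ i ≟ z ⟧
    R-laplacian z i = begin
      laplacian G (λ x → R x z) i
        ≡⟨ laplacian-addEdge T u≢v ¬uv (λ x → R x z) i ⟩
      laplacian T (λ x → R x z) i + [u] i * (R u z - R v z) + [v] i * (R v z - R u z)
        ≡⟨ cong₂ _+_ (cong₂ (λ l r → l + [u] i * r) lapT (R-u-v z)) (cong ([v] i *_) (trans (antisym (R v z) (R u z))
            (cong -_ (R-u-v z)))) ⟩
      C * (τ i - ι 2 * 1ℚ * ⟦ i ≟ z ⟧) + - 1ℚ * q + ι 2 * a z * ([v] i - [u] i) + [u] i * (ι 2 * a z - K) + [v] i * -
          (ι 2 * a z - K)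
        ≡⟨ close C (τ i) ⟦ i ≟ z ⟧ q (a z) ([u] i) ([v] i) K ⟩
      curvature i - ι 2 * C * ⟦ i ≟ z ⟧ ∎
      where
      q : ℚ
      q = laplacian T (λ x → a x * a x) i
      antisym : ∀ x y → x - y ≡ - (y - x)
      antisym = solve-∀ ℚ-ring
      close : ∀ C t b q a p r K → C * (t - ι 2 * 1ℚ * b) + - 1ℚ * q + ι 2 * a * (r - p) + p * (ι 2 * a - K) + r * -
          (ι 2 * a - K) ≡
              C * t - q - K * (p - r) - ι 2 * C * b
      close = solve-∀ ℚ-ring
      expand : ∀ C d x y → C * d - (x - y) * (x - y) ≡ C * d + - 1ℚ * (x * x) + ι 2 * y * x + - (y * y)
      expand = solve-∀ ℚ-ring
      lapT : laplacian T (λ x → R x z) i ≡ C * (τ i - ι 2 * 1ℚ * ⟦ i ≟ z ⟧) + - 1ℚ * q + ι 2 * a z * ([v] i - [u] i)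
      lapT = trans (laplacian-lin₃ T C (- 1ℚ) (ι 2 * a z) (- (a z * a z)) (λ x → expand C (dist x z) (a x) (a z)) i)
                   (cong₂ (λ r s → C * r + - 1ℚ * q + ι 2 * a z * s) (laplacian-dist z i) (laplacian-a i))

    -- Two minus the degree in `G`. Its sums against 1, `a` and `a²` all vanish, so that (a - a')²
    -- disappears from `∑-σ-R`.
    σ : Fin n → ℚ
    σ i = τ i - [u] i - [v] i

    ∑-σ : ∀ (f : Fin n → ℚ) → ∑[ x < n ] (σ x * f x) ≡ ∑[ x < n ] (τ x * f x) - f u - f v
    ∑-σ f = begin
      ∑[ x < n ] (σ x * f x)
        ≡⟨ ∑-lin₃ 1ℚ (- 1ℚ) (- 1ℚ) (λ x → expand (τ x) ([u] x) ([v] x) (f x)) ⟩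
      1ℚ * ∑[ x < n ] (τ x * f x) + - 1ℚ * ∑[ x < n ] ([u] x * f x) + - 1ℚ * ∑[ x < n ] ([v] x * f x)
        ≡⟨ cong₂ (λ s t → 1ℚ * ∑[ x < n ] (τ x * f x) + - 1ℚ * s + - 1ℚ * t) (∑-δ u f) (∑-δ v f) ⟩
      1ℚ * ∑[ x < n ] (τ x * f x) + - 1ℚ * f u + - 1ℚ * f v
        ≡⟨ collect (∑[ x < n ] (τ x * f x)) (f u) (f v) ⟩
      ∑[ x < n ] (τ x * f x) - f u - f v ∎
      where
      expand : ∀ t p q f → (t - p - q) * f ≡ 1ℚ * (t * f) + - 1ℚ * (p * f) + - 1ℚ * (q * f)
      expand = solve-∀ ℚ-ring
      collect : ∀ s p q → 1ℚ * s + - 1ℚ * p + - 1ℚ * q ≡ s - p - q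
      collect = solve-∀ ℚ-ring

    ∑-σ-1 : ∑[ x < n ] (σ x * 1ℚ) ≡ 0ℚ
    ∑-σ-1 = trans (∑-σ (λ _ → 1ℚ)) (cong (λ s → s - 1ℚ - 1ℚ) (trans (sum-cong-≗ λ x → ℚ.*-identityʳ (τ x)) (∑-τ u)))

    ∑-σ-a : ∑[ x < n ] (σ x * a x) ≡ 0ℚ
    ∑-σ-a = trans (∑-σ a) (trans (cong₂ _-_ (cong₂ _-_ ∑-τ-a a-u) a-v) (lemma K))
      where
      lemma : ∀ K → K - 0ℚ - K ≡ 0ℚ
      lemma = solve-∀ ℚ-ring

    ∑-σ-a² : ∑[ x < n ] (σ x * (a x * a x)) ≡ 0ℚ
    ∑-σ-a² = trans (∑-σ (λ x → a x * a x)) (trans (cong₂ _-_ (cong₂ _-_ ∑-τ-a² (cong (λ y → y * y) a-u)) (cong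
        (λ y → y * y) a-v)) (lemma K))
      where
      lemma : ∀ K → K * K - 0ℚ * 0ℚ - K * K ≡ 0ℚ
      lemma = solve-∀ ℚ-ring

    ∑-σ-dist : ∀ z → ∑[ x < n ] (σ x * dist x z) ≡ N - 1ℚ - dist u z - dist v z
    ∑-σ-dist z = trans (∑-σ (λ x → dist x z)) (cong (λ s → s - dist u z - dist v z) (∑-τ-dist z))

    r : Fin n → ℚ
    r x = C * (N - 1ℚ - K) * 1ℚ + - (C * ι 2) * h x

    ends : ∀ x → dist u x + dist v x ≡ ι 2 * h x + K
    ends x = trans (cong₂ _+_ (trans (dist-sym u x) (dist-start x))
        (trans (dist-sym v x) (dist-end x))) (lemma (h x) (a x) K)
      where
      lemma : ∀ h a K → h + a + (h + (K - a)) ≡ ι 2 * h + K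
      lemma = solve-∀ ℚ-ring

    ∑-σ-R : ∀ x → ∑[ y < n ] (σ y * R x y) ≡ r x
    ∑-σ-R x = begin
      ∑[ y < n ] (σ y * R x y)
        ≡⟨ ∑-lin₄ C (- (a x * a x)) (ι 2 * a x) (- 1ℚ) (λ y → expand (σ y) C (dist x y) (a x) (a y)) ⟩
      C * ∑[ y < n ] (σ y * dist x y) + - (a x * a x) * ∑[ y < n ] (σ y * 1ℚ) + ι 2 * a x * ∑[ y < n ]
          (σ y * a y) + - 1ℚ * ∑[ y < n ] (σ y * (a y * a y))
        ≡⟨ cong₂ _+_ (cong₂ _+_ (cong₂ (λ s t → C * s + - (a x * a x) * t) (trans (flip-∑ σ x) (∑-σ-dist x)) ∑-σ-1)
            (cong (ι 2 * a x *_) ∑-σ-a)) (cong (- 1ℚ *_) ∑-σ-a²) ⟩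
      C * (N - 1ℚ - dist u x - dist v x) + - (a x * a x) * 0ℚ + ι 2 * a x * 0ℚ + - 1ℚ * 0ℚ
        ≡⟨ regroup C N (dist u x) (dist v x) (a x) ⟩
      C * (N - 1ℚ - (dist u x + dist v x))
        ≡⟨ cong (λ s → C * (N - 1ℚ - s)) (ends x) ⟩
      C * (N - 1ℚ - (ι 2 * h x + K))
        ≡⟨ close C N (h x) K ⟩
      r x ∎
      where
      expand : ∀ s C d x y → s * (C * d - (x - y) * (x - y)) ≡ C * (s * d) + - (x * x) * (s * 1ℚ) + ι 2 * x *
          (s * y) + - 1ℚ * (s * (y * y))
      expand = solve-∀ ℚ-ring
      regroup : ∀ C N d e x → C * (N - 1ℚ - d - e) + - (x * x) * 0ℚ + ι 2 * x * 0ℚ + - 1ℚ * 0ℚ ≡ C * (N - 1ℚ - (d + e))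
      regroup = solve-∀ ℚ-ring
      close : ∀ C N h K → C * (N - 1ℚ - (ι 2 * h + K)) ≡ C * (N - 1ℚ - K) * 1ℚ + - (C * ι 2) * h
      close = solve-∀ ℚ-ring

    -- Twice h is the sum of the distances to u and v, up to a constant.
    ∑-σ-h : ι 2 * ∑[ x < n ] (σ x * h x) ≡ ι 2 * (N - 1ℚ) - ι 2 * K
    ∑-σ-h = begin
      ι 2 * ∑[ x < n ] (σ x * h x)
        ≡⟨ *-distribˡ-sum (ι 2) (λ x → σ x * h x) ⟩
      ∑[ x < n ] (ι 2 * (σ x * h x))
        ≡⟨ ∑-lin₃ 1ℚ 1ℚ (- K) (λ x → trans (regroup (σ x) (h x) K) (trans (cong (λ s → σ x * s + - K * (σ x * 1ℚ)) (sym
            (trans (cong₂ _+_ (dist-sym x u) (dist-sym x v)) (ends x)))) (expand (σ x) (dist x u) (dist x v) K))) ⟩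
      1ℚ * ∑[ x < n ] (σ x * dist x u) + 1ℚ * ∑[ x < n ] (σ x * dist x v) + - K * ∑[ x < n ] (σ x * 1ℚ)
        ≡⟨ cong₂ _+_ (cong₂ (λ s t → 1ℚ * s + 1ℚ * t)
             (trans (∑-σ-dist u) (cong₂ (λ s t → N - 1ℚ - s - t) (dist-refl u) (trans (dist-sym v u) dist-uv)))
             (trans (∑-σ-dist v) (cong₂ (λ s t → N - 1ℚ - s - t) dist-uv (dist-refl v)))) (cong (- K *_) ∑-σ-1) ⟩
      1ℚ * (N - 1ℚ - 0ℚ - K) + 1ℚ * (N - 1ℚ - K - 0ℚ) + - K * 0ℚ
        ≡⟨ close N K ⟩
      ι 2 * (N - 1ℚ) - ι 2 * K ∎
      where
      regroup : ∀ s h K → ι 2 * (s * h) ≡ s * (ι 2 * h + K) + - K * (s * 1ℚ)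
      regroup = solve-∀ ℚ-ring
      expand : ∀ s d e K → s * (d + e) + - K * (s * 1ℚ) ≡ 1ℚ * (s * d) + 1ℚ * (s * e) + - K * (s * 1ℚ)
      expand = solve-∀ ℚ-ring
      close : ∀ N K → 1ℚ * (N - 1ℚ - 0ℚ - K) + 1ℚ * (N - 1ℚ - K - 0ℚ) + - K * 0ℚ ≡ ι 2 * (N - 1ℚ) - ι 2 * K
      close = solve-∀ ℚ-ring

  kemeny-unicyclic : ∀ {κ} → IsKemeny G κ → κ * (ι 4 * C * N) ≡
    ι 4 * (C * W - Q) - ι 4 * (C * (N * (N - 1ℚ - K) - ι 2 * H)) - C * (ι 2 * (N - 1ℚ) - ι 2 * K)
  kemeny-unicyclic {κ} kem = begin
    κ * (ι 4 * C * N)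
      ≡⟨ cong (κ *_) (trans (scale C N) (cong (ι 2 * C *_) (sym ∑D))) ⟩
    κ * (ι 2 * C * sum (degℚ G))
      ≡⟨ kemeny-formula G connG (degree≢0 G connG) R curvature C R-diag R-laplacian kem ⟩
    ∑[ x < n ] (degℚ G x * ∑[ y < n ] (degℚ G y * R x y))
      ≡⟨ sum-cong-≗ (λ x → cong₂ _*_ (degree-σ x) (sum-cong-≗ λ y → cong (_* R x y) (degree-σ y))) ⟩
    ∑[ x < n ] ((ι 2 - σ x) * ∑[ y < n ] ((ι 2 - σ y) * R x y))
      ≡⟨ ∑-quadratic σ R r R-sym ∑-σ-R ⟩
    ι 4 * ∑[ x < n ] ∑[ y < n ] R x y - ι 4 * sum r + ∑[ x < n ] (σ x * r x)
      ≡⟨ cong₂ _+_ (cong₂ (λ s t → ι 4 * s - ι 4 * t) ∑∑R ∑r) ∑σr ⟩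
    ι 4 * (C * W - Q) - ι 4 * (C * (N - 1ℚ - K) * (N * 1ℚ) + - (C * ι 2) * H) + (C * (N - 1ℚ - K) * 0ℚ + - C * (ι 2 *
        (N - 1ℚ) - ι 2 * K))
      ≡⟨ close C W Q N K H ⟩
    ι 4 * (C * W - Q) - ι 4 * (C * (N * (N - 1ℚ - K) - ι 2 * H)) - C * (ι 2 * (N - 1ℚ) - ι 2 * K) ∎
    where
    scale : ∀ C N → ι 4 * C * N ≡ ι 2 * C * (ι 2 * N)
    scale = solve-∀ ℚ-ring
    degree-σ : ∀ i → degℚ G i ≡ ι 2 - σ i
    degree-σ i = trans (degree-addEdge T u≢v ¬uv i) (trans (cong
        (λ s → s + [u] i + [v] i) (degree-τ i)) (lemma (τ i) ([u] i) ([v] i)))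
      where
      lemma : ∀ t p q → ι 2 - t + p + q ≡ ι 2 - (t - p - q)
      lemma = solve-∀ ℚ-ring
    ∑D : sum (degℚ G) ≡ ι 2 * N
    ∑D = trans (sum-cong-≗ degree-σ) (trans (∑-2- σ) (trans (cong (λ s → ι 2 * N - s) (trans (sum-cong-≗ λ x → sym
        (ℚ.*-identityʳ (σ x))) ∑-σ-1)) (lemma N)))
      where
      lemma : ∀ N → ι 2 * N - 0ℚ ≡ ι 2 * N
      lemma = solve-∀ ℚ-ring
    ∑∑R : ∑[ x < n ] ∑[ y < n ] R x y ≡ C * W - Q
    ∑∑R = trans (sum-cong-≗ λ x → trans (∑-distrib-- (λ y → C * dist x y) (λ y → (a x - a y) * (a x - a y)))
        (cong (_- ∑[ y < n ] ((a x - a y) * (a x - a y))) (∑-scale C (dist x))))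
      (trans (∑-distrib-- (λ x → C * sum (dist x)) (λ x → ∑[ y < n ] ((a x - a y) * (a x - a y)))) (cong (_- Q)
          (∑-scale C (λ x → sum (dist x)))))
    ∑r : sum r ≡ C * (N - 1ℚ - K) * (N * 1ℚ) + - (C * ι 2) * H
    ∑r = trans (∑-lin₂ {f = λ _ → 1ℚ} {h} (C * (N - 1ℚ - K)) (- (C * ι 2)) (λ _ → refl)) (cong
        (λ s → C * (N - 1ℚ - K) * s + - (C * ι 2) * H) (∑-const n 1ℚ))
    ∑σr : ∑[ x < n ] (σ x * r x) ≡ C * (N - 1ℚ - K) * 0ℚ + - C * (ι 2 * (N - 1ℚ) - ι 2 * K)
    ∑σr = trans (∑-lin₂ (C * (N - 1ℚ - K)) (- (C * ι 2)) (λ x → expand (σ x) (C * (N - 1ℚ - K)) C (h x)))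
      (cong₂ (λ s t → C * (N - 1ℚ - K) * s + t) ∑-σ-1 (trans (assoc C _) (cong (- C *_) ∑-σ-h)))
      where
      expand : ∀ s b C h → s * (b * 1ℚ + - (C * ι 2) * h) ≡ b * (s * 1ℚ) + - (C * ι 2) * (s * h)
      expand = solve-∀ ℚ-ring
      assoc : ∀ C x → - (C * ι 2) * x ≡ - C * (ι 2 * x)
      assoc = solve-∀ ℚ-ring
    close : ∀ C W Q N K H → ι 4 * (C * W - Q) - ι 4 * (C * (N - 1ℚ - K) * (N * 1ℚ) + - (C * ι 2) * H) + (C *
        (N - 1ℚ - K) * 0ℚ + - C * (ι 2 * (N - 1ℚ) - ι 2 * K)) ≡
            ι 4 * (C * W - Q) - ι 4 * (C * (N * (N - 1ℚ - K) - ι 2 * H)) - C * (ι 2 * (N - 1ℚ) - ι 2 * K)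
    close = solve-∀ ℚ-ring

  kemeny-difference : ∀ {κG κT} → IsKemeny G κG → IsKemeny T κT →
    ι 4 * C * N * (N - 1ℚ) * (κG - κT) ≡
    - (ι 4 * C * W) - ι 4 * (N - 1ℚ) * Q + ι 8 * C * (N - 1ℚ) * H + C * (N - 1ℚ) * (ι 4 * N * K + ι 2 * K + ι 2)
  kemeny-difference {κG} {κT} kemG kemT = begin
    ι 4 * C * N * (N - 1ℚ) * (κG - κT)
      ≡⟨ expand C N κG κT ⟩
    (N - 1ℚ) * (κG * (ι 4 * C * N)) - C * N * (κT * (ι 4 * (N - 1ℚ)))
      ≡⟨ cong₂ (λ s t → (N - 1ℚ) * s - C * N * t) (kemeny-unicyclic kemG) (kemeny-tree kemT) ⟩
    (N - 1ℚ) * (ι 4 * (C * W - Q) - ι 4 * (C * (N * (N - 1ℚ - K) - ι 2 * H)) - C * (ι 2 * (N - 1ℚ) - ι 2 * K))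
      - C * N * (ι 4 * W - ι 4 * (N * (N - 1ℚ)) + ι 2 * (N - 1ℚ))
      ≡⟨ close C N K W Q H ⟩
    - (ι 4 * C * W) - ι 4 * (N - 1ℚ) * Q + ι 8 * C * (N - 1ℚ) * H + C * (N - 1ℚ) * (ι 4 * N * K + ι 2 * K + ι 2) ∎
    where
    expand : ∀ C N g t → ι 4 * C * N * (N - 1ℚ) * (g - t) ≡ (N - 1ℚ) * (g * (ι 4 * C * N)) - C * N * (t * (ι 4 *
        (N - 1ℚ)))
    expand = solve-∀ ℚ-ring
    close : ∀ C N K W Q H → (N - 1ℚ) * (ι 4 * (C * W - Q) - ι 4 * (C * (N * (N - 1ℚ - K) - ι 2 * H)) - C * (ι 2 *
        (N - 1ℚ) - ι 2 * K))
            - C * N * (ι 4 * W - ι 4 * (N * (N - 1ℚ)) + ι 2 * (N - 1ℚ)) ≡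
            - (ι 4 * C * W) - ι 4 * (N - 1ℚ) * Q + ι 8 * C * (N - 1ℚ) * H + C * (N - 1ℚ) * (ι 4 * N * K + ι 2 * K + ι 2)
    close = solve-∀ ℚ-ring

-- Counting

sumℕ-mono : ∀ {n} {f g : Fin n → ℕ} → (∀ i → f i ℕ.≤ g i) → sumℕ f ℕ.≤ sumℕ g
sumℕ-mono {zero}  le = z≤n
sumℕ-mono {suc n} le = ℕ.+-mono-≤ (le zero) (sumℕ-mono (le ∘ suc))

sumℕ-mono-< : ∀ {n} {f g : Fin n → ℕ} → (∀ i → f i ℕ.≤ g i) → ∀ i → f i ℕ.< g i → sumℕ f ℕ.< sumℕ g
sumℕ-mono-< le zero    lt = ℕ.+-mono-<-≤ lt (sumℕ-mono (le ∘ suc))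
sumℕ-mono-< le (suc i) lt = ℕ.+-mono-≤-< (le zero) (sumℕ-mono-< (le ∘ suc) i lt)

sumℕ-≤-except : ∀ {n} {f g : Fin n → ℕ} i → (∀ j → j ≢ i → f j ℕ.≤ g j) → f i ℕ.≤ suc (g i) → sumℕ f ℕ.≤ suc (sumℕ g)
sumℕ-≤-except zero    le le₁ = ℕ.+-mono-≤ le₁ (sumℕ-mono (λ j → le (suc j) λ ()))
sumℕ-≤-except {f = f} {g} (suc i) le le₁ = subst (sumℕ f ℕ.≤_) (ℕ.+-suc (g zero) _)
  (ℕ.+-mono-≤ (le zero λ ()) (sumℕ-≤-except i (λ j j≢i → le (suc j) (j≢i ∘ Fin.suc-injective)) le₁))

sumℕ-0 : ∀ {n} {f : Fin n → ℕ} → (∀ i → f i ≡ 0) → sumℕ f ≡ 0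
sumℕ-0 {zero}  e = refl
sumℕ-0 {suc n} e = cong₂ ℕ._+_ (e zero) (sumℕ-0 (e ∘ suc))

sumℕ≢0 : ∀ {n} (f : Fin n → ℕ) → sumℕ f ≢ 0 → ∃[ i ] f i ≢ 0
sumℕ≢0 f ≢0 with Fin.any? (λ i → ¬? (f i ℕ.≟ 0))
... | yes w = w
... | no ¬w = contradiction (sumℕ-0 λ i → decidable-stable (f i ℕ.≟ 0) λ ne → ¬w (i , ne)) ≢0

indicator : ∀ {P : Set} → Dec P → ℕ
indicator P? = if does P? then 1 else 0

indicator-yes : ∀ {P : Set} (P? : Dec P) → P → indicator P? ≡ 1
indicator-yes P? p = cong (if_then 1 else 0) (dec-true P? p)

indicator-no : ∀ {P : Set} (P? : Dec P) → ¬ P → indicator P? ≡ 0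
indicator-no P? ¬p = cong (if_then 1 else 0) (dec-false P? ¬p)

ι-indicator : ∀ {P : Set} (P? : Dec P) → ι (indicator P?) ≡ ⟦ P? ⟧
ι-indicator (yes _) = refl
ι-indicator (no _)  = refl

-- A height as the number of levels below it; this turns sums over heights into sums over levels.
∑-below : ∀ {m h} → h ℕ.≤ m → ∑[ t < m ] ⟦ toℕ t ℕ.<? h ⟧ ≡ ι h
∑-below {m} z≤n = ∑-0 {m} λ t → ⟦⟧-no (toℕ t ℕ.<? 0) λ ()
∑-below {suc m} {suc h} (s≤s h≤m) = begin
  ⟦ 0 ℕ.<? suc h ⟧ + ∑[ t < m ] ⟦ suc (toℕ t) ℕ.<? suc h ⟧   ≡⟨ cong (_+ ∑[ t < m ] ⟦ toℕ t ℕ.<? h ⟧) (⟦⟧-yes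
      (0 ℕ.<? suc h) (s≤s z≤n)) ⟩
  1ℚ + ∑[ t < m ] ⟦ toℕ t ℕ.<? h ⟧  ≡⟨ cong (1ℚ +_) (∑-below h≤m) ⟩
  1ℚ + ι h  ≡⟨ sym (ι-suc h) ⟩
  ι (suc h)  ∎
  where
  open ≡-Reasoning

⟦<⟧-⊓ : ∀ t h h′ → ⟦ t ℕ.<? h ⟧ * ⟦ t ℕ.<? h′ ⟧ ≡ ⟦ t ℕ.<? h ℕ.⊓ h′ ⟧
⟦<⟧-⊓ t h h′ with t ℕ.<? h ℕ.⊓ h′
... | yes t<⊓ = trans (cong₂ _*_ (⟦⟧-yes (t ℕ.<? h) (ℕ.m<n⊓o⇒m<n h h′ t<⊓)) (⟦⟧-yes (t ℕ.<? h′) (ℕ.m<n⊓o⇒m<o h h′ t<⊓)))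
                      (sym (⟦⟧-yes (t ℕ.<? h ℕ.⊓ h′) t<⊓))
... | no t≮⊓  = trans (⟦⟧*⟦⟧-no (t ℕ.<? h) (t ℕ.<? h′) λ t<h t<h′ → t≮⊓ (ℕ.⊓-pres-m< t<h t<h′))
                      (sym (⟦⟧-no (t ℕ.<? h ℕ.⊓ h′) t≮⊓))

ι-∣-∣ : ∀ m n → ι ℕ.∣ m - n ∣ ≡ 1ℚ * ι m + 1ℚ * ι n + - ι 2 * ι (m ℕ.⊓ n)
ι-∣-∣ m n with ℕ.≤-total m n
... | inj₁ m≤n = trans (trans (cong ι (ℕ.m≤n⇒∣m-n∣≡n∸m m≤n)) (ι-∸ m≤n))
                       (trans (lemma (ι m) (ι n)) (cong (λ s → 1ℚ * ι m + 1ℚ * ι n + - ι 2 * ι s) (sym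
                           (ℕ.m≤n⇒m⊓n≡m m≤n))))
  where
  lemma : ∀ m n → n - m ≡ 1ℚ * m + 1ℚ * n + - ι 2 * m
  lemma = solve-∀ ℚ-ring
... | inj₂ n≤m = trans (trans (cong ι (ℕ.m≤n⇒∣n-m∣≡n∸m n≤m)) (ι-∸ n≤m))
                       (trans (lemma (ι m) (ι n)) (cong (λ s → 1ℚ * ι m + 1ℚ * ι n + - ι 2 * ι s) (sym
                           (ℕ.m≥n⇒m⊓n≡n n≤m))))
  where
  lemma : ∀ m n → m - n ≡ 1ℚ * m + 1ℚ * n + - ι 2 * n
  lemma = solve-∀ ℚ-ring

ι-∣-∣² : ∀ m n → ι (ℕ.∣ m - n ∣ ℕ.* ℕ.∣ m - n ∣) ≡ (ι m - ι n) * (ι m - ι n)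
ι-∣-∣² m n = trans (ι-* ℕ.∣ m - n ∣ ℕ.∣ m - n ∣) (helper (ℕ.≤-total m n))
  where
  swap : ∀ m n → (n - m) * (n - m) ≡ (m - n) * (m - n)
  swap = solve-∀ ℚ-ring
  helper : m ℕ.≤ n ⊎ n ℕ.≤ m → ι ℕ.∣ m - n ∣ * ι ℕ.∣ m - n ∣ ≡ (ι m - ι n) * (ι m - ι n)
  helper (inj₁ m≤n) = trans (cong (λ s → s * s) (trans (cong ι (ℕ.m≤n⇒∣m-n∣≡n∸m m≤n)) (ι-∸ m≤n))) (swap (ι m) (ι n))
  helper (inj₂ n≤m) = cong (λ s → s * s) (trans (cong ι (ℕ.m≤n⇒∣n-m∣≡n∸m n≤m)) (ι-∸ n≤m))

-- The truncation of `pred` at 0 is harmless because of the factor `j`.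
ι-*-pred : ∀ j → ι (j ℕ.* ℕ.pred j) ≡ ι j * (ι j - 1ℚ)
ι-*-pred zero    = refl
ι-*-pred (suc j) = trans (ι-* (suc j) j) (cong (ι (suc j) *_) (trans (lemma (ι j)) (cong (_- 1ℚ) (sym (ι-suc j)))))
  where
  lemma : ∀ j → j ≡ 1ℚ + j - 1ℚ
  lemma = solve-∀ ℚ-ring

-- The sum of j(j - 1) over j up to m, the origin of the cubic (n-c+1)(n-c)(n-c-1) in the bound.
∑-∸ : ∀ m → ι 3 * ∑[ t < m ] ι ((m ∸ toℕ t) ℕ.* ℕ.pred (m ∸ toℕ t)) ≡ (ι m + 1ℚ) * ι m * (ι m - 1ℚ)
∑-∸ zero    = refl
∑-∸ (suc m) = begin
  ι 3 * (ι (suc m ℕ.* m) + S)  ≡⟨ ℚ.*-distribˡ-+ (ι 3) (ι (suc m ℕ.* m)) S ⟩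
  ι 3 * ι (suc m ℕ.* m) + ι 3 * S  ≡⟨ cong₂ (λ s t → ι 3 * s + t) (trans (ι-* (suc m) m)
      (cong (_* ι m) (ι-suc m))) (∑-∸ m) ⟩
  ι 3 * ((1ℚ + ι m) * ι m) + (ι m + 1ℚ) * ι m * (ι m - 1ℚ) ≡⟨ close (ι m) ⟩
  (1ℚ + ι m + 1ℚ) * (1ℚ + ι m) * (1ℚ + ι m - 1ℚ)  ≡⟨ cong (λ x → (x + 1ℚ) * x * (x - 1ℚ)) (sym (ι-suc m)) ⟩
  (ι (suc m) + 1ℚ) * ι (suc m) * (ι (suc m) - 1ℚ)  ∎
  where
  open ≡-Reasoning
  S = ∑[ t < m ] ι ((m ∸ toℕ t) ℕ.* ℕ.pred (m ∸ toℕ t))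
  close : ∀ m → ι 3 * ((1ℚ + m) * m) + (m + 1ℚ) * m * (m - 1ℚ) ≡ (1ℚ + m + 1ℚ) * (1ℚ + m) * (1ℚ + m - 1ℚ)
  close = solve-∀ ℚ-ring

-- Middles of a path

parity : ℕ → ℕ
parity zero          = 0
parity (suc zero)    = 1
parity (suc (suc k)) = parity k

-- Four times a product is the square of the sum minus the square of the difference, and the two
-- halves of `j` differ by its parity. For `j = c + 1` this replaces floor and ceiling by the parity
-- of `k = c - 1`.
floor*ceil : ∀ j → ι 4 * (ι ⌊ j /2⌋ * ι ⌈ j /2⌉) ≡ ι j * ι j - ι (parity j)
floor*ceil zero          = refl
floor*ceil (suc zero)    = refl
floor*ceil (suc (suc j)) = begin
  ι 4 * (ι (suc ⌊ j /2⌋) * ι (suc ⌈ j /2⌉))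
    ≡⟨ cong₂ (λ s t → ι 4 * (s * t)) (ι-suc ⌊ j /2⌋) (ι-suc ⌈ j /2⌉) ⟩
  ι 4 * ((1ℚ + ι ⌊ j /2⌋) * (1ℚ + ι ⌈ j /2⌉))
    ≡⟨ expand (ι ⌊ j /2⌋) (ι ⌈ j /2⌉) ⟩
  ι 4 * (ι ⌊ j /2⌋ * ι ⌈ j /2⌉) + ι 4 * (ι ⌊ j /2⌋ + ι ⌈ j /2⌉) + ι 4
    ≡⟨ cong₂ (λ s t → s + ι 4 * t + ι 4) (floor*ceil j) (trans (sym (ι-+ ⌊ j /2⌋ ⌈ j /2⌉)) (cong ι
        (ℕ.⌊n/2⌋+⌈n/2⌉≡n j))) ⟩
  ι j * ι j - ι (parity j) + ι 4 * ι j + ι 4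
    ≡⟨ close (ι j) (ι (parity j)) ⟩
  (ι 2 + ι j) * (ι 2 + ι j) - ι (parity j)
    ≡⟨ cong (λ x → x * x - ι (parity j)) (sym (ι-+ 2 j)) ⟩
  ι (suc (suc j)) * ι (suc (suc j)) - ι (parity j) ∎
  where
  open ≡-Reasoning
  expand : ∀ f g → ι 4 * ((1ℚ + f) * (1ℚ + g)) ≡ ι 4 * (f * g) + ι 4 * (f + g) + ι 4
  expand = solve-∀ ℚ-ring
  close : ∀ j e → j * j - e + ι 4 * j + ι 4 ≡ (ι 2 + j) * (ι 2 + j) - e
  close = solve-∀ ℚ-ring

parity-gap : ∀ a k → parity ℕ.∣ a ℕ.+ a - k ∣ ≡ parity k
parity-gap zero    k             = cong parity (ℕ.∣-∣-identityˡ k)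
parity-gap (suc a) zero          = trans (cong parity (cong suc (ℕ.+-suc a a))) (trans (cong parity (sym
    (ℕ.∣-∣-identityʳ (a ℕ.+ a)))) (parity-gap a 0))
parity-gap (suc a) (suc zero)    = trans (cong parity (trans (ℕ.∣-∣-identityʳ (a ℕ.+ suc a)) (ℕ.+-suc a a))) (odd a)
  where
  odd : ∀ a → parity (suc (a ℕ.+ a)) ≡ 1
  odd zero    = refl
  odd (suc a) = trans (cong (λ x → parity (suc (suc x))) (ℕ.+-suc a a)) (odd a)
parity-gap (suc a) (suc (suc k)) = trans (cong (λ s → parity ℕ.∣ s - suc k ∣) (ℕ.+-suc a a)) (parity-gap a k)

parity≤1 : ∀ j → parity j ℕ.≤ 1
parity≤1 zero          = z≤n
parity≤1 (suc zero)    = s≤s z≤n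
parity≤1 (suc (suc j)) = parity≤1 j

parity≤square : ∀ j → parity j ℕ.≤ j ℕ.* j
parity≤square zero          = z≤n
parity≤square (suc zero)    = s≤s z≤n
parity≤square (suc (suc j)) = ℕ.≤-trans (parity≤1 j) (s≤s z≤n)

parity≡square⇒≤1 : ∀ j → j ℕ.* j ≡ parity j → j ℕ.≤ 1
parity≡square⇒≤1 zero          e = z≤n
parity≡square⇒≤1 (suc zero)    e = s≤s z≤n
parity≡square⇒≤1 (suc (suc j)) e = contradiction (subst (ℕ._≤ 1) (sym e) (parity≤1 j)) λ { (s≤s ()) }

-- With `c = suc k`, the three disjuncts of `IsMiddle` say that `2a - k` is 0, 1 or -1.
gap≤1⇒middle : ∀ {k} (a : Fin (suc k)) → ℕ.∣ toℕ a ℕ.+ toℕ a - k ∣ ℕ.≤ 1 → IsMiddle a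
gap≤1⇒middle {k} a le with ℕ.∣ toℕ a ℕ.+ toℕ a - k ∣ in eq
... | zero = inj₁ (trans (cong suc (sym (ℕ.∣m-n∣≡0⇒m≡n eq))) (trans (ℕ.+-comm 1 _) (cong (λ s → toℕ a ℕ.+ s ℕ.+ 1) (sym
    (ℕ.+-identityʳ (toℕ a))))))
gap≤1⇒middle {k} a (s≤s z≤n) | suc zero with ℕ.≤-total (toℕ a ℕ.+ toℕ a) k
... | inj₁ le = inj₂ (inj₂ (trans (cong suc (trans (sym (ℕ.m∸n+n≡m le)) (cong (ℕ._+ (toℕ a ℕ.+ toℕ a)) (trans (sym
    (ℕ.m≤n⇒∣m-n∣≡n∸m le)) eq))))
                  (trans (ℕ.+-comm 2 _) (cong (λ s → toℕ a ℕ.+ s ℕ.+ 2) (sym (ℕ.+-identityʳ (toℕ a)))))))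
... | inj₂ ge = inj₂ (inj₁ (trans (cong (ℕ._+ k) (trans (sym eq) (ℕ.m≤n⇒∣n-m∣≡n∸m ge))) (trans (ℕ.m∸n+n≡m ge)
    (cong (toℕ a ℕ.+_) (sym (ℕ.+-identityʳ (toℕ a)))))))

middle⇒square : ∀ {k} (a : Fin (suc k)) → IsMiddle a → ℕ.∣ toℕ a ℕ.+ toℕ a - k ∣ ℕ.* ℕ.∣ toℕ a ℕ.+ toℕ a - k ∣
    ≡ parity k
middle⇒square {k} a mid = trans (square _ gap≤1) (parity-gap (toℕ a) k)
  where
  square : ∀ j → j ℕ.≤ 1 → j ℕ.* j ≡ parity j
  square zero       _ = refl
  square (suc zero) _ = refl
  square (suc (suc _)) (s≤s ())
  double : ∀ x → 2 ℕ.* x ≡ x ℕ.+ x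
  double x = cong (x ℕ.+_) (ℕ.+-identityʳ x)
  gap≤1 : ℕ.∣ toℕ a ℕ.+ toℕ a - k ∣ ℕ.≤ 1
  gap≤1 = from mid
    where
    x = toℕ a ℕ.+ toℕ a
    from : IsMiddle a → ℕ.∣ x - k ∣ ℕ.≤ 1
    from (inj₁ e) = subst (λ k → ℕ.∣ x - k ∣ ℕ.≤ 1) (sym k≡x) (ℕ.≤-trans (ℕ.≤-reflexive (ℕ.∣n-n∣≡0 x)) z≤n)
      where
      k≡x : k ≡ x
      k≡x = ℕ.suc-injective (trans e (trans (ℕ.+-comm _ 1) (cong suc (double (toℕ a)))))
    from (inj₂ (inj₁ e)) = subst (λ x → ℕ.∣ x - k ∣ ℕ.≤ 1) (trans e (double (toℕ a))) (ℕ.≤-reflexive (trans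
        (cong ℕ.∣_- k ∣ (ℕ.+-comm 1 k)) (trans (ℕ.∣-∣-comm (k ℕ.+ 1) k) (ℕ.∣m-m+n∣≡n k 1))))
    from (inj₂ (inj₂ e)) = subst (λ k → ℕ.∣ x - k ∣ ℕ.≤ 1) (sym k≡x+1) (ℕ.≤-reflexive (ℕ.∣m-m+n∣≡n x 1))
      where
      k≡x+1 : k ≡ x ℕ.+ 1
      k≡x+1 = ℕ.suc-injective (trans e (trans (cong (ℕ._+ 2) (double (toℕ a))) (ℕ.+-suc x 1)))

-- The deficit to the bound

opaque
  -- The braces of the bound, with floor and ceiling as variables `f` and `g`.
  big : (N C f g : ℚ) → ℚ
  big N C f g = ι 4 * C * (ℤ.+ 2 / 3) * (N - C + 1ℚ) * (N - C) * (N - C - 1ℚ)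
    - ι 8 * (N - C) *
        ( - (N * C * f * g)
        + C * (C + 1ℚ) * (ℤ.+ 1 / 6) * ((ι 2 * N + 1ℚ) * C + N - 1ℚ))
    - ι 4 * (N + 1ℚ) * C * C * (C * C - 1ℚ) * (ℤ.+ 1 / 6)
    + ι 4 * N * (N - 1ℚ) * C * (C - 1ℚ)
    + ι 2 * (N - 1ℚ) * C * C

  bound-big : ∀ n c → bound n c ≡ recip (4 ℕ.* c ℕ.* n ℕ.* (n ∸ 1)) * big (ι n) (ι c) (ι ⌊ suc c /2⌋) (ι ⌈ suc c /2⌉)
  bound-big n c = refl

  -- Isolates the product of floor and ceiling in the form in which `floor*ceil` evaluates it.
  big-product : ∀ N C f g → big N C f g ≡ big N C 0ℚ 0ℚ + ι 2 * (N - C) * N * C * (ι 4 * (f * g))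
  big-product = expand
    where
    expand : ∀ N C f g → ι 4 * C * (ℤ.+ 2 / 3) * (N - C + 1ℚ) * (N - C) * (N - C - 1ℚ)
      - ι 8 * (N - C) * (- (N * C * f * g) + C * (C + 1ℚ) * (ℤ.+ 1 / 6) * ((ι 2 * N + 1ℚ) * C + N - 1ℚ))
      - ι 4 * (N + 1ℚ) * C * C * (C * C - 1ℚ) * (ℤ.+ 1 / 6) + ι 4 * N * (N - 1ℚ) * C * (C - 1ℚ) + ι 2 *
          (N - 1ℚ) * C * C ≡
      ι 4 * C * (ℤ.+ 2 / 3) * (N - C + 1ℚ) * (N - C) * (N - C - 1ℚ)
      - ι 8 * (N - C) * (- (N * C * 0ℚ * 0ℚ) + C * (C + 1ℚ) * (ℤ.+ 1 / 6) * ((ι 2 * N + 1ℚ) * C + N - 1ℚ))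
      - ι 4 * (N + 1ℚ) * C * C * (C * C - 1ℚ) * (ℤ.+ 1 / 6) + ι 4 * N * (N - 1ℚ) * C * (C - 1ℚ) + ι 2 * (N - 1ℚ) * C * C
      + ι 2 * (N - C) * N * C * (ι 4 * (f * g))
    expand = solve-∀ ℚ-ring

  ⅓ : ℚ
  ⅓ = ℤ.+ 1 / 3

  ⅓-cancel : ∀ x → ⅓ * (ι 3 * x) ≡ x
  ⅓-cancel = expand
    where
    expand : ∀ x → (ℤ.+ 1 / 3) * (ι 3 * x) ≡ x
    expand = solve-∀ ℚ-ring

  -- `s` stands for the sum of (x - b)² over the path. The absolute values and the squares are both
  -- centred at K/2; of the final coefficient CN of the square, C comes from the former and C(N - 1)
  -- from the latter.
  gap-sum : ∀ N K x s → ι 6 * s ≡ ι 6 * (1ℚ + K) * (x * x) - ι 6 * x * (K * (K + 1ℚ)) + K * (K + 1ℚ) * (ι 2 * K + 1ℚ) →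
    (1ℚ + K) * ((ι 2 * x - K) * (ι 2 * x - K) + K * K + ι 2 * K) + ι 4 * (N - 1ℚ) * s ≡
    (1ℚ + K) * (K * K + ι 2 * K) * (⅓ * (N + ι 2)) + (1ℚ + K) * N * ((ι 2 * x - K) * (ι 2 * x - K))
  gap-sum N K x s e = trans (cong (λ s → (1ℚ + K) * ((ι 2 * x - K) * (ι 2 * x - K) + K * K + ι 2 * K) + ι 4 *
      (N - 1ℚ) * s) s≡) (expand N K x)
    where
    sixth : ∀ s → s ≡ (ℤ.+ 1 / 6) * (ι 6 * s)
    sixth = solve-∀ ℚ-ring
    s≡ : s ≡ (ℤ.+ 1 / 6) * (ι 6 * (1ℚ + K) * (x * x) - ι 6 * x * (K * (K + 1ℚ)) + K * (K + 1ℚ) * (ι 2 * K + 1ℚ))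
    s≡ = trans (sixth s) (cong ((ℤ.+ 1 / 6) *_) e)
    expand : ∀ N K x → (1ℚ + K) * ((ι 2 * x - K) * (ι 2 * x - K) + K * K + ι 2 * K) +
      ι 4 * (N - 1ℚ) * ((ℤ.+ 1 / 6) * (ι 6 * (1ℚ + K) * (x * x) - ι 6 * x * (K * (K + 1ℚ)) + K * (K + 1ℚ) *
          (ι 2 * K + 1ℚ))) ≡
      (1ℚ + K) * (K * K + ι 2 * K) * ((ℤ.+ 1 / 3) * (N + ι 2)) + (1ℚ + K) * N * ((ι 2 * x - K) * (ι 2 * x - K))
    expand = solve-∀ ℚ-ring

  -- `ε` cancels on the right: it is subtracted with the product of floor and ceiling, and added
  -- back to be absorbed by `Mid`.
  big-polynomial : ∀ N K ε → let C = 1ℚ + K; m = N - C; C₀ = C * (K * K + ι 2 * K) * (⅓ * (N + ι 2)) in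
    C * (N - 1ℚ) * (ι 4 * N * K + ι 2 * K + ι 2) - (C * C₀ + C * N * (C * (K * K + ι 2 * K) * ⅓) + ι 2 * (C₀ * m)) ≡
    big N C 0ℚ 0ℚ + ι 2 * (N - C) * N * C * ((1ℚ + C) * (1ℚ + C) - ε) - ι 8 * C * (⅓ * ((m + 1ℚ) * m *
        (m - 1ℚ))) + ι 2 * C * N * (m * ε)
  big-polynomial = expand
    where
    expand : ∀ N K ε →
      (1ℚ + K) * (N - 1ℚ) * (ι 4 * N * K + ι 2 * K + ι 2) - ((1ℚ + K) * ((1ℚ + K) * (K * K + ι 2 * K) * ((ℤ.+ 1 / 3) *
          (N + ι 2))) + (1ℚ + K) * N * ((1ℚ + K) * (K * K + ι 2 * K) * (ℤ.+ 1 / 3)) + ι 2 * (((1ℚ + K) *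
          (K * K + ι 2 * K) * ((ℤ.+ 1 / 3) * (N + ι 2))) * (N - (1ℚ + K)))) ≡
      ι 4 * (1ℚ + K) * (ℤ.+ 2 / 3) * (N - (1ℚ + K) + 1ℚ) * (N - (1ℚ + K)) * (N - (1ℚ + K) - 1ℚ)
      - ι 8 * (N - (1ℚ + K)) * (- (N * (1ℚ + K) * 0ℚ * 0ℚ) + (1ℚ + K) * ((1ℚ + K) + 1ℚ) * (ℤ.+ 1 / 6) *
          ((ι 2 * N + 1ℚ) * (1ℚ + K) + N - 1ℚ))
      - ι 4 * (N + 1ℚ) * (1ℚ + K) * (1ℚ + K) * ((1ℚ + K) * (1ℚ + K) - 1ℚ) * (ℤ.+ 1 / 6) + ι 4 * N * (N - 1ℚ) *
          (1ℚ + K) * ((1ℚ + K) - 1ℚ) + ι 2 * (N - 1ℚ) * (1ℚ + K) * (1ℚ + K)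
      + ι 2 * (N - (1ℚ + K)) * N * (1ℚ + K) * ((1ℚ + (1ℚ + K)) * (1ℚ + (1ℚ + K)) - ε) - ι 8 * (1ℚ + K) * ((ℤ.+ 1 / 3) *
          ((N - (1ℚ + K) + 1ℚ) * (N - (1ℚ + K)) * (N - (1ℚ + K) - 1ℚ))) + ι 2 * (1ℚ + K) * N * ((N - (1ℚ + K)) * ε)
    expand = solve-∀ ℚ-ring

∑-squares : ∀ k x → ι 6 * ∑[ b < suc k ] ((x - ι (toℕ b)) * (x - ι (toℕ b))) ≡
  ι 6 * (1ℚ + ι k) * (x * x) - ι 6 * x * (ι k * (ι k + 1ℚ)) + ι k * (ι k + 1ℚ) * (ι 2 * ι k + 1ℚ)
∑-squares k x = begin
  ι 6 * ∑[ b < suc k ] ((x - ι (toℕ b)) * (x - ι (toℕ b)))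
    ≡⟨ cong (ι 6 *_) (∑-lin₃ {n = suc k} {f = λ _ → 1ℚ} {λ b → ι (toℕ b)} {λ b → ι (toℕ b) * ι (toℕ b)} (x * x) (-
        (ι 2 * x)) 1ℚ (λ b → expand x (ι (toℕ b)))) ⟩
  ι 6 * (x * x * ∑[ b < suc k ] 1ℚ + - (ι 2 * x) * S₁ + 1ℚ * S₂)
    ≡⟨ cong (λ s → ι 6 * (x * x * s + - (ι 2 * x) * S₁ + 1ℚ * S₂)) (trans (∑-const (suc k) 1ℚ)
        (cong (_* 1ℚ) (ι-suc k))) ⟩
  ι 6 * (x * x * ((1ℚ + ι k) * 1ℚ) + - (ι 2 * x) * S₁ + 1ℚ * S₂)
    ≡⟨ regroup x (ι k) S₁ S₂ ⟩
  ι 6 * (1ℚ + ι k) * (x * x) - ι 6 * x * (ι 2 * S₁) + ι 6 * S₂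
    ≡⟨ cong₂ (λ s t → ι 6 * (1ℚ + ι k) * (x * x) - ι 6 * x * s + t) (∑-toℕ k) (∑-toℕ² k) ⟩
  ι 6 * (1ℚ + ι k) * (x * x) - ι 6 * x * (ι k * (ι k + 1ℚ)) + ι k * (ι k + 1ℚ) * (ι 2 * ι k + 1ℚ) ∎
  where
  open ≡-Reasoning
  S₁ = ∑[ b < suc k ] ι (toℕ b)
  S₂ = ∑[ b < suc k ] (ι (toℕ b) * ι (toℕ b))
  expand : ∀ x b → (x - b) * (x - b) ≡ x * x * 1ℚ + - (ι 2 * x) * b + 1ℚ * (b * b)
  expand = solve-∀ ℚ-ring
  regroup : ∀ x k s₁ s₂ → ι 6 * (x * x * ((1ℚ + k) * 1ℚ) + - (ι 2 * x) * s₁ + 1ℚ * s₂) ≡ ι 6 * (1ℚ + k) *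
      (x * x) - ι 6 * x * (ι 2 * s₁) + ι 6 * s₂
  regroup = solve-∀ ℚ-ring

-- Four times `∑-squares` at the midpoint `k / 2`.
∑-centred : ∀ k → ∑[ b < suc k ] ((ι 2 * ι (toℕ b) - ι k) * (ι 2 * ι (toℕ b) - ι k)) ≡ (1ℚ + ι k) *
    (ι k * ι k + ι 2 * ι k) * ⅓
∑-centred k = *-cancelˡ {ι 3} (λ ()) (begin
  ι 3 * ∑[ b < suc k ] ((ι 2 * ι (toℕ b) - ι k) * (ι 2 * ι (toℕ b) - ι k))
    ≡⟨ cong (ι 3 *_) (∑-lin₁ {n = suc k} {f = λ b → (½ * ι k - ι (toℕ b)) * (½ * ι k - ι (toℕ b))} (ι 4)
        (λ b → factor (ι (toℕ b)) (ι k))) ⟩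
  ι 3 * (ι 4 * ∑[ b < suc k ] ((½ * ι k - ι (toℕ b)) * (½ * ι k - ι (toℕ b))))
    ≡⟨ regroup (∑[ b < suc k ] ((½ * ι k - ι (toℕ b)) * (½ * ι k - ι (toℕ b)))) ⟩
  ι 2 * (ι 6 * ∑[ b < suc k ] ((½ * ι k - ι (toℕ b)) * (½ * ι k - ι (toℕ b))))
    ≡⟨ cong (ι 2 *_) (∑-squares k (½ * ι k)) ⟩
  ι 2 * (ι 6 * (1ℚ + ι k) * (½ * ι k * (½ * ι k)) - ι 6 * (½ * ι k) * (ι k * (ι k + 1ℚ)) + ι k * (ι k + 1ℚ) *
      (ι 2 * ι k + 1ℚ))
    ≡⟨ close (ι k) ⟩
  (1ℚ + ι k) * (ι k * ι k + ι 2 * ι k)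
    ≡⟨ sym (⅓-cancel _) ⟩
  ⅓ * (ι 3 * ((1ℚ + ι k) * (ι k * ι k + ι 2 * ι k)))
    ≡⟨ swap ⅓ ((1ℚ + ι k) * (ι k * ι k + ι 2 * ι k)) ⟩
  ι 3 * ((1ℚ + ι k) * (ι k * ι k + ι 2 * ι k) * ⅓) ∎)
  where
  open ≡-Reasoning
  factor : ∀ b k → (ι 2 * b - k) * (ι 2 * b - k) ≡ ι 4 * ((½ * k - b) * (½ * k - b))
  factor = solve-∀ ℚ-ring
  regroup : ∀ s → ι 3 * (ι 4 * s) ≡ ι 2 * (ι 6 * s)
  regroup = solve-∀ ℚ-ring
  close : ∀ k → ι 2 * (ι 6 * (1ℚ + k) * (½ * k * (½ * k)) - ι 6 * (½ * k) * (k * (k + 1ℚ)) + k * (k + 1ℚ) *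
      (ι 2 * k + 1ℚ)) ≡ (1ℚ + k) * (k * k + ι 2 * k)
  close = solve-∀ ℚ-ring
  swap : ∀ t x → t * (ι 3 * x) ≡ ι 3 * (x * t)
  swap = solve-∀ ℚ-ring

-- Counting the vertices off the path by height

module Deficit {n} (T : Graph n) (tree : IsTree T) {k} (p : Fin (suc k) → Fin n)
               (path : IsPath T (p zero) (p (fromℕ k)) p) where
  open PathProjection T tree p path
  open TreeLaplacian T tree
  open PathLaplacian T tree p path
  open ≡-Reasoning

  m : ℕ
  m = n ∸ suc k

  private
    N K C : ℚ
    N = ι n
    K = ι k
    C = ι (suc k)

  off : Fin n → ℚ
  off x = ⟦ 0 ℕ.<? height x ⟧

  0≤off : ∀ x → 0ℚ ≤ off x
  0≤off x = 0≤⟦⟧ (0 ℕ.<? height x)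

  ∑-split : ∀ (F : Fin n → ℚ) → sum F ≡ ∑[ b < suc k ] F (p b) + ∑[ x < n ] (off x * F x)
  ∑-split F = begin
    sum F  ≡⟨ sum-cong-≗ pointwise ⟩
    ∑[ x < n ] (∑[ b < suc k ] (⟦ p b ≟ x ⟧ * F x) + off x * F x)  ≡⟨ ∑-distrib-+
        (λ x → ∑[ b < suc k ] (⟦ p b ≟ x ⟧ * F x)) (λ x → off x * F x) ⟩
    ∑[ x < n ] ∑[ b < suc k ] (⟦ p b ≟ x ⟧ * F x) + ∑[ x < n ] (off x * F x)   ≡⟨ cong (_+ ∑[ x < n ] (off x * F x))
        (trans (∑-comm (λ x b → ⟦ p b ≟ x ⟧ * F x)) (sum-cong-≗ λ b → ∑-δʳ (p b) F)) ⟩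
    ∑[ b < suc k ] F (p b) + ∑[ x < n ] (off x * F x)  ∎
    where
    cover : ∀ x → ∑[ b < suc k ] ⟦ p b ≟ x ⟧ + off x ≡ 1ℚ
    cover x with 0 ℕ.<? height x
    ... | yes 0<h = cong₂ _+_ (∑-0 {suc k} λ b → ⟦⟧-no (p b ≟ x) λ { refl → ℕ.<-irrefl
        (sym (height-path b)) 0<h }) (⟦⟧-yes (0 ℕ.<? height x) 0<h)
    ... | no ¬0<h = cong₂ _+_ (trans (∑-point (foot x) λ b b≢f → ⟦⟧-no (p b ≟ x) λ { refl → b≢f (sym (foot-path b)) })
                                (⟦⟧-yes (p (foot x) ≟ x) (height≡0⇒ (ℕ.n≤0⇒n≡0
                                    (ℕ.≮⇒≥ ¬0<h))))) (⟦⟧-no (0 ℕ.<? height x) ¬0<h)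
    pointwise : ∀ x → F x ≡ ∑[ b < suc k ] (⟦ p b ≟ x ⟧ * F x) + off x * F x
    pointwise x = begin
      F x  ≡⟨ sym (ℚ.*-identityˡ (F x)) ⟩
      1ℚ * F x  ≡⟨ cong (_* F x) (sym (cover x)) ⟩
      (∑[ b < suc k ] ⟦ p b ≟ x ⟧ + off x) * F x  ≡⟨ ℚ.*-distribʳ-+ (F x)
          (∑[ b < suc k ] ⟦ p b ≟ x ⟧) (off x) ⟩
      ∑[ b < suc k ] ⟦ p b ≟ x ⟧ * F x + off x * F x       ≡⟨ cong (_+ off x * F x) (trans (ℚ.*-comm _ (F x))
          (trans (*-distribˡ-sum (F x) (λ b → ⟦ p b ≟ x ⟧)) (sum-cong-≗ {suc k} λ b → ℚ.*-comm (F x) ⟦ p b ≟ x ⟧))) ⟩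
      ∑[ b < suc k ] (⟦ p b ≟ x ⟧ * F x) + off x * F x     ∎

  opaque
    M : ℕ → ℕ
    M t = sumℕ (λ x → indicator (t ℕ.<? height x))

    M-∑ : ∀ t → M t ≡ sumℕ (λ x → indicator (t ℕ.<? height x))
    M-∑ t = refl

  ι-M : ∀ t → ι (M t) ≡ ∑[ x < n ] ⟦ t ℕ.<? height x ⟧
  ι-M t = trans (cong ι (M-∑ t)) (trans (ι-sum (λ x → indicator (t ℕ.<? height x)))
      (sum-cong-≗ λ x → ι-indicator (t ℕ.<? height x)))

  n≡c+M : n ≡ suc k ℕ.+ M 0
  n≡c+M = ι-injective (begin
    ι n  ≡⟨ sym (trans (∑-const n 1ℚ) (ℚ.*-identityʳ (ι n))) ⟩
    ∑[ x < n ] 1ℚ  ≡⟨ ∑-split (λ _ → 1ℚ) ⟩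
    ∑[ b < suc k ] 1ℚ + ∑[ x < n ] (off x * 1ℚ)  ≡⟨ cong₂ _+_ (trans (∑-const (suc k) 1ℚ) (ℚ.*-identityʳ C))
        (trans (sum-cong-≗ λ x → ℚ.*-identityʳ (off x)) (sym (ι-M 0))) ⟩
    C + ι (M 0)  ≡⟨ sym (ι-+ (suc k) (M 0)) ⟩
    ι (suc k ℕ.+ M 0)                                   ∎)

  M0≡m : M 0 ≡ m
  M0≡m = sym (trans (cong (_∸ suc k) n≡c+M) (ℕ.m+n∸m≡n (suc k) (M 0)))

  ι-m : ι m ≡ N - C
  ι-m = ι-∸ (subst (suc k ℕ.≤_) (sym n≡c+M) (ℕ.m≤m+n (suc k) (M 0)))

  indicator-suc≤ : ∀ t x → indicator (suc t ℕ.<? height x) ℕ.≤ indicator (t ℕ.<? height x)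
  indicator-suc≤ t x = by-cases (suc t ℕ.<? height x)
    where
    by-cases : Dec (suc t ℕ.< height x) → indicator (suc t ℕ.<? height x) ℕ.≤ indicator (t ℕ.<? height x)
    by-cases (yes 1+t<h) = ℕ.≤-reflexive (trans (indicator-yes (suc t ℕ.<? height x) 1+t<h)
        (sym (indicator-yes (t ℕ.<? height x) (ℕ.<⇒≤ 1+t<h))))
    by-cases (no 1+t≮h)  = ℕ.≤-trans (ℕ.≤-reflexive (indicator-no (suc t ℕ.<? height x) 1+t≮h)) z≤n

  ∃-height : ∀ {t} → M t ≢ 0 → ∃[ x ] height x ≡ suc t
  ∃-height {t} M≢0 with sumℕ≢0 _ (M≢0 ∘ trans (M-∑ t))
  ... | x , ≢0 = height-below (height x) x (suc t) refl (decidable-stable (t ℕ.<? height x) λ t≮h → ≢0 (indicator-no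
      (t ℕ.<? height x) t≮h))

  -- A vertex of height exactly `suc t` is counted by `M t` and not by `M (suc t)`; `pred` also
  -- covers the case that `M t` is 0.
  M-suc : ∀ t → M (suc t) ℕ.≤ ℕ.pred (M t)
  M-suc t with M t ℕ.≟ 0
  ... | yes M≡0 = subst (λ s → M (suc t) ℕ.≤ ℕ.pred s) (sym M≡0)
    (subst (M (suc t) ℕ.≤_) M≡0 (subst₂ ℕ._≤_ (sym (M-∑ (suc t))) (sym (M-∑ t)) (sumℕ-mono (indicator-suc≤ t))))
  ... | no M≢0 with ∃-height M≢0
  ...   | x , h≡1+t = ℕ.≤-pred (ℕ.≤-trans (subst₂ ℕ._<_ (sym (M-∑ (suc t)))
      (sym (M-∑ t)) (sumℕ-mono-< (indicator-suc≤ t) x jump))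
            (ℕ.≤-reflexive (sym (ℕ.suc-pred (M t) {{ℕ.≢-nonZero M≢0}}))))
    where
    jump : indicator (suc t ℕ.<? height x) ℕ.< indicator (t ℕ.<? height x)
    jump = subst₂ ℕ._<_ (sym (indicator-no (suc t ℕ.<? height x) (ℕ.≤⇒≯ (ℕ.≤-reflexive h≡1+t))))
                        (sym (indicator-yes (t ℕ.<? height x) (ℕ.≤-reflexive (sym h≡1+t)))) (s≤s z≤n)

  M≤m∸ : ∀ t → M t ℕ.≤ m ∸ t
  M≤m∸ zero    = ℕ.≤-reflexive M0≡m
  M≤m∸ (suc t) = ℕ.≤-trans (M-suc t) (ℕ.≤-trans (ℕ.pred-mono-≤ (M≤m∸ t)) (ℕ.≤-reflexive (ℕ.pred[m∸n]≡m∸[1+n] m t)))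

  -- `M m` is at most `m ∸ m`, so no vertex lies above level `m`, and the first `m` levels exhaust
  -- every height.
  height≤m : ∀ x → height x ℕ.≤ m
  height≤m x = ℕ.≮⇒≥ λ m<h → ℕ.<⇒≱ (sumℕ-mono-< {f = λ _ → 0} (λ _ → z≤n) x (ℕ.≤-reflexive
      (sym (indicator-yes (m ℕ.<? height x) m<h))))
    (ℕ.≤-trans (ℕ.≤-reflexive (sym (M-∑ m))) (ℕ.≤-trans (M≤m∸ m) (ℕ.≤-trans (ℕ.≤-reflexive (ℕ.n∸n≡0 m)) z≤n)))

  MM : ℚ
  MM = ∑[ t < m ] (ι (M (toℕ t)) * ι (M (toℕ t)))

  H-M : H ≡ ∑[ t < m ] ι (M (toℕ t))
  H-M = begin
    H  ≡⟨ sum-cong-≗ (λ x → trans (h-ι x) (sym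
        (∑-below (height≤m x)))) ⟩
    ∑[ x < n ] ∑[ t < m ] ⟦ toℕ t ℕ.<? height x ⟧  ≡⟨ ∑-comm (λ x (t : Fin m) → ⟦ toℕ t ℕ.<? height x ⟧) ⟩
    ∑[ t < m ] ∑[ x < n ] ⟦ toℕ t ℕ.<? height x ⟧  ≡⟨ sum-cong-≗ {m} (λ t → sym (ι-M (toℕ t))) ⟩
    ∑[ t < m ] ι (M (toℕ t))  ∎

  -- A level lies below the minimum of two heights iff it lies below both, so on each level the
  -- double sum factors into the square of `M`.
  ∑∑-⊓ : ∑[ x < n ] ∑[ y < n ] ι (height x ℕ.⊓ height y) ≡ MM
  ∑∑-⊓ = begin
    ∑[ x < n ] ∑[ y < n ] ι (height x ℕ.⊓ height y)
      ≡⟨ sum-cong-≗ (λ x → trans (sum-cong-≗ (layers x)) (∑-comm (λ y t → β t x * β t y))) ⟩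
    ∑[ x < n ] ∑[ t < m ] ∑[ y < n ] (β t x * β t y)
      ≡⟨ sum-cong-≗ (λ x → sum-cong-≗ {m} λ t → trans (∑-scale (β t x) (β t)) (trans (cong (β t x *_)
          (sym (ι-M (toℕ t)))) (ℚ.*-comm (β t x) (ι (M (toℕ t)))))) ⟩
    ∑[ x < n ] ∑[ t < m ] (ι (M (toℕ t)) * β t x)
      ≡⟨ ∑-comm (λ x t → ι (M (toℕ t)) * β t x) ⟩
    ∑[ t < m ] ∑[ x < n ] (ι (M (toℕ t)) * β t x)
      ≡⟨ sum-cong-≗ {m} (λ t → trans (∑-scale (ι (M (toℕ t))) (β t)) (cong (ι (M (toℕ t)) *_) (sym (ι-M (toℕ t))))) ⟩
    MM ∎
    where
    β : Fin m → Fin n → ℚ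
    β t x = ⟦ toℕ t ℕ.<? height x ⟧
    layers : ∀ x y → ι (height x ℕ.⊓ height y) ≡ ∑[ t < m ] (β t x * β t y)
    layers x y = trans (sym (∑-below {m} (ℕ.≤-trans (ℕ.m⊓n≤m (height x) (height y)) (height≤m x))))
                       (sum-cong-≗ {m} λ t → sym (⟦<⟧-⊓ (toℕ t) (height x) (height y)))

  Δh Δa e : Fin n → Fin n → ℚ
  Δh x y = ι ℕ.∣ height x - height y ∣
  Δa x y = ι ℕ.∣ toℕ (foot x) - toℕ (foot y) ∣
  e x y = dist x y - (Δh x y + Δa x y)

  0≤e : ∀ x y → 0ℚ ≤ e x y
  0≤e x y = p≤q⇒0≤q-p (subst₂ _≤_ (ι-+ ℕ.∣ height x - height y ∣ _) (sym (dist-ι x y)) (ι-mono (d-lower x y)))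

  ∑∑-Δh : ∑[ x < n ] ∑[ y < n ] Δh x y ≡ ι 2 * N * H - ι 2 * MM
  ∑∑-Δh = begin
    ∑[ x < n ] ∑[ y < n ] Δh x y
      ≡⟨ ∑-lin₃ {g = λ _ → H} N 1ℚ (- ι 2) row ⟩
    N * H + 1ℚ * ∑[ x < n ] H + - ι 2 * ∑[ x < n ] ∑[ y < n ] ι (height x ℕ.⊓ height y)
      ≡⟨ cong₂ (λ s t → N * H + 1ℚ * s + - ι 2 * t) (∑-const n H) ∑∑-⊓ ⟩
    N * H + 1ℚ * (N * H) + - ι 2 * MM
      ≡⟨ collect N H MM ⟩
    ι 2 * N * H - ι 2 * MM ∎
    where
    collect : ∀ N H M → N * H + 1ℚ * (N * H) + - ι 2 * M ≡ ι 2 * N * H - ι 2 * M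
    collect = solve-∀ ℚ-ring
    swap : ∀ h N H s → h * (N * 1ℚ) + 1ℚ * H + - ι 2 * s ≡ N * h + 1ℚ * H + - ι 2 * s
    swap = solve-∀ ℚ-ring
    row : ∀ x → ∑[ y < n ] Δh x y ≡ N * h x + 1ℚ * H + - ι 2 * ∑[ y < n ] ι (height x ℕ.⊓ height y)
    row x = begin
      ∑[ y < n ] Δh x y
        ≡⟨ ∑-lin₃ {f = λ _ → 1ℚ} {h} {λ y → ι (height x ℕ.⊓ height y)} (h x) 1ℚ (- ι 2)
            (λ y → trans (ι-∣-∣ (height x) (height y))
             (cong₂ (λ s t → s + t + - ι 2 * ι (height x ℕ.⊓ height y)) (trans (ℚ.*-comm 1ℚ (ι (height x)))
                 (cong (_* 1ℚ) (sym (h-ι x)))) (cong (1ℚ *_) (sym (h-ι y))))) ⟩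
      h x * ∑[ y < n ] 1ℚ + 1ℚ * H + - ι 2 * ∑[ y < n ] ι (height x ℕ.⊓ height y)
        ≡⟨ cong (λ s → h x * s + 1ℚ * H + - ι 2 * ∑[ y < n ] ι (height x ℕ.⊓ height y)) (∑-const n 1ℚ) ⟩
      h x * (N * 1ℚ) + 1ℚ * H + - ι 2 * ∑[ y < n ] ι (height x ℕ.⊓ height y)
        ≡⟨ swap (h x) N H (∑[ y < n ] ι (height x ℕ.⊓ height y)) ⟩
      N * h x + 1ℚ * H + - ι 2 * ∑[ y < n ] ι (height x ℕ.⊓ height y) ∎

-- The deficit as a sum over levels and pairs of feet

module DeficitIdentity {n} (T : Graph n) (tree : IsTree T) {k} (p : Fin (suc k) → Fin n)
                       (path : IsPath T (p zero) (p (fromℕ k)) p) where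
  open PathProjection T tree p path
  open TreeLaplacian T tree
  open PathLaplacian T tree p path
  open Deficit T tree p path
  open ≡-Reasoning

  private
    N K C : ℚ
    N = ι n
    K = ι k
    C = ι (suc k)

    C≡1+K : C ≡ 1ℚ + K
    C≡1+K = ι-suc k

  opaque
    -- The cost of a pair of feet: the |a - a'| part of `4cW` together with `4(n-1)Q`.
    gap : Fin (suc k) → Fin (suc k) → ℚ
    gap i j = ι 4 * C * ι ℕ.∣ toℕ i - toℕ j ∣ + ι 4 * (N - 1ℚ) * ((ι (toℕ i) - ι (toℕ j)) * (ι (toℕ i) - ι (toℕ j)))

    gap-def : ∀ i j → gap i j ≡ ι 4 * C * ι ℕ.∣ toℕ i - toℕ j ∣ + ι 4 * (N - 1ℚ) * ((ι (toℕ i) - ι (toℕ j)) * (ι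
        (toℕ i) - ι (toℕ j)))
    gap-def i j = refl

    offset : Fin (suc k) → ℚ
    offset i = (ι 2 * ι (toℕ i) - K) * (ι 2 * ι (toℕ i) - K)

    offset-def : ∀ i → offset i ≡ (ι 2 * ι (toℕ i) - K) * (ι 2 * ι (toℕ i) - K)
    offset-def i = refl

    C₀ : ℚ
    C₀ = C * (K * K + ι 2 * K) * (⅓ * (N + ι 2))

    C₀-def : C₀ ≡ C * (K * K + ι 2 * K) * (⅓ * (N + ι 2))
    C₀-def = refl

  gap-sym : ∀ i j → gap i j ≡ gap j i
  gap-sym i j = trans (gap-def i j) (trans (cong₂ (λ s t → ι 4 * C * ι s + ι 4 * (N - 1ℚ) * t)
      (ℕ.∣-∣-comm (toℕ i) (toℕ j)) (swap (ι (toℕ i)) (ι (toℕ j)))) (sym (gap-def j i)))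
    where
    swap : ∀ x y → (x - y) * (x - y) ≡ (y - x) * (y - x)
    swap = solve-∀ ℚ-ring

  -- The total cost of a vertex with foot `i` against the whole path. It is least where `offset` is,
  -- which is how the middle enters.
  ∑-gap-offset : ∀ i → sum (gap i) ≡ C₀ * 1ℚ + C * N * offset i
  ∑-gap-offset i = begin
    sum (gap i)
      ≡⟨ ∑-lin₂ {n = suc k} {f = λ b → ι ℕ.∣ toℕ i - toℕ b ∣} {λ b → (ι (toℕ i) - ι (toℕ b)) * (ι (toℕ i) - ι (toℕ b))}
          (ι 4 * C) (ι 4 * (N - 1ℚ)) (gap-def i) ⟩
    ι 4 * C * G₁ + ι 4 * (N - 1ℚ) * G₂
      ≡⟨ cong (_+ ι 4 * (N - 1ℚ) * G₂) (trans (swap C G₁) (cong₂ _*_ C≡1+K (∑-gap i))) ⟩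
    (1ℚ + K) * ((ι 2 * ι (toℕ i) - K) * (ι 2 * ι (toℕ i) - K) + K * K + ι 2 * K) + ι 4 * (N - 1ℚ) * G₂
      ≡⟨ gap-sum N K (ι (toℕ i)) G₂ (∑-squares k (ι (toℕ i))) ⟩
    (1ℚ + K) * (K * K + ι 2 * K) * (⅓ * (N + ι 2)) + (1ℚ + K) * N * ((ι 2 * ι (toℕ i) - K) * (ι 2 * ι (toℕ i) - K))
      ≡⟨ cong₂ (λ c o → c * (K * K + ι 2 * K) * (⅓ * (N + ι 2)) + c * N * o) (sym C≡1+K) (sym (offset-def i)) ⟩
    C * (K * K + ι 2 * K) * (⅓ * (N + ι 2)) + C * N * offset i
      ≡⟨ cong (_+ C * N * offset i) (trans (sym C₀-def) (sym (ℚ.*-identityʳ C₀))) ⟩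
    C₀ * 1ℚ + C * N * offset i ∎
    where
    G₁ = ∑[ b < suc k ] ι ℕ.∣ toℕ i - toℕ b ∣
    G₂ = ∑[ b < suc k ] ((ι (toℕ i) - ι (toℕ b)) * (ι (toℕ i) - ι (toℕ b)))
    swap : ∀ C g → ι 4 * C * g ≡ C * (ι 4 * g)
    swap = solve-∀ ℚ-ring

  -- The four terms of the deficit are `E`, the excess of distances over the lower bound; `L`, the
  -- shortfall of the level counts from those of a pendant path; `Mid`, the displacement of feet
  -- from the middle; and `P`, the spread of the feet of vertices off the path. `S` and `A` are
  -- auxiliary.
  P S E A L Mid : ℚ
  P = ∑[ x < n ] (off x * ∑[ y < n ] (off y * gap (foot x) (foot y)))
  S = ∑[ x < n ] (off x * offset (foot x))
  E = ∑[ x < n ] ∑[ y < n ] e x y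
  A = ∑[ x < n ] ∑[ y < n ] Δa x y
  L = ∑[ t < m ] (ι ((m ∸ toℕ t) ℕ.* ℕ.pred (m ∸ toℕ t)) - ι (M (toℕ t) ℕ.* ℕ.pred (M (toℕ t))))
  Mid = ∑[ x < n ] (off x * (offset (foot x) - ι (parity k)))

  ∑-off : sum off ≡ ι m
  ∑-off = trans (sym (ι-M 0)) (cong ι M0≡m)

  private
    Σgap : ℚ
    Σgap = ∑[ x < n ] ∑[ y < n ] gap (foot x) (foot y)

    attraction : Fin (suc k) → ℚ
    attraction i = ∑[ y < n ] (off y * gap i (foot y))

    ∑-attraction : sum attraction ≡ C₀ * ι m + C * N * S
    ∑-attraction = begin
      ∑[ i < suc k ] ∑[ y < n ] (off y * gap i (foot y))
        ≡⟨ ∑-comm (λ i y → off y * gap i (foot y)) ⟩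
      ∑[ y < n ] ∑[ i < suc k ] (off y * gap i (foot y))
        ≡⟨ ∑-lin₂ C₀ (C * N) column ⟩
      C₀ * sum off + C * N * S
        ≡⟨ cong (λ s → C₀ * s + C * N * S) ∑-off ⟩
      C₀ * ι m + C * N * S ∎
      where
      expand : ∀ o c d s → o * (c * 1ℚ + d * s) ≡ c * o + d * (o * s)
      expand = solve-∀ ℚ-ring
      column : ∀ y → ∑[ i < suc k ] (off y * gap i (foot y)) ≡ C₀ * off y + C * N * (off y * offset (foot y))
      column y = begin
        ∑[ i < suc k ] (off y * gap i (foot y))   ≡⟨ ∑-scale {n = suc k} (off y) (λ i → gap i (foot y)) ⟩
        off y * ∑[ i < suc k ] gap i (foot y)     ≡⟨ cong (off y *_) (trans
            (sum-cong-≗ {suc k} λ i → gap-sym i (foot y)) (∑-gap-offset (foot y))) ⟩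
        off y * (C₀ * 1ℚ + C * N * offset (foot y)) ≡⟨ expand (off y) C₀ (C * N) (offset (foot y)) ⟩
        C₀ * off y + C * N * (off y * offset (foot y)) ∎

    row : ∀ x → ∑[ y < n ] gap (foot x) (foot y) ≡ (C₀ * 1ℚ + C * N * offset (foot x)) + attraction (foot x)
    row x = trans (∑-split (λ y → gap (foot x) (foot y))) (cong (_+ attraction (foot x))
      (trans (sum-cong-≗ {suc k} λ b → cong (gap (foot x)) (foot-path b)) (∑-gap-offset (foot x))))

    -- Both sums are split into vertices on and off the path: the first two terms are the pairs on
    -- the path, the doubled term the mixed pairs, and `P` the pairs off it.
    Σgap≡ : Σgap ≡ C * C₀ + C * N * (C * (K * K + ι 2 * K) * ⅓) + ι 2 * (C₀ * ι m + C * N * S) + P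
    Σgap≡ = begin
      Σgap
        ≡⟨ trans (sum-cong-≗ row) (∑-split Φ) ⟩
      ∑[ b < suc k ] Φ (p b) + ∑[ x < n ] (off x * Φ x)
        ≡⟨ cong₂ _+_ on-path off-path ⟩
      (C₀ * (C * 1ℚ) + C * N * (C * (K * K + ι 2 * K) * ⅓) + 1ℚ * (C₀ * ι m + C * N * S)) +
          (C₀ * ι m + C * N * S + 1ℚ * P)
        ≡⟨ collect C₀ C (C * N * (C * (K * K + ι 2 * K) * ⅓)) (C₀ * ι m + C * N * S) P ⟩
      C * C₀ + C * N * (C * (K * K + ι 2 * K) * ⅓) + ι 2 * (C₀ * ι m + C * N * S) + P ∎
      where
      Φ : Fin n → ℚ
      Φ x = (C₀ * 1ℚ + C * N * offset (foot x)) + attraction (foot x)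
      collect : ∀ c₀ C q r P → (c₀ * (C * 1ℚ) + q + 1ℚ * r) + (r + 1ℚ * P) ≡ C * c₀ + q + ι 2 * r + P
      collect = solve-∀ ℚ-ring
      unit : ∀ c o a → (c + o) + a ≡ c + o + 1ℚ * a
      unit = solve-∀ ℚ-ring
      expand : ∀ o c d s a → o * ((c * 1ℚ + d * s) + a) ≡ c * o + d * (o * s) + 1ℚ * (o * a)
      expand = solve-∀ ℚ-ring
      centred : sum offset ≡ C * (K * K + ι 2 * K) * ⅓
      centred = trans (sum-cong-≗ {suc k} offset-def) (trans (∑-centred k) (cong (λ c → c * (K * K + ι 2 * K) * ⅓)
          (sym C≡1+K)))
      on-path : ∑[ b < suc k ] Φ (p b) ≡ C₀ * (C * 1ℚ) + C * N * (C * (K * K + ι 2 * K) * ⅓) + 1ℚ *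
          (C₀ * ι m + C * N * S)
      on-path = begin
        ∑[ b < suc k ] Φ (p b)
          ≡⟨ ∑-lin₃ {n = suc k} {f = λ _ → 1ℚ} {offset} {attraction} C₀ (C * N) 1ℚ (λ b → trans (cong
              (λ i → (C₀ * 1ℚ + C * N * offset i) + attraction i) (foot-path b)) (unit (C₀ * 1ℚ) (C * N * offset b)
              (attraction b))) ⟩
        C₀ * ∑[ b < suc k ] 1ℚ + C * N * sum offset + 1ℚ * sum attraction
          ≡⟨ cong₂ _+_ (cong₂ (λ s t → C₀ * s + C * N * t) (∑-const (suc k) 1ℚ) centred) (cong (1ℚ *_) ∑-attraction) ⟩
        C₀ * (C * 1ℚ) + C * N * (C * (K * K + ι 2 * K) * ⅓) + 1ℚ * (C₀ * ι m + C * N * S) ∎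
      off-path : ∑[ x < n ] (off x * Φ x) ≡ C₀ * ι m + C * N * S + 1ℚ * P
      off-path = trans (∑-lin₃ C₀ (C * N) 1ℚ (λ x → expand (off x) C₀ (C * N) (offset (foot x)) (attraction (foot x))))
                       (cong (λ s → C₀ * s + C * N * S + 1ℚ * P) ∑-off)

    Σgap-Q : Σgap ≡ ι 4 * C * A + ι 4 * (N - 1ℚ) * Q
    Σgap-Q = ∑-lin₂ (ι 4 * C) (ι 4 * (N - 1ℚ)) (λ x → ∑-lin₂ (ι 4 * C) (ι 4 * (N - 1ℚ)) λ y →
      trans (gap-def (foot x) (foot y)) (cong (λ r → ι 4 * C * Δa x y + ι 4 * (N - 1ℚ) * r)
        (cong₂ (λ r s → (r - s) * (r - s)) (sym (a-ι x)) (sym (a-ι y)))))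

    W≡ : W ≡ 1ℚ * E + 1ℚ * (ι 2 * N * H - ι 2 * MM) + 1ℚ * A
    W≡ = trans (∑-lin₃ 1ℚ 1ℚ 1ℚ (λ x → ∑-lin₃ 1ℚ 1ℚ 1ℚ (λ y → split (dist x y) (Δh x y) (Δa x y))))
               (cong (λ s → 1ℚ * E + 1ℚ * s + 1ℚ * A) ∑∑-Δh)
      where
      split : ∀ d h a → d ≡ 1ℚ * (d - (h + a)) + 1ℚ * h + 1ℚ * a
      split = solve-∀ ℚ-ring

    L≡ : L ≡ ⅓ * ((ι m + 1ℚ) * ι m * (ι m - 1ℚ)) - (1ℚ * MM + - 1ℚ * H)
    L≡ = trans (∑-distrib-- {n = m} (λ t → ι ((m ∸ toℕ t) ℕ.* ℕ.pred (m ∸ toℕ t)))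
        (λ t → ι (M (toℕ t) ℕ.* ℕ.pred (M (toℕ t)))))
      (cong₂ _-_ (trans (sym (⅓-cancel (∑[ t < m ] ι ((m ∸ toℕ t) ℕ.* ℕ.pred (m ∸ toℕ t))))) (cong (⅓ *_) (∑-∸ m)))
                 (trans (∑-lin₂ {n = m} {f = λ t → ι (M (toℕ t)) * ι (M (toℕ t))} {λ t → ι (M (toℕ t))} 1ℚ (- 1ℚ)
                     (λ t → trans (ι-*-pred (M (toℕ t))) (expand (ι (M (toℕ t)))))) (cong (λ s → 1ℚ * MM + - 1ℚ * s)
                     (sym H-M))))
      where
      expand : ∀ j → j * (j - 1ℚ) ≡ 1ℚ * (j * j) + - 1ℚ * j
      expand = solve-∀ ℚ-ring

    Mid≡ : Mid ≡ 1ℚ * S + - ι (parity k) * ι m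
    Mid≡ = trans (∑-lin₂ 1ℚ (- ι (parity k)) (λ x → expand (off x) (offset (foot x)) (ι (parity k))))
                 (cong (λ s → 1ℚ * S + - ι (parity k) * s) ∑-off)
      where
      expand : ∀ o s ε → o * (s - ε) ≡ 1ℚ * (o * s) + - ε * o
      expand = solve-∀ ℚ-ring

  -- The bound minus the difference of Kemeny's constants, times 4cn(n - 1).
  deficit : ℚ
  deficit = ι 4 * C * E + ι 8 * C * L + ι 2 * C * N * Mid + P

  value-deficit : - (ι 4 * C * W) - ι 4 * (N - 1ℚ) * Q + ι 8 * C * (N - 1ℚ) * H + C * (N - 1ℚ) *
      (ι 4 * N * K + ι 2 * K + ι 2) ≡
                  big N C (ι ⌊ suc (suc k) /2⌋) (ι ⌈ suc (suc k) /2⌉) - deficit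
  value-deficit = begin
    - (ι 4 * C * W) - ι 4 * (N - 1ℚ) * Q + ι 8 * C * (N - 1ℚ) * H + Z
      ≡⟨ cong (λ w → - (ι 4 * C * w) - ι 4 * (N - 1ℚ) * Q + ι 8 * C * (N - 1ℚ) * H + Z) W≡ ⟩
    -- The multiples of `N * H` cancel, which leaves `8C (MM - H)`, that is, 8C times the sum of M_t
    -- (M_t - 1) over the levels.
    - (ι 4 * C * (1ℚ * E + 1ℚ * (ι 2 * N * H - ι 2 * MM) + 1ℚ * A)) - ι 4 * (N - 1ℚ) * Q + ι 8 * C * (N - 1ℚ) * H + Z
      ≡⟨ regroup C N E H MM A Q Z ⟩
    - (ι 4 * C * E) - ι 8 * C * H + ι 8 * C * MM - (ι 4 * C * A + ι 4 * (N - 1ℚ) * Q) + Z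
      ≡⟨ cong (λ s → - (ι 4 * C * E) - ι 8 * C * H + ι 8 * C * MM - s + Z) (trans (sym Σgap-Q) Σgap≡) ⟩
    - (ι 4 * C * E) - ι 8 * C * H + ι 8 * C * MM - (C * C₀ + C * N * X + ι 2 * (C₀ * ι m + C * N * S) + P) + Z
      ≡⟨ isolate C N E H MM C₀ X (ι m) S P Z ⟩
    (Z - (C * C₀ + C * N * X + ι 2 * (C₀ * ι m))) + (- (ι 4 * C * E) - ι 8 * C * H + ι 8 * C * MM - ι 2 *
        (C * N * S) - P)
      ≡⟨ cong (_+ (- (ι 4 * C * E) - ι 8 * C * H + ι 8 * C * MM - ι 2 * (C * N * S) - P)) polynomial ⟩
    (big N C f g - ι 8 * C * (⅓ * ((ι m + 1ℚ) * ι m * (ι m - 1ℚ))) + ι 2 * C * N * (ι m * ε)) + (-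
        (ι 4 * C * E) - ι 8 * C * H + ι 8 * C * MM - ι 2 * (C * N * S) - P)
      ≡⟨ reassemble (big N C f g) C N E H MM (⅓ * ((ι m + 1ℚ) * ι m * (ι m - 1ℚ))) S (ι m) ε P ⟩
    big N C f g - (ι 4 * C * E + ι 8 * C * (⅓ * ((ι m + 1ℚ) * ι m * (ι m - 1ℚ)) - (1ℚ * MM + - 1ℚ * H)) + ι 2 * C * N *
        (1ℚ * S + - ε * ι m) + P)
      ≡⟨ cong₂ (λ l s → big N C f g - (ι 4 * C * E + ι 8 * C * l + ι 2 * C * N * s + P)) (sym L≡) (sym Mid≡) ⟩
    big N C f g - deficit ∎
    where
    Z X ε f g : ℚ
    Z = C * (N - 1ℚ) * (ι 4 * N * K + ι 2 * K + ι 2)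
    X = C * (K * K + ι 2 * K) * ⅓
    ε = ι (parity k)
    f = ι ⌊ suc (suc k) /2⌋
    g = ι ⌈ suc (suc k) /2⌉
    regroup : ∀ C N E H MM A Q Z → - (ι 4 * C * (1ℚ * E + 1ℚ * (ι 2 * N * H - ι 2 * MM) + 1ℚ * A)) - ι 4 *
        (N - 1ℚ) * Q + ι 8 * C * (N - 1ℚ) * H + Z ≡
              - (ι 4 * C * E) - ι 8 * C * H + ι 8 * C * MM - (ι 4 * C * A + ι 4 * (N - 1ℚ) * Q) + Z
    regroup = solve-∀ ℚ-ring
    isolate : ∀ C N E H MM c₀ X m S P Z → - (ι 4 * C * E) - ι 8 * C * H + ι 8 * C * MM - (C * c₀ + C * N * X + ι 2 *
        (c₀ * m + C * N * S) + P) + Z ≡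
              (Z - (C * c₀ + C * N * X + ι 2 * (c₀ * m))) + (- (ι 4 * C * E) - ι 8 * C * H + ι 8 * C * MM - ι 2 *
                  (C * N * S) - P)
    isolate = solve-∀ ℚ-ring
    reassemble : ∀ B C N E H MM l S m ε P → (B - ι 8 * C * l + ι 2 * C * N * (m * ε)) + (-
        (ι 4 * C * E) - ι 8 * C * H + ι 8 * C * MM - ι 2 * (C * N * S) - P) ≡
                 B - (ι 4 * C * E + ι 8 * C * (l - (1ℚ * MM + - 1ℚ * H)) + ι 2 * C * N * (1ℚ * S + - ε * m) + P)
    reassemble = solve-∀ ℚ-ring
    polynomial : Z - (C * C₀ + C * N * X + ι 2 * (C₀ * ι m)) ≡ big N C f g - ι 8 * C * (⅓ * ((ι m + 1ℚ) * ι m *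
        (ι m - 1ℚ))) + ι 2 * C * N * (ι m * ε)
    polynomial = begin
      Z - (C * C₀ + C * N * X + ι 2 * (C₀ * ι m))
        ≡⟨ cong₂ (λ c₀ m → Z - (C * c₀ + C * N * X + ι 2 * (c₀ * m))) C₀-def ι-m ⟩
      lhs C
        ≡⟨ cong lhs C≡1+K ⟩
      lhs (1ℚ + K)
        ≡⟨ big-polynomial N K ε ⟩
      rhs (1ℚ + K)
        ≡⟨ cong rhs (sym C≡1+K) ⟩
      rhs C
        ≡⟨ cong₂ (λ b m → b - ι 8 * C * (⅓ * ((m + 1ℚ) * m * (m - 1ℚ))) + ι 2 * C * N * (m * ε)) (sym product)
            (sym ι-m) ⟩
      big N C f g - ι 8 * C * (⅓ * ((ι m + 1ℚ) * ι m * (ι m - 1ℚ))) + ι 2 * C * N * (ι m * ε) ∎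
      where
      lhs rhs : ℚ → ℚ
      lhs C = C * (N - 1ℚ) * (ι 4 * N * K + ι 2 * K + ι 2) - (C * (C * (K * K + ι 2 * K) * (⅓ * (N + ι 2))) + C * N *
          (C * (K * K + ι 2 * K) * ⅓) + ι 2 * (C * (K * K + ι 2 * K) * (⅓ * (N + ι 2)) * (N - C)))
      rhs C = big N C 0ℚ 0ℚ + ι 2 * (N - C) * N * C * ((1ℚ + C) * (1ℚ + C) - ε) - ι 8 * C * (⅓ * ((N - C + 1ℚ) *
          (N - C) * (N - C - 1ℚ))) + ι 2 * C * N * ((N - C) * ε)
      product : big N C f g ≡ big N C 0ℚ 0ℚ + ι 2 * (N - C) * N * C * ((1ℚ + C) * (1ℚ + C) - ε)
      product = trans (big-product N C f g) (cong (λ s → big N C 0ℚ 0ℚ + ι 2 * (N - C) * N * C * s)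
        (trans (floor*ceil (suc (suc k))) (cong (λ s → s * s - ε) (ι-suc (suc k)))))

-- Rigidity

module Rigidity {n} (T : Graph n) (tree : IsTree T) {k} (p : Fin (suc k) → Fin n)
                (path : IsPath T (p zero) (p (fromℕ k)) p) where
  open TreeDistance T tree
  open PathProjection T tree p path
  open TreeLaplacian T tree
  open Deficit T tree p path
  open DeficitIdentity T tree p path

  record Rigid : Set where
    field
      d-exact   : ∀ x y → d x y ≡ ℕ.∣ height x - height y ∣ ℕ.+ ℕ.∣ toℕ (foot x) - toℕ (foot y) ∣
      middle    : ∀ x → 0 ℕ.< height x → IsMiddle (foot x)
      same-foot : ∀ x y → 0 ℕ.< height x → 0 ℕ.< height y → foot x ≡ foot y

    height-injective : ∀ {x y} → 0 ℕ.< height x → height x ≡ height y → x ≡ y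
    height-injective {x} {y} 0<h e = d≡0⇒≡ (trans (d-exact x y)
      (cong₂ ℕ._+_ (ℕ.m≡n⇒∣m-n∣≡0 e) (ℕ.m≡n⇒∣m-n∣≡0 (cong toℕ (same-foot x y 0<h (subst (0 ℕ.<_) e 0<h))))))

    -- The converse of `M-suc`: by `height-injective` only one vertex has height `suc t`, so at most
    -- one is lost on passing to the next level.
    M-pred : ∀ t → M t ℕ.≤ suc (M (suc t))
    M-pred t with M t ℕ.≟ 0
    ... | yes M≡0 = ℕ.≤-trans (ℕ.≤-reflexive M≡0) z≤n
    ... | no M≢0 with ∃-height M≢0
    ...   | x , h≡1+t = subst₂ ℕ._≤_ (sym (M-∑ t)) (cong suc (sym (M-∑ (suc t)))) (sumℕ-≤-except x others
                          (ℕ.≤-trans (ℕ.≤-reflexive (indicator-yes (t ℕ.<? height x) (ℕ.≤-reflexive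
                              (sym h≡1+t)))) (s≤s z≤n)))
      where
      others : ∀ y → y ≢ x → indicator (t ℕ.<? height y) ℕ.≤ indicator (suc t ℕ.<? height y)
      others y y≢x = by-cases (t ℕ.<? height y)
        where
        by-cases : Dec (t ℕ.< height y) → indicator (t ℕ.<? height y) ℕ.≤ indicator (suc t ℕ.<? height y)
        by-cases (no t≮h)  = ℕ.≤-trans (ℕ.≤-reflexive (indicator-no (t ℕ.<? height y) t≮h)) z≤n
        by-cases (yes t<h) = ℕ.≤-reflexive (trans (indicator-yes (t ℕ.<? height y) t<h)
            (sym (indicator-yes (suc t ℕ.<? height y)
          (ℕ.≤∧≢⇒< t<h λ e → y≢x (height-injective (ℕ.≤-<-trans z≤n t<h) (trans (sym e) (sym h≡1+t)))))))

    M≡m∸ : ∀ t → M t ≡ m ∸ t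
    M≡m∸ t = ℕ.≤-antisym (M≤m∸ t) (lower t)
      where
      lower : ∀ t → m ∸ t ℕ.≤ M t
      lower zero    = ℕ.≤-reflexive (sym M0≡m)
      lower (suc t) = ℕ.≤-trans (ℕ.≤-reflexive (sym (ℕ.pred[m∸n]≡m∸[1+n] m t))) (ℕ.pred-mono-≤
          (ℕ.≤-trans (lower t) (M-pred t)))

  private
    N K C : ℚ
    N = ι n
    K = ι k
    C = ι (suc k)

    0≤N-1 : 0ℚ ≤ N - 1ℚ
    0≤N-1 = p≤q⇒0≤q-p (ι-mono {1} {n} (subst (1 ℕ.≤_) (sym n≡c+M) (s≤s z≤n)))

    0≤4C : 0ℚ ≤ ι 4 * C
    0≤4C = 0≤* (0≤ι 4) (0≤ι (suc k))

    ι[1+_]≢0 : ∀ j → ι (suc j) ≢ 0ℚ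
    ι[1+ j ]≢0 e with ι-injective {suc j} {0} e
    ... | ()

    *-≢0 : ∀ {x y} → x ≢ 0ℚ → y ≢ 0ℚ → x * y ≢ 0ℚ
    *-≢0 {x} x≢0 y≢0 e = y≢0 (*-cancelˡ x≢0 (trans e (sym (ℚ.*-zeroʳ x))))

    *≡0⇒ : ∀ {x y} → x ≢ 0ℚ → x * y ≡ 0ℚ → y ≡ 0ℚ
    *≡0⇒ {x} x≢0 e = *-cancelˡ x≢0 (trans e (sym (ℚ.*-zeroʳ x)))

    C≢0 : C ≢ 0ℚ
    C≢0 = ι[1+ k ]≢0

    4C≢0 : ι 4 * C ≢ 0ℚ
    4C≢0 = *-≢0 {ι 4} (λ ()) C≢0

    N≢0 : N ≢ 0ℚ
    N≢0 e = ι[1+ k ℕ.+ M 0 ]≢0 (trans (cong ι (sym n≡c+M)) e)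

    off-yes : ∀ {x} → 0 ℕ.< height x → off x ≡ 1ℚ
    off-yes {x} 0<h = ⟦⟧-yes (0 ℕ.<? height x) 0<h

    off-no : ∀ {x} → ¬ 0 ℕ.< height x → off x ≡ 0ℚ
    off-no {x} 0≮h = ⟦⟧-no (0 ℕ.<? height x) 0≮h

    offset-ι : ∀ i → offset i ≡ ι (ℕ.∣ toℕ i ℕ.+ toℕ i - k ∣ ℕ.* ℕ.∣ toℕ i ℕ.+ toℕ i - k ∣)
    offset-ι i = trans (offset-def i) (trans (cong (λ x → (x - K) * (x - K)) (trans (double (ι (toℕ i)))
        (sym (ι-+ (toℕ i) (toℕ i)))))
                   (sym (ι-∣-∣² (toℕ i ℕ.+ toℕ i) k)))
      where
      double : ∀ x → ι 2 * x ≡ x + x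
      double = solve-∀ ℚ-ring

    0≤gap : ∀ i j → 0ℚ ≤ gap i j
    0≤gap i j = subst (0ℚ ≤_) (sym (gap-def i j)) (0≤+ (0≤* 0≤4C (0≤ι ℕ.∣ toℕ i - toℕ j ∣)) (0≤* (0≤* (0≤ι 4) 0≤N-1)
        (0≤p*p (ι (toℕ i) - ι (toℕ j)))))

    gap≡0⇒≡ : ∀ {i j} → gap i j ≡ 0ℚ → i ≡ j
    gap≡0⇒≡ {i} {j} e = Fin.toℕ-injective (ℕ.∣m-n∣≡0⇒m≡n (ι-injective {_} {0} (*≡0⇒ 4C≢0
      (0≤+≡0⇒≡0ˡ (0≤* 0≤4C (0≤ι ℕ.∣ toℕ i - toℕ j ∣)) (0≤* (0≤* (0≤ι 4) 0≤N-1) (0≤p*p (ι (toℕ i) - ι (toℕ j)))) (trans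
          (sym (gap-def i j)) e)))))

    gap-diag : ∀ i → gap i i ≡ 0ℚ
    gap-diag i = trans (gap-def i i) (trans (cong (λ s → ι 4 * C * ι s + ι 4 * (N - 1ℚ) * ((ι (toℕ i) - ι (toℕ i)) * (ι
        (toℕ i) - ι (toℕ i)))) (ℕ.∣n-n∣≡0 (toℕ i))) (lemma C N (ι (toℕ i))))
      where
      lemma : ∀ C N x → ι 4 * C * 0ℚ + ι 4 * (N - 1ℚ) * ((x - x) * (x - x)) ≡ 0ℚ
      lemma = solve-∀ ℚ-ring

    -- `2i - k` has the parity of `k`, so its square is at least 1 when `k` is odd.
    offset-parity : ∀ i → ι (parity k) ≤ offset i
    offset-parity i = subst (ι (parity k) ≤_) (sym (offset-ι i)) (ι-mono
      (subst (ℕ._≤ ℕ.∣ toℕ i ℕ.+ toℕ i - k ∣ ℕ.* ℕ.∣ toℕ i ℕ.+ toℕ i - k ∣) (parity-gap (toℕ i) k)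
          (parity≤square ℕ.∣ toℕ i ℕ.+ toℕ i - k ∣)))

    0≤E : 0ℚ ≤ E
    0≤E = ∑-nonNeg λ x → ∑-nonNeg (0≤e x)

    0≤L : 0ℚ ≤ L
    0≤L = ∑-nonNeg {m} λ t → p≤q⇒0≤q-p (ι-mono (ℕ.*-mono-≤ (M≤m∸ (toℕ t)) (ℕ.pred-mono-≤ (M≤m∸ (toℕ t)))))

    0≤Mid : ∀ x → 0ℚ ≤ off x * (offset (foot x) - ι (parity k))
    0≤Mid x = 0≤* (0≤off x) (p≤q⇒0≤q-p (offset-parity (foot x)))

    0≤P : ∀ x y → 0ℚ ≤ off y * gap (foot x) (foot y)
    0≤P x y = 0≤* (0≤off y) (0≤gap (foot x) (foot y))

    0≤P′ : ∀ x → 0ℚ ≤ off x * ∑[ y < n ] (off y * gap (foot x) (foot y))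
    0≤P′ x = 0≤* (0≤off x) (∑-nonNeg (0≤P x))

    0≤2CN : 0ℚ ≤ ι 2 * C * N
    0≤2CN = 0≤* (0≤* (0≤ι 2) (0≤ι (suc k))) (0≤ι n)

    0≤₁ : 0ℚ ≤ ι 4 * C * E
    0≤₁ = 0≤* 0≤4C 0≤E
    0≤₂ : 0ℚ ≤ ι 8 * C * L
    0≤₂ = 0≤* (0≤* (0≤ι 8) (0≤ι (suc k))) 0≤L
    0≤₃ : 0ℚ ≤ ι 2 * C * N * Mid
    0≤₃ = 0≤* 0≤2CN (∑-nonNeg 0≤Mid)
    0≤₄ : 0ℚ ≤ P
    0≤₄ = ∑-nonNeg 0≤P′

  0≤deficit : 0ℚ ≤ deficit
  0≤deficit = 0≤+ (0≤+ (0≤+ 0≤₁ 0≤₂) 0≤₃) 0≤₄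

  -- Exact distances come from `E`, middle feet from `Mid` and coinciding feet from `P`, each a sum
  -- of nonnegative terms.
  deficit≡0⇒rigid : deficit ≡ 0ℚ → Rigid
  deficit≡0⇒rigid deficit≡0 = record
    { d-exact   = λ x y → ι-injective (trans (sym (dist-ι x y)) (trans (p-q≡0⇒p≡q (∑-nonNeg-≡0 (0≤e x) (∑-nonNeg-≡0
        (λ x → ∑-nonNeg (0≤e x)) E≡0 x) y)) (sym (ι-+ ℕ.∣ height x - height y ∣ ℕ.∣ toℕ (foot x) - toℕ (foot y) ∣))))
    ; middle    = λ x 0<h → gap≤1⇒middle (foot x) (parity≡square⇒≤1 _ (ι-injective (trans (sym (offset-ι (foot x)))
                    (trans (p-q≡0⇒p≡q (drop-off 0<h (∑-nonNeg-≡0 0≤Mid Mid≡0 x))) (cong ι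
                        (sym (parity-gap (toℕ (foot x)) k)))))))
    ; same-foot = λ x y 0<hx 0<hy → gap≡0⇒≡ (drop-off 0<hy (∑-nonNeg-≡0 (0≤P x) (drop-off 0<hx
        (∑-nonNeg-≡0 0≤P′ P≡0 x)) y))
    }
    where
    drop-off : ∀ {x y} → 0 ℕ.< height x → off x * y ≡ 0ℚ → y ≡ 0ℚ
    drop-off {x} {y} 0<h e = trans (sym (ℚ.*-identityˡ y)) (trans (cong (_* y) (sym (off-yes 0<h))) e)
    ₁₂₃≡0 : ι 4 * C * E + ι 8 * C * L + ι 2 * C * N * Mid ≡ 0ℚ
    ₁₂₃≡0 = 0≤+≡0⇒≡0ˡ (0≤+ (0≤+ 0≤₁ 0≤₂) 0≤₃) 0≤₄ deficit≡0
    P≡0 : P ≡ 0ℚ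
    P≡0 = 0≤+≡0⇒≡0ʳ (0≤+ (0≤+ 0≤₁ 0≤₂) 0≤₃) 0≤₄ deficit≡0
    Mid≡0 : Mid ≡ 0ℚ
    Mid≡0 = *≡0⇒ (*-≢0 (*-≢0 {ι 2} (λ ()) C≢0) N≢0) (0≤+≡0⇒≡0ʳ (0≤+ 0≤₁ 0≤₂) 0≤₃ ₁₂₃≡0)
    E≡0 : E ≡ 0ℚ
    E≡0 = *≡0⇒ 4C≢0 (0≤+≡0⇒≡0ˡ 0≤₁ 0≤₂ (0≤+≡0⇒≡0ˡ (0≤+ 0≤₁ 0≤₂) 0≤₃ ₁₂₃≡0))

  -- `L` vanishes by `M≡m∸`: rigidity forces the level counts of a pendant path.
  rigid⇒deficit≡0 : Rigid → deficit ≡ 0ℚ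
  rigid⇒deficit≡0 rigid = trans (cong₂ _+_ (cong₂ _+_ (cong₂ (λ s t → ι 4 * C * s + ι 8 * C * t) E≡0 L≡0)
      (cong (ι 2 * C * N *_) Mid≡0)) P≡0) (lemma C N)
    where
    open Rigid rigid
    lemma : ∀ C N → ι 4 * C * 0ℚ + ι 8 * C * 0ℚ + ι 2 * C * N * 0ℚ + 0ℚ ≡ 0ℚ
    lemma = solve-∀ ℚ-ring
    p≡q⇒p-q≡0 : ∀ {p q} → p ≡ q → p - q ≡ 0ℚ
    p≡q⇒p-q≡0 {p} refl = ℚ.+-inverseʳ p
    off-∣ : ∀ x {y} → (0 ℕ.< height x → y ≡ 0ℚ) → off x * y ≡ 0ℚ
    off-∣ x {y} f = by-cases (0 ℕ.<? height x)
      where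
      by-cases : Dec (0 ℕ.< height x) → off x * y ≡ 0ℚ
      by-cases (yes 0<h) = trans (cong (off x *_) (f 0<h)) (ℚ.*-zeroʳ (off x))
      by-cases (no 0≮h)  = trans (cong (_* y) (off-no 0≮h)) (ℚ.*-zeroˡ y)
    E≡0 : E ≡ 0ℚ
    E≡0 = ∑∑-0 λ x y → p≡q⇒p-q≡0 (trans (dist-ι x y) (trans (cong ι (d-exact x y))
        (ι-+ ℕ.∣ height x - height y ∣ ℕ.∣ toℕ (foot x) - toℕ (foot y) ∣)))
    L≡0 : L ≡ 0ℚ
    L≡0 = ∑-0 {m} λ t → p≡q⇒p-q≡0 (cong (λ j → ι (j ℕ.* ℕ.pred j)) (sym (M≡m∸ (toℕ t))))
    Mid≡0 : Mid ≡ 0ℚ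
    Mid≡0 = ∑-0 λ x → off-∣ x λ 0<h → p≡q⇒p-q≡0 (trans (offset-ι (foot x))
        (cong ι (middle⇒square (foot x) (middle x 0<h))))
    P≡0 : P ≡ 0ℚ
    P≡0 = ∑-0 λ x → off-∣ x λ 0<hx → ∑-0 λ y → off-∣ y λ 0<hy →
      trans (cong (gap (foot x)) (sym (same-foot x y 0<hx 0<hy))) (gap-diag (foot x))

-- Extremal trees

-- Supplies the vertex of attachment when no vertex lies off the path and the pendant path is a
-- single vertex.
∃-middle : ∀ k → ∃[ x ] IsMiddle {suc k} x
∃-middle k with halve k
  where
  halve : ∀ k → ∃[ i ] i ℕ.≤ k × ℕ.∣ i ℕ.+ i - k ∣ ℕ.≤ 1
  halve zero          = 0 , z≤n , z≤n
  halve (suc zero)    = 0 , z≤n , s≤s z≤n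
  halve (suc (suc k)) with halve k
  ... | i , i≤k , gap≤1 = suc i , s≤s (ℕ.m≤n⇒m≤1+n i≤k) , subst (λ s → ℕ.∣ s - suc k ∣ ℕ.≤ 1) (sym (ℕ.+-suc i i)) gap≤1
... | i , i≤k , gap≤1 = fromℕ< (s≤s i≤k) , gap≤1⇒middle (fromℕ< (s≤s i≤k)) (subst (λ s → ℕ.∣ s ℕ.+ s - k ∣ ℕ.≤ 1)
    (sym (Fin.toℕ-fromℕ< (s≤s i≤k))) gap≤1)

pathGraph-gap : ∀ {m} {i j : Fin m} → Adj (pathGraph m) i j → ℕ.∣ toℕ i - toℕ j ∣ ≡ 1
pathGraph-gap {i = i} {j} (inj₁ e) = trans (cong ℕ.∣ toℕ i -_∣ (trans (sym e) (ℕ.+-comm 1 (toℕ i))))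
    (ℕ.∣m-m+n∣≡n (toℕ i) 1)
pathGraph-gap {i = i} {j} (inj₂ e) = trans (ℕ.∣-∣-comm (toℕ i) (toℕ j)) (pathGraph-gap {i = j} {i} (inj₁ e))

gap-pathGraph : ∀ {m} {i j : Fin m} → ℕ.∣ toℕ i - toℕ j ∣ ≡ 1 → Adj (pathGraph m) i j
gap-pathGraph {i = i} {j} e with ℕ.≤-total (toℕ i) (toℕ j)
... | inj₁ i≤j = inj₁ (trans (cong (ℕ._+ toℕ i) (trans (sym e) (ℕ.m≤n⇒∣m-n∣≡n∸m i≤j))) (ℕ.m∸n+n≡m i≤j))
... | inj₂ j≤i = inj₂ (trans (cong (ℕ._+ toℕ j) (trans (sym e) (ℕ.m≤n⇒∣n-m∣≡n∸m j≤i))) (ℕ.m∸n+n≡m j≤i))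

module Extremality {n} (T : Graph n) (tree : IsTree T) {k} (p : Fin (suc k) → Fin n)
                   (path : IsPath T (p zero) (p (fromℕ k)) p) where
  open TreeDistance T tree
  open PathProjection T tree p path
  open Deficit T tree p path using (m; M; ∃-height; height≤m)
  open Rigidity T tree p path
  open IsPath path

  0≢height⇒0< : ∀ {x} → height x ≢ 0 → 0 ℕ.< height x
  0≢height⇒0< = ℕ.n≢0⇒n>0

  module RigidTree (rigid : Rigid) where
    open Rigid rigid

    private
      common-foot : ∃[ x₀ ] IsMiddle x₀ × (∀ v → 0 ℕ.< height v → foot v ≡ x₀)
      common-foot with Fin.any? (λ v → 0 ℕ.<? height v)
      ... | yes (v , 0<h) = foot v , middle v 0<h , λ w 0<hw → same-foot w v 0<hw 0<h
      ... | no none with ∃-middle k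
      ...   | x₀ , mid = x₀ , mid , λ v 0<h → contradiction (v , 0<h) none

      x₀ : Fin (suc k)
      x₀ = proj₁ common-foot

      at-level : ∀ (j : Fin m) → ∃[ v ] height v ≡ suc (toℕ j)
      at-level j = ∃-height λ M≡0 → ℕ.<⇒≢ (ℕ.m<n⇒0<n∸m (Fin.toℕ<n j)) (sym (trans (sym (M≡m∸ (toℕ j))) M≡0))

      q : Fin (suc m) → Fin n
      q zero    = p x₀
      q (suc j) = proj₁ (at-level j)

      height-q : ∀ j → height (q j) ≡ toℕ j
      height-q zero    = height-path x₀
      height-q (suc j) = proj₂ (at-level j)

      foot-q : ∀ j → foot (q j) ≡ x₀
      foot-q zero    = foot-path x₀
      foot-q (suc j) = proj₂ (proj₂ common-foot) (q (suc j)) (subst (0 ℕ.<_) (sym (height-q (suc j))) (s≤s z≤n))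

      q-injective : ∀ {i j} → q i ≡ q j → i ≡ j
      q-injective {i} {j} e = Fin.toℕ-injective (trans (sym (height-q i)) (trans (cong height e) (height-q j)))

      Cover : Fin n → Set
      Cover v = (∃[ i ] p i ≡ v) ⊎ (∃[ j ] q j ≡ v)

      cover : ∀ v → Cover v
      cover v with height v in eq
      ... | zero  = inj₁ (foot v , height≡0⇒ eq)
      ... | suc t = inj₂ (suc j , height-injective (subst (0 ℕ.<_) (sym (height-q (suc j))) (s≤s z≤n))
                             (trans (height-q (suc j)) (trans (cong suc (Fin.toℕ-fromℕ< t<m)) (sym eq))))
        where
        t<m : t ℕ.< m
        t<m = subst (ℕ._≤ m) eq (height≤m v)
        j : Fin m
        j = fromℕ< t<m

      d-p-q : ∀ i j → d (p i) (q j) ≡ toℕ j ℕ.+ ℕ.∣ toℕ i - toℕ x₀ ∣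
      d-p-q i j = trans (d-exact (p i) (q j)) (cong₂ ℕ._+_
        (trans (cong₂ ℕ.∣_-_∣ (height-path i) (height-q j)) (ℕ.∣-∣-identityˡ (toℕ j)))
        (cong₂ (λ a b → ℕ.∣ toℕ a - toℕ b ∣) (foot-path i) (foot-q j)))

      d-q-q : ∀ i j → d (q i) (q j) ≡ ℕ.∣ toℕ i - toℕ j ∣
      d-q-q i j = trans (d-exact (q i) (q j)) (trans (cong₂ ℕ._+_ (cong₂ ℕ.∣_-_∣ (height-q i) (height-q j))
        (ℕ.m≡n⇒∣m-n∣≡0 (cong toℕ (trans (foot-q i) (sym (foot-q j)))))) (ℕ.+-identityʳ _))

      Edges : Fin n → Fin n → Set
      Edges u v = (∃[ i ] ∃[ j ] Adj (pathGraph (suc k)) i j × p i ≡ u × p j ≡ v)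
                ⊎ (∃[ i ] ∃[ j ] Adj (pathGraph (suc m)) i j × q i ≡ u × q j ≡ v)

      edges-sym : ∀ {u v} → Edges u v → Edges v u
      edges-sym (inj₁ (i , j , a , e , f)) = inj₁ (j , i , Graph.Adj-sym (pathGraph (suc k)) {i} {j} a , f , e)
      edges-sym (inj₂ (i , j , a , e , f)) = inj₂ (j , i , Graph.Adj-sym (pathGraph (suc m)) {i} {j} a , f , e)

      -- Either `j` is 0, so that `q j` is the glued vertex and the edge lies on `p`, or the formula
      -- for the distance forces `j = 1` and `i = x₀`, the first edge of `q`.
      mixed-edge : ∀ i j → d (p i) (q j) ≡ 1 → Edges (p i) (q j)
      mixed-edge i zero    e = inj₁ (i , x₀ , gap-pathGraph {i = i} {x₀} (trans (sym (d-p-q i zero)) e) , refl , refl)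
      mixed-edge i (suc j) e = inj₂ (zero , suc j , inj₁ (cong suc (sym j≡0)) , cong p (sym i≡x₀) , refl)
        where
        sum≡0 : toℕ j ℕ.+ ℕ.∣ toℕ i - toℕ x₀ ∣ ≡ 0
        sum≡0 = ℕ.suc-injective (trans (sym (d-p-q i (suc j))) e)
        j≡0 : toℕ j ≡ 0
        j≡0 = ℕ.m+n≡0⇒m≡0 (toℕ j) sum≡0
        i≡x₀ : i ≡ x₀
        i≡x₀ = Fin.toℕ-injective (ℕ.∣m-n∣≡0⇒m≡n (ℕ.m+n≡0⇒n≡0 (toℕ j) sum≡0))

      edge⇒ : ∀ {u v} → Cover u → Cover v → Adj T u v → Edges u v
      edge⇒ (inj₁ (i , refl)) (inj₁ (j , refl)) a = inj₁ (i , j , gap-pathGraph {i = i} {j} (trans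
          (sym (d-path-path i j)) (adj⇒d≡1 a)) , refl , refl)
      edge⇒ (inj₁ (i , refl)) (inj₂ (j , refl)) a = mixed-edge i j (adj⇒d≡1 a)
      edge⇒ (inj₂ (i , refl)) (inj₁ (j , refl)) a = edges-sym (mixed-edge j i (adj⇒d≡1 (Graph.Adj-sym T a)))
      edge⇒ (inj₂ (i , refl)) (inj₂ (j , refl)) a = inj₂ (i , j , gap-pathGraph {i = i} {j} (trans
          (sym (d-q-q i j)) (adj⇒d≡1 a)) , refl , refl)

      edge⇐ : ∀ {u v} → Edges u v → Adj T u v
      edge⇐ (inj₁ (i , j , a , refl , refl)) = d≡1⇒adj (trans (d-path-path i j) (pathGraph-gap {i = i} {j} a))
      edge⇐ (inj₂ (i , j , a , refl , refl)) = d≡1⇒adj (trans (d-q-q i j) (pathGraph-gap {i = i} {j} a))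

    extremal : IsExtremal T p
    extremal = x₀ , proj₁ (proj₂ common-foot) , zero , inj₁ refl , q , record
      { f-injective = injective
      ; g-injective = q-injective
      ; glue        = refl
      ; glue-only   = λ {i} {j} e → trans (sym (foot-path i)) (trans (cong foot e) (foot-q j)) ,
                                    Fin.toℕ-injective (trans (sym (height-q j)) (trans (cong height
                                        (sym e)) (height-path i)))
      ; cover       = cover
      ; edges       = λ u v → mk⇔ (edge⇒ (cover u) (cover v)) edge⇐
      }

  -- Here `q` starts at the glued vertex; the other orientation is reduced to this one by reversal.
  module PendantPath {l} (q : Fin (suc l) → Fin n) (x : Fin (suc k)) (q0≡px : q zero ≡ p x)
                     (q-injective : ∀ {i j} → q i ≡ q j → i ≡ j)
                     (q-adjacent : ∀ (j : Fin l) → Adj T (q (inject₁ j)) (q (suc j)))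
                     (glue-only : ∀ {i j} → p i ≡ q j → j ≡ zero)
                     (cover : ∀ v → (∃[ i ] p i ≡ v) ⊎ (∃[ j ] q j ≡ v))
                     (mid : IsMiddle x) where

    private
      q-path : IsPath T (q zero) (q (fromℕ l)) q
      q-path = record { injective = q-injective ; adjacent = q-adjacent ; start = refl ; end = refl }

      d-q0 : ∀ b → d (q zero) (p b) ≡ ℕ.∣ toℕ x - toℕ b ∣
      d-q0 b = trans (cong (λ v → d v (p b)) q0≡px) (d-path-path x b)

      -- By d-lower, q 1 has height 1 and foot x.
      first-step : ∀ {l′} (q : Fin (suc (suc l′)) → Fin n) → q zero ≡ p x → Adj T (q zero) (q (suc zero)) →
                   (∀ {i j} → p i ≡ q j → j ≡ zero) → ∀ b → d (q (suc zero)) (p b) ≡ suc (d (q zero) (p b))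
      first-step q q0≡px a only b = trans (d-path q₁ b) (trans (cong₂ (λ h f → h ℕ.+ ℕ.∣ toℕ f - toℕ b ∣) h≡1 f≡x)
                                      (cong suc (sym (trans (cong (λ v → d v (p b)) q0≡px) (d-path-path x b)))))
        where
        q₁ = q (suc zero)
        0<h : 0 ℕ.< height q₁
        0<h = 0≢height⇒0< λ h≡0 → contradiction (only (height≡0⇒ h≡0)) λ ()
        le : height q₁ ℕ.+ ℕ.∣ toℕ (foot q₁) - toℕ x ∣ ℕ.≤ 1
        le = ℕ.≤-reflexive (trans (sym (d-path q₁ x)) (adj⇒d≡1 (subst (Adj T q₁) q0≡px (Graph.Adj-sym T a))))
        h≡1 : height q₁ ≡ 1
        h≡1 = ℕ.≤-antisym (ℕ.≤-trans (ℕ.m≤m+n _ _) le) 0<h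
        f≡x : foot q₁ ≡ x
        f≡x = Fin.toℕ-injective (ℕ.∣m-n∣≡0⇒m≡n (ℕ.n≤0⇒n≡0 (ℕ.s≤s⁻¹ (subst
            (λ h → h ℕ.+ ℕ.∣ toℕ (foot q₁) - toℕ x ∣ ℕ.≤ 1) h≡1 le))))

      -- Once the first edge of `q` leads away from `p b`, `keeps-receding` propagates this along
      -- the whole of `q`.
      recedes : ∀ {l} (q : Fin (suc l) → Fin n) → q zero ≡ p x → (∀ {i j} → q i ≡ q j → i ≡ j) →
                (∀ (j : Fin l) → Adj T (q (inject₁ j)) (q (suc j))) → (∀ {i j} → p i ≡ q j → j ≡ zero) →
                ∀ b (j : Fin l) → d (q (suc j)) (p b) ≡ suc (d (q (inject₁ j)) (p b))
      recedes {suc l} q q0≡px inj adj only b = <-weakInduction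
          (λ j → d (q (suc j)) (p b) ≡ suc (d (q (inject₁ j)) (p b)))
        (first-step q q0≡px (adj zero) only b)
        (λ j e → keeps-receding (p b) (adj (inject₁ j)) (adj (suc j)) (λ same → apart j (inj same)) e)
        where
        apart : ∀ (j : Fin l) → inject₁ (inject₁ j) ≢ suc (suc j)
        apart j e = ℕ.<⇒≢ (ℕ.m≤n⇒m≤1+n (s≤s (ℕ.≤-refl {toℕ j}))) (trans (sym
            (trans (Fin.toℕ-inject₁ (inject₁ j)) (Fin.toℕ-inject₁ j))) (cong toℕ e))

      d-q-p : ∀ j b → d (q j) (p b) ≡ toℕ j ℕ.+ ℕ.∣ toℕ x - toℕ b ∣
      d-q-p j b = <-weakInduction (λ j → d (q j) (p b) ≡ toℕ j ℕ.+ ℕ.∣ toℕ x - toℕ b ∣) (d-q0 b)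
        (λ j e → trans (recedes q q0≡px q-injective q-adjacent glue-only b j)
                       (cong suc (trans e (cong (ℕ._+ ℕ.∣ toℕ x - toℕ b ∣) (Fin.toℕ-inject₁ j))))) j

      d-q-q : ∀ i j → d (q i) (q j) ≡ ℕ.∣ toℕ i - toℕ j ∣
      d-q-q = PathProjection.d-path-path T tree q q-path

      module _ (j : Fin (suc l)) where
        s : ℕ
        s = ℕ.∣ toℕ x - toℕ (foot (q j)) ∣

        height≡j+s : height (q j) ≡ toℕ j ℕ.+ s
        height≡j+s = trans (sym (trans (d-path (q j) (foot (q j))) (trans (cong (height (q j) ℕ.+_)
            (ℕ.∣n-n∣≡0 (toℕ (foot (q j))))) (ℕ.+-identityʳ _)))) (d-q-p j (foot (q j)))

        height+s≡j : height (q j) ℕ.+ s ≡ toℕ j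
        height+s≡j = trans (cong (height (q j) ℕ.+_) (ℕ.∣-∣-comm (toℕ x) (toℕ (foot (q j))))) (trans
            (sym (d-path (q j) x))
          (trans (d-q-p j x) (trans (cong (toℕ j ℕ.+_) (ℕ.∣n-n∣≡0 (toℕ x))) (ℕ.+-identityʳ _))))

        -- The distance from `q j` to its foot gives `height = j + s`, the distance to `p x` gives
        -- `height + s = j`; together `2s = 0`.
        s≡0 : s ≡ 0
        s≡0 = ℕ.m+n≡0⇒m≡0 s (ℕ.+-cancelˡ-≡ (toℕ j) _ _ (trans (sym (ℕ.+-assoc (toℕ j) s s)) (trans (cong (ℕ._+ s)
            (sym height≡j+s)) (trans height+s≡j (sym (ℕ.+-identityʳ (toℕ j)))))))

        height-q : height (q j) ≡ toℕ j
        height-q = trans height≡j+s (trans (cong (toℕ j ℕ.+_) s≡0) (ℕ.+-identityʳ _))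

        foot-q : foot (q j) ≡ x
        foot-q = Fin.toℕ-injective (sym (ℕ.∣m-n∣≡0⇒m≡n s≡0))

      off⇒foot≡x : ∀ v → 0 ℕ.< height v → foot v ≡ x
      off⇒foot≡x v 0<h with cover v
      ... | inj₁ (i , refl) = contradiction (sym (height-path i)) (ℕ.<⇒≢ 0<h)
      ... | inj₂ (j , refl) = foot-q j

      exact : ∀ v w → d v w ≡ ℕ.∣ height v - height w ∣ ℕ.+ ℕ.∣ toℕ (foot v) - toℕ (foot w) ∣
      exact v w with cover v | cover w
      ... | inj₁ (i , refl) | inj₁ (j , refl) = trans (d-path-path i j) (sym (cong₂ ℕ._+_
        (cong₂ ℕ.∣_-_∣ (height-path i) (height-path j)) (cong₂
            (λ a b → ℕ.∣ toℕ a - toℕ b ∣) (foot-path i) (foot-path j))))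
      ... | inj₁ (i , refl) | inj₂ (j , refl) = trans (d-sym (p i) (q j)) (trans (d-q-p j i) (sym (cong₂ ℕ._+_
        (trans (cong₂ ℕ.∣_-_∣ (height-path i) (height-q j)) (ℕ.∣-∣-identityˡ (toℕ j)))
        (trans (cong₂ (λ a b → ℕ.∣ toℕ a - toℕ b ∣) (foot-path i) (foot-q j)) (ℕ.∣-∣-comm (toℕ i) (toℕ x))))))
      ... | inj₂ (i , refl) | inj₁ (j , refl) = trans (d-q-p i j) (sym (cong₂ ℕ._+_
        (trans (cong₂ ℕ.∣_-_∣ (height-q i) (height-path j)) (ℕ.∣-∣-identityʳ (toℕ i)))
        (cong₂ (λ a b → ℕ.∣ toℕ a - toℕ b ∣) (foot-q i) (foot-path j))))
      ... | inj₂ (i , refl) | inj₂ (j , refl) = trans (d-q-q i j) (sym (trans (cong₂ ℕ._+_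
        (cong₂ ℕ.∣_-_∣ (height-q i) (height-q j)) (trans (cong₂ (λ a b → ℕ.∣ toℕ a - toℕ b ∣) (foot-q i) (foot-q j))
            (ℕ.∣n-n∣≡0 (toℕ x)))) (ℕ.+-identityʳ _)))

    rigid : Rigid
    rigid = record
      { d-exact   = exact
      ; middle    = λ v 0<h → subst IsMiddle (sym (off⇒foot≡x v 0<h)) mid
      ; same-foot = λ v w 0<hv 0<hw → trans (off⇒foot≡x v 0<hv) (sym (off⇒foot≡x w 0<hw))
      }

  extremal⇒rigid : IsExtremal T p → Rigid
  extremal⇒rigid (x , mid , y , inj₁ refl , q , ident) = PendantPath.rigid q x (sym glue) g-injective
    (λ j → Equivalence.from (edges _ _) (inj₂ (inject₁ j , suc j , inj₁ (cong suc (Fin.toℕ-inject₁ j)) , refl , refl)))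
    (proj₂ ∘ glue-only) cover mid
    where open IsIdentification ident
  -- The glued vertex is the last one of the pendant path, which is therefore traversed backwards.
  extremal⇒rigid (x , mid , y , inj₂ refl , q , ident) = PendantPath.rigid (q ∘ opposite) x (sym glue)
    (λ e → trans (sym (Fin.opposite-involutive _)) (trans (cong opposite (g-injective e)) (Fin.opposite-involutive _)))
    (λ j → Equivalence.from (edges _ _) (inj₂ (opposite (inject₁ j) , opposite (suc j) , inj₂
        (successive j) , refl , refl)))
    (λ {i} {j} e → trans (sym (Fin.opposite-involutive j)) (trans
        (cong opposite (proj₂ (glue-only e))) (Fin.opposite-involutive zero)))
    cover′ mid
    where
    open IsIdentification ident
    successive : ∀ (j : Fin m) → suc (toℕ (opposite (suc j))) ≡ toℕ (opposite (inject₁ j))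
    successive j = trans (cong suc (Fin.opposite-prop (suc j))) (trans (sym (ℕ.+-∸-assoc 1 (Fin.toℕ<n j)))
      (sym (trans (Fin.opposite-prop (inject₁ j)) (cong (m ∸_) (Fin.toℕ-inject₁ j)))))
    cover′ : ∀ v → (∃[ i ] p i ≡ v) ⊎ (∃[ j ] q (opposite j) ≡ v)
    cover′ v with cover v
    ... | inj₁ on       = inj₁ on
    ... | inj₂ (j , e)  = inj₂ (opposite j , trans (cong q (Fin.opposite-involutive j)) e)

theorem3p1 : ∀ (n : ℕ) → 4 ℕ.≤ n →
    ∀ (T : Graph n) → IsTree T →
    ∀ (v₁ v_c : Fin n) (v₁≢v_c : v₁ ≢ v_c) → ¬ Adj T v₁ v_c →
    ∀ (k : ℕ) (p : Fin (suc k) → Fin n) → IsPath T v₁ v_c p →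
    ∀ (κG κT : ℚ) → IsKemeny (addEdge T v₁≢v_c) κG → IsKemeny T κT →
    (κG - κT ≤ bound n (suc k)) ×
    ((κG - κT ≡ bound n (suc k)) ⇔ IsExtremal T p)
theorem3p1 (suc zero) (s≤s ())
-- Two visible successors make `n ∸ 1`, and with it `D`, a successor, so that `D≢0` is an absurd
-- pattern.
theorem3p1 n@(suc (suc _)) 4≤n T tree v₁ v_c v₁≢v_c ¬adj k p path@record { start = refl ; end = refl } κG κT kemG kemT =
  0≤q-p⇒p≤q (subst (0ℚ ≤_) (sym slack) (0≤* 0≤r 0≤deficit)) ,
  mk⇔ (λ eq → RigidTree.extremal (deficit≡0⇒rigid (cancel (trans (sym slack) (trans (cong (_- (κG - κT)) (sym eq))
      (ℚ.+-inverseʳ (κG - κT)))))))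
      (λ ext → sym (p-q≡0⇒p≡q (trans slack (trans (cong (r *_) (rigid⇒deficit≡0 (extremal⇒rigid ext))) (ℚ.*-zeroʳ r)))))
  where
  open KemenyConstants T tree p path v₁≢v_c ¬adj
  open DeficitIdentity T tree p path
  open Rigidity T tree p path
  open Extremality T tree p path
  open ≡-Reasoning

  D : ℕ
  D = 4 ℕ.* suc k ℕ.* n ℕ.* (n ∸ 1)

  r B : ℚ
  r = recip D
  B = big (ι n) (ι (suc k)) (ι ⌊ suc (suc k) /2⌋) (ι ⌈ suc (suc k) /2⌉)

  D≢0 : D ≢ 0
  D≢0 ()

  ι-D : ι D ≡ ι 4 * ι (suc k) * ι n * (ι n - 1ℚ)
  ι-D = trans (ι-* (4 ℕ.* suc k ℕ.* n) (n ∸ 1)) (cong₂ _*_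
    (trans (ι-* (4 ℕ.* suc k) n) (cong (_* ι n) (ι-* 4 (suc k)))) (ι-∸ {1} {n} (s≤s z≤n)))

  0≤r : 0ℚ ≤ r
  0≤r = 0≤recip D

  -- Both claims are read off from this: `r` is nonnegative and invertible, so the sign and the
  -- vanishing of the slack are those of `deficit`.
  slack : bound n (suc k) - (κG - κT) ≡ r * deficit
  slack = begin
    bound n (suc k) - (κG - κT)
      ≡⟨ cong₂ _-_ (bound-big n (suc k)) (trans (sym (ℚ.*-identityˡ (κG - κT))) (trans (cong (_* (κG - κT))
          (sym (recip-* {D} D≢0))) (ℚ.*-assoc r (ι D) (κG - κT)))) ⟩
    r * B - r * (ι D * (κG - κT))
      ≡⟨ cong (λ s → r * B - r * s) (trans (cong (_* (κG - κT)) ι-D)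
          (trans (kemeny-difference kemG kemT) value-deficit)) ⟩
    r * B - r * (B - deficit)
      ≡⟨ factor r B deficit ⟩
    r * deficit ∎
    where
    factor : ∀ r B δ → r * B - r * (B - δ) ≡ r * δ
    factor = solve-∀ ℚ-ring

  cancel : r * deficit ≡ 0ℚ → deficit ≡ 0ℚ
  cancel e = begin
    deficit  ≡⟨ sym (ℚ.*-identityˡ deficit) ⟩
    1ℚ * deficit  ≡⟨ cong (_* deficit) (sym (recip-* {D} D≢0)) ⟩
    r * ι D * deficit     ≡⟨ swap r (ι D) deficit ⟩
    ι D * (r * deficit)   ≡⟨ cong (ι D *_) e ⟩
    ι D * 0ℚ  ≡⟨ ℚ.*-zeroʳ (ι D) ⟩
    0ℚ  ∎
    where
    swap : ∀ r d x → r * d * x ≡ d * (r * x)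
    swap = solve-∀ ℚ-ring
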